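{- Let $q$ be a prime power, $n\ge1$, and let $k$ be an integer with $1\le k\le n$ and $k\equiv 2 \pmod 4$. Let $U\subseteq H_n(\mathbb{F}_{q^2})$ be any constant rank-distance $k$ set. Then \[ |U|\le 1+\prod_{i=1}^k\left(q^{n-i+1}+(-1)^{n-i+1}\right). \]
   Context: $H_n(\mathbb{F}_{q^2})$ is the set of $n\times n$ hermitian matrices over $\mathbb{F}_{q^2}$ (matrices $A$ with $\overline{A}^T=A$, $\overline{\cdot}$ being $x\mapsto x^q$ entrywise). A constant rank-distance $k$ set is a set $U$ of $n\times n$ matrices with $\mathrm{rank}(A-B)=k$ for all distinct $A,B\in U$ and $\mathrm{rank}(A)=k$ for all nonzero $A\in U$. -}

module Defs where

open import Level using (Level; _⊔_)
open import Data.Nat as ℕ using (ℕ; zero; suc; _∸_; _%_)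
open import Data.Nat.Primality using (Prime)
open import Data.Integer as ℤ using (ℤ)
open import Data.Fin using (Fin; zero; suc)
open import Data.List using (List; length)
open import Data.List.Relation.Unary.Any using (Any)
open import Data.List.Relation.Unary.All using (All)
open import Data.List.Relation.Unary.AllPairs using (AllPairs)
open import Data.Product using (Σ; ∃; _×_)
open import Relation.Nullary using (¬_)
open import Relation.Binary.PropositionalEquality using (_≡_)
open import Relation.Binary.Definitions using (Decidable)
open import Function.Definitions using (Injective)
open import Algebra.Bundles using (CommutativeRing)

IsPrimePower : ℕ → Set
IsPrimePower q = Σ ℕ λ p → Σ ℕ λ m → Prime p × q ≡ p ℕ.^ suc m

record FiniteField (c ℓ : Level) : Set (Level.suc (c ⊔ ℓ)) where
  field
    commRing : CommutativeRing c ℓ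
  open CommutativeRing commRing public using (Carrier; _≈_; _+_; _*_; -_; _-_; 0#; 1#)
  field
    _≟_      : Decidable _≈_
    1≉0      : ¬ (1# ≈ 0#)
    inverse  : ∀ x → ¬ (x ≈ 0#) → ∃ λ y → (x * y) ≈ 1#
    elements : List Carrier
    complete : ∀ x → Any (x ≈_) elements
    distinct : AllPairs (λ x y → ¬ (x ≈ y)) elements

  size : ℕ
  size = length elements

  pow : Carrier → ℕ → Carrier
  pow x zero    = 1#
  pow x (suc m) = x * pow x m

  sumFin : ∀ {r} → (Fin r → Carrier) → Carrier
  sumFin {zero}  f = 0#
  sumFin {suc r} f = f zero + sumFin (λ j → f (suc j))

  Matrix : ℕ → Set c
  Matrix n = Fin n → Fin n → Carrier

  MatEq : ∀ {n} → Matrix n → Matrix n → Set ℓ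
  MatEq A B = ∀ i j → A i j ≈ B i j

  IsZeroMat : ∀ {n} → Matrix n → Set ℓ
  IsZeroMat A = ∀ i j → A i j ≈ 0#

  _⊖_ : ∀ {n} → Matrix n → Matrix n → Matrix n
  (A ⊖ B) i j = A i j - B i j

  LinIndep : ∀ {r n} → (Fin r → Fin n → Carrier) → Set (c ⊔ ℓ)
  LinIndep {r} {n} v =
    (coef : Fin r → Carrier) →
    (∀ i → sumFin (λ j → coef j * v j i) ≈ 0#) →
    ∀ j → coef j ≈ 0#

  HasIndepCols : ∀ {n} → Matrix n → ℕ → Set (c ⊔ ℓ)
  HasIndepCols {n} A r =
    Σ (Fin r → Fin n) λ σ → Injective _≡_ _≡_ σ × LinIndep (λ j i → A i (σ j))

  RankEq : ∀ {n} → Matrix n → ℕ → Set (c ⊔ ℓ)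
  RankEq A r = HasIndepCols A r × ¬ HasIndepCols A (suc r)

  -- Hermitian w.r.t. the involution x ↦ x^q (field of order q^2)
  Hermitian : ∀ {n} → ℕ → Matrix n → Set ℓ
  Hermitian q A = ∀ i j → A j i ≈ pow (A i j) q

  -- U (a finite set, as a duplicate-free list) is a constant rank-distance k set
  ConstRankDist : ∀ {n} → ℕ → List (Matrix n) → Set (c ⊔ ℓ)
  ConstRankDist k U =
    AllPairs (λ A B → RankEq (A ⊖ B) k) U ×
    All (λ A → ¬ IsZeroMat A → RankEq A k) U

  HermitianSet : ∀ {n} → ℕ → List (Matrix n) → Set (c ⊔ ℓ)
  HermitianSet q U = AllPairs (λ A B → ¬ MatEq A B) U × All (Hermitian q) U

negOnePow : ℕ → ℤ
negOnePow zero    = ℤ.+ 1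
negOnePow (suc m) = ℤ.- negOnePow m

prodFrom1 : ℕ → (ℕ → ℤ) → ℤ
prodFrom1 zero    f = ℤ.+ 1
prodFrom1 (suc k) f = prodFrom1 k f ℤ.* f (suc k)

bound : ℕ → ℕ → ℕ → ℤ
bound q n k = ℤ.+ 1 ℤ.+ prodFrom1 k (λ i → ℤ.+ (q ℕ.^ (n ∸ i ℕ.+ 1)) ℤ.+ negOnePow (n ∸ i ℕ.+ 1))

{-# OPTIONS --safe #-}
-- Delsarte's clique bound for the dual eigenvalue of the invertible hermitian matrices, with the characters
-- removed.  Write b = −q and h_A(x) = x* A x.  For a tuple Z of vectors put Q_A(Z) = Σ h_A(zⱼ), which lies in F_q
-- and is additive in A, and let ψ = q·δ₀ − 1 on F_q.  By Cauchy–Schwarz Σ_{A,A′ ∈ U} ψ(Q_A(Z) − Q_A′(Z)) ≥ 0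
-- for each Z; summing over a set of bases Z of F^n, the term of a pair depends only on the rank of A − A′.
--
-- To evaluate it, let φ : F_q → ℤ have sum 0 (a stand-in for a nontrivial character of F_q).  Norm fibres have
-- q + 1 elements over nonzero values and trace fibres have q, so Σ_c φ(t + α N(c)) = b φ(t) for α ≠ 0 and
-- Σ_c φ(t + Tr(c w)) = 0 for w ≠ 0.  Hence Σ_x φ(t + h(x)) = b^(n+j) φ(t) for a form of nullity j, and the kernel
-- has b^(2j) elements.  Splitting off the first vector x of a basis: if h(x) ≠ 0 the rest contributes the sum for
-- the form on x^⊥; if x is in the kernel, the sum for the quotient form; otherwise 0, since the remaining vectors
-- cannot all be orthogonal to x.  The resulting recursion is solved by M(n) P(j) φ(t), where
-- P(j) = ∏_{i=1..j} (b^i + 1).  For rank k ≡ 2 (mod 4) the sign of P(n) / P(n−k) is −1 and its absolute value is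
-- the product in the bound.
module Submission where

open import Defs
open import Level using (Level)

-- Bases enter because Q_A(Z) is the trace of A Z Z*, and for bases Z over a finite field Z Z* meets
-- every invertible hermitian matrix equally often. The fibre sizes need no generator of the
-- multiplicative group: the degree of a polynomial bounds each fibre, the fibres over F_q have q²
-- elements altogether, and the bounds add up to just that, so each is attained. Rank and nullity
-- are linked by counting alone: the kernel of a rank k form has both b^(2j) and b^(2n - 2k)
-- elements, which forces j = n - k. The sign is decisive. M(n) P(n) is the number of bases and
-- hence positive, so a negative ratio P(n) / P(n - k) makes the off-diagonal value M(n) P(n - k)
-- negative; only then does nonnegativity of the double sum limit the number of off-diagonal pairs.
-- The factor b^i + 1 has sign (-1)^i, two neighbouring values of i contribute -1, and k ≡ 2 (mod 4)
-- means an odd number of such pairs.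

module Development where

  open import Data.Nat as ℕ using (ℕ; zero; suc)
  import Data.Nat.Properties as ℕ
  open import Data.Nat.Combinatorics using (_C_; nCk+nC[k+1]≡[n+1]C[k+1]; nCn≡1; nC1≡n)
  open import Data.Nat.Divisibility using (_∣_; divides; ∣⇒≤)
  open import Data.Nat.Primality using (Prime; euclidsLemma; prime⇒nonTrivial)
  open import Data.Integer as ℤ using (ℤ; +_; _+_; _*_; -_; _≤_; _^_; 0ℤ; 1ℤ; +≤+)
  import Data.Integer.Properties as ℤ
  open import Data.Integer.Tactic.RingSolver using (solve-∀)
  open import Data.Fin as Fin using (Fin; zero; suc; toℕ; fromℕ; inject₁; punchIn)
  import Data.Fin.Properties as Fin
  open import Data.Fin.Permutation using (permutation)
  open import Data.List as List using (List; []; _∷_; _++_; map; concatMap; cartesianProductWith; filter; length; allFin; tabulate)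
  open import Data.List.Properties using (map-tabulate; length-tabulate)
  open import Data.List.Membership.Propositional using (_∈_; find)
  open import Data.List.Membership.Propositional.Properties using (∈-concatMap⁻; ∈-cartesianProductWith⁻; ∈-filter⁻; ∈-lookup)
  open import Data.List.Relation.Unary.Any as Any using (here; there)
  open import Data.List.Relation.Unary.Any.Properties using (lookup-index)
  open import Data.List.Relation.Unary.All as All using (All; []; _∷_)
  open import Data.List.Relation.Unary.AllPairs using (AllPairs; []; _∷_)
  open import Data.Vec as Vec using (Vec; []; _∷_; replicate; zipWith; lookup)
  import Data.Vec.Properties as Vec
  open import Data.Product using (∃; _×_; _,_; proj₁; proj₂)
  open import Data.Sum using (_⊎_; inj₁; inj₂)
  open import Data.Empty using (⊥-elim)
  open import Function.Definitions using (Injective)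
  open import Relation.Nullary using (¬_; Dec; yes; no; contradiction)
  open import Relation.Nullary.Decidable using (_×-dec_; ¬?; decidable-stable)
  open import Relation.Unary using (Pred) renaming (Decidable to Decidable₁)
  open import Relation.Binary.Definitions using (DecidableEquality)
  open import Relation.Binary.PropositionalEquality
  open import Algebra.Bundles using (CommutativeRing; CommutativeMonoid; RawRing)
  open import Algebra.Structures using (IsCommutativeRing)
  open import Algebra.Morphism.Structures using (IsRingMonomorphism)
  import Algebra.Morphism.RingMonomorphism as RingMonomorphism
  import Algebra.Solver.Ring.NaturalCoefficients.Default

  -- Finite integer sums over lists, and enumerations of finite types

  module Sums where

    private variable
      a p : Level
      A B : Set a
      P Q : Set p

    𝟙 : Dec P → ℤ
    𝟙 (yes _) = 1ℤ
    𝟙 (no _)  = 0ℤ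

    𝟙-yes : (d : Dec P) → P → 𝟙 d ≡ 1ℤ
    𝟙-yes (yes _) _ = refl
    𝟙-yes (no ¬p) p = contradiction p ¬p

    𝟙-no : (d : Dec P) → ¬ P → 𝟙 d ≡ 0ℤ
    𝟙-no (yes p) ¬p = contradiction p ¬p
    𝟙-no (no _)  _  = refl

    𝟙-cong : (d : Dec P) (e : Dec Q) → (P → Q) → (Q → P) → 𝟙 d ≡ 𝟙 e
    𝟙-cong (yes p) e f g = sym (𝟙-yes e (f p))
    𝟙-cong (no ¬p) e f g = sym (𝟙-no e λ q → ¬p (g q))

    0≤𝟙 : (d : Dec P) → 0ℤ ≤ 𝟙 d
    0≤𝟙 (yes _) = +≤+ ℕ.z≤n
    0≤𝟙 (no _)  = +≤+ ℕ.z≤n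

    𝟙-*-cong : (d : Dec P) {x y : ℤ} → (P → x ≡ y) → 𝟙 d * x ≡ 𝟙 d * y
    𝟙-*-cong (yes p) e = cong (1ℤ *_) (e p)
    𝟙-*-cong (no _)  e = refl

    𝟙-× : (d : Dec P) (e : Dec Q) → 𝟙 (d ×-dec e) ≡ 𝟙 d * 𝟙 e
    𝟙-× (yes _) (yes _) = refl
    𝟙-× (yes _) (no _)  = refl
    𝟙-× (no _)  _       = refl

    ∑ : List A → (A → ℤ) → ℤ
    ∑ []       f = 0ℤ
    ∑ (x ∷ xs) f = f x + ∑ xs f

    ∑-cong : (xs : List A) {f g : A → ℤ} → (∀ x → f x ≡ g x) → ∑ xs f ≡ ∑ xs g
    ∑-cong []       e = refl
    ∑-cong (x ∷ xs) e = cong₂ _+_ (e x) (∑-cong xs e)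

    ∑-cong-∈ : (xs : List A) {f g : A → ℤ} → (∀ x → x ∈ xs → f x ≡ g x) → ∑ xs f ≡ ∑ xs g
    ∑-cong-∈ []       e = refl
    ∑-cong-∈ (x ∷ xs) e = cong₂ _+_ (e x (here refl)) (∑-cong-∈ xs λ y y∈ → e y (there y∈))

    ∑-+ : (xs : List A) (f g : A → ℤ) → ∑ xs (λ x → f x + g x) ≡ ∑ xs f + ∑ xs g
    ∑-+ []       f g = refl
    ∑-+ (x ∷ xs) f g rewrite ∑-+ xs f g = lem (f x) (g x) (∑ xs f) (∑ xs g)
      where
      lem : ∀ a b c d → a + b + (c + d) ≡ a + c + (b + d)
      lem = solve-∀

    ∑-*ˡ : (xs : List A) (c : ℤ) (f : A → ℤ) → ∑ xs (λ x → c * f x) ≡ c * ∑ xs f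
    ∑-*ˡ []       c f = sym (ℤ.*-zeroʳ c)
    ∑-*ˡ (x ∷ xs) c f rewrite ∑-*ˡ xs c f = sym (ℤ.*-distribˡ-+ c (f x) (∑ xs f))

    ∑-*ʳ : (xs : List A) (c : ℤ) (f : A → ℤ) → ∑ xs (λ x → f x * c) ≡ ∑ xs f * c
    ∑-*ʳ xs c f = trans (∑-cong xs λ x → ℤ.*-comm (f x) c) (trans (∑-*ˡ xs c f) (ℤ.*-comm c _))

    ∑-0 : (xs : List A) → ∑ xs (λ _ → 0ℤ) ≡ 0ℤ
    ∑-0 []       = refl
    ∑-0 (x ∷ xs) = trans (ℤ.+-identityˡ _) (∑-0 xs)

    ∑-const : (xs : List A) (c : ℤ) → ∑ xs (λ _ → c) ≡ + length xs * c
    ∑-const []       c = refl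
    ∑-const (x ∷ xs) c = trans (cong (_+_ c) (∑-const xs c)) (sym (ℤ.suc-* (+ length xs) c))

    ∑-swap : (xs : List A) (ys : List B) (f : A → B → ℤ) →
             ∑ xs (λ x → ∑ ys (f x)) ≡ ∑ ys (λ y → ∑ xs λ x → f x y)
    ∑-swap []       ys f = sym (∑-0 ys)
    ∑-swap (x ∷ xs) ys f = trans (cong (_+_ (∑ ys (f x))) (∑-swap xs ys f))
      (sym (∑-+ ys (f x) (λ y → ∑ xs λ x → f x y)))

    ∑-++ : (xs ys : List A) (f : A → ℤ) → ∑ (xs ++ ys) f ≡ ∑ xs f + ∑ ys f
    ∑-++ []       ys f = sym (ℤ.+-identityˡ _)
    ∑-++ (x ∷ xs) ys f = trans (cong (_+_ (f x)) (∑-++ xs ys f)) (sym (ℤ.+-assoc (f x) (∑ xs f) (∑ ys f)))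

    ∑-map : (g : A → B) (xs : List A) (f : B → ℤ) → ∑ (map g xs) f ≡ ∑ xs (λ x → f (g x))
    ∑-map g []       f = refl
    ∑-map g (x ∷ xs) f = cong (_+_ (f (g x))) (∑-map g xs f)

    ∑-concatMap : (g : A → List B) (xs : List A) (f : B → ℤ) → ∑ (concatMap g xs) f ≡ ∑ xs (λ x → ∑ (g x) f)
    ∑-concatMap g []       f = refl
    ∑-concatMap g (x ∷ xs) f = trans (∑-++ (g x) (concatMap g xs) f) (cong (_+_ (∑ (g x) f)) (∑-concatMap g xs f))

    ∑-product : {C : Set p} (g : A → B → C) (xs : List A) (ys : List B) (f : C → ℤ) →
                ∑ (cartesianProductWith g xs ys) f ≡ ∑ xs (λ x → ∑ ys λ y → f (g x y))
    ∑-product g []       ys f = refl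
    ∑-product g (x ∷ xs) ys f = trans (∑-++ (map (g x) ys) (cartesianProductWith g xs ys) f)
      (cong₂ _+_ (∑-map (g x) ys f) (∑-product g xs ys f))

    ∑-filter : {R : Pred A p} (R? : Decidable₁ R) (xs : List A) (f : A → ℤ) →
               ∑ (filter R? xs) f ≡ ∑ xs (λ x → 𝟙 (R? x) * f x)
    ∑-filter R? []       f = refl
    ∑-filter R? (x ∷ xs) f with R? x
    ... | yes _ = cong₂ _+_ (sym (ℤ.*-identityˡ (f x))) (∑-filter R? xs f)
    ... | no _  = trans (∑-filter R? xs f) (sym (ℤ.+-identityˡ _))

    ∑-mono : (xs : List A) {f g : A → ℤ} → (∀ x → f x ≤ g x) → ∑ xs f ≤ ∑ xs g
    ∑-mono []       e = ℤ.≤-refl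
    ∑-mono (x ∷ xs) e = ℤ.+-mono-≤ (e x) (∑-mono xs e)

    0≤∑ : (xs : List A) {f : A → ℤ} → (∀ x → 0ℤ ≤ f x) → 0ℤ ≤ ∑ xs f
    0≤∑ xs {f} e = subst (_≤ ∑ xs f) (∑-0 xs) (∑-mono xs e)

    0≤∑≤0⇒0 : (xs : List A) {f : A → ℤ} → (∀ x → 0ℤ ≤ f x) → ∑ xs f ≤ 0ℤ → ∀ {x} → x ∈ xs → f x ≡ 0ℤ
    0≤∑≤0⇒0 (x ∷ xs) {f} e s (here refl) = ℤ.≤-antisym
      (ℤ.≤-trans (subst (_≤ f x + ∑ xs f) (ℤ.+-identityʳ (f x)) (ℤ.+-monoʳ-≤ (f x) (0≤∑ xs e))) s) (e x)
    0≤∑≤0⇒0 (x ∷ xs) {f} e s (there x∈) = 0≤∑≤0⇒0 xs e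
      (ℤ.≤-trans (subst (_≤ f x + ∑ xs f) (ℤ.+-identityˡ (∑ xs f)) (ℤ.+-monoˡ-≤ (∑ xs f) (e x))) s) x∈

    ∑≢0⇒∃ : (xs : List A) (f : A → ℤ) → ∑ xs f ≢ 0ℤ → ∃ λ x → x ∈ xs × f x ≢ 0ℤ
    ∑≢0⇒∃ []       f ne = contradiction refl ne
    ∑≢0⇒∃ (x ∷ xs) f ne with f x ℤ.≟ 0ℤ
    ... | no fx≢0  = x , here refl , fx≢0
    ... | yes fx≡0 with ∑≢0⇒∃ xs f (λ e → ne (cong₂ _+_ fx≡0 e))
    ...   | y , y∈ , fy≢0 = y , there y∈ , fy≢0

    -- Occurring exactly once is stated as a sum of indicators so that it combines directly with
    -- `∑`: membership, reindexing along bijections and decidability of quantifiers all come out of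
    -- this one equation.
    record Enumerates {a} {A : Set a} (_≟_ : DecidableEquality A) (xs : List A) : Set a where
      field count≡1 : ∀ a → ∑ xs (λ x → 𝟙 (a ≟ x)) ≡ 1ℤ
    open Enumerates public

    module _ {_≟_ : DecidableEquality A} {xs : List A} (enum : Enumerates _≟_ xs) where

      enum-∈ : ∀ a → a ∈ xs
      enum-∈ a with ∑≢0⇒∃ xs (λ x → 𝟙 (a ≟ x)) (λ e → contradiction (trans (sym (count≡1 enum a)) e) λ ())
      ... | x , x∈ , ne with a ≟ x
      ...   | yes refl = x∈
      ...   | no _     = contradiction refl ne

      ∑-δ : ∀ a (f : A → ℤ) → ∑ xs (λ x → 𝟙 (a ≟ x) * f x) ≡ f a
      ∑-δ a f = begin
        ∑ xs (λ x → 𝟙 (a ≟ x) * f x) ≡⟨ ∑-cong xs (λ x → 𝟙-*-cong (a ≟ x) λ { refl → refl }) ⟩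
        ∑ xs (λ x → 𝟙 (a ≟ x) * f a) ≡⟨ ∑-*ʳ xs (f a) _ ⟩
        ∑ xs (λ x → 𝟙 (a ≟ x)) * f a ≡⟨ cong (_* f a) (count≡1 enum a) ⟩
        1ℤ * f a                     ≡⟨ ℤ.*-identityˡ (f a) ⟩
        f a                          ∎
        where open ≡-Reasoning

      -- Sorting the terms by the fibres of `π`; this is how the sizes of norm and trace fibres
      -- enter sums over the field.
      ∑-insert : (ys : List B) (π : B → A) (f : A → ℤ) →
                 ∑ ys (λ y → f (π y)) ≡ ∑ xs (λ x → ∑ ys (λ y → 𝟙 (π y ≟ x)) * f x)
      ∑-insert ys π f = begin
        ∑ ys (λ y → f (π y))                        ≡⟨ ∑-cong ys (λ y → ∑-δ (π y) f) ⟨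
        ∑ ys (λ y → ∑ xs (λ x → 𝟙 (π y ≟ x) * f x)) ≡⟨ ∑-swap ys xs _ ⟩
        ∑ xs (λ x → ∑ ys (λ y → 𝟙 (π y ≟ x) * f x)) ≡⟨ ∑-cong xs (λ x → ∑-*ʳ ys (f x) _) ⟩
        ∑ xs (λ x → ∑ ys (λ y → 𝟙 (π y ≟ x)) * f x) ∎
        where open ≡-Reasoning

      ∑-reindex : (π ρ : A → A) → (∀ x → π (ρ x) ≡ x) → (∀ x → ρ (π x) ≡ x) →
                  (f : A → ℤ) → ∑ xs (λ x → f (π x)) ≡ ∑ xs f
      ∑-reindex π ρ πρ ρπ f = trans (∑-insert xs π f) (∑-cong xs λ x → trans
        (cong (_* f x) (trans (∑-cong xs λ y → 𝟙-cong (π y ≟ x) (ρ x ≟ y)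
          (λ { refl → ρπ y }) (λ { refl → πρ x })) (count≡1 enum (ρ x)))) (ℤ.*-identityˡ (f x)))

      -- Search by counting: a sum of indicators is nonzero exactly when some indicator is.
      ∃? : {R : Pred A p} → Decidable₁ R → Dec (∃ R)
      ∃? R? with ∑ xs (λ x → 𝟙 (R? x)) ℤ.≟ 0ℤ
      ... | yes e = no λ { (x , r) → contradiction
              (trans (sym (𝟙-yes (R? x) r)) (0≤∑≤0⇒0 xs (λ x → 0≤𝟙 (R? x)) (ℤ.≤-reflexive e) (enum-∈ x))) λ () }
      ... | no ne with ∑≢0⇒∃ xs _ ne
      ...   | x , _ , fx≢0 with R? x
      ...     | yes r = yes (x , r)
      ...     | no _  = contradiction refl fx≢0

      ∀? : {R : Pred A p} → Decidable₁ R → Dec (∀ x → R x)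
      ∀? R? with ∃? (λ x → ¬? (R? x))
      ... | yes (x , ¬r) = no λ r → ¬r (r x)
      ... | no ¬∃        = yes λ x → decidable-stable (R? x) λ ¬r → ¬∃ (x , ¬r)

    -- Each unordered pair of distinct positions is counted twice.
    ∑∑-AllPairs : {R : A → A → Set p} (g : A → A → ℤ) (d c : ℤ) → (∀ x → g x x ≡ d) →
                  (∀ {x y} → R x y → g x y ≡ c) → (∀ x y → g x y ≡ g y x) →
                  {xs : List A} → AllPairs R xs →
                  ∑ xs (λ x → ∑ xs (g x)) ≡ + length xs * (d + (+ length xs ℤ.- 1ℤ) * c)
    ∑∑-AllPairs g d c gd gc gs [] = refl
    ∑∑-AllPairs {A = A} {R = R} g d c gd gc gs {x ∷ xs} (rs ∷ ps) = begin
      g x x + ∑ xs (g x) + ∑ xs (λ y → g y x + ∑ xs (g y))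
        ≡⟨ cong (_+_ (g x x + ∑ xs (g x))) (∑-+ xs (λ y → g y x) (λ y → ∑ xs (g y))) ⟩
      g x x + ∑ xs (g x) + (∑ xs (λ y → g y x) + ∑ xs (λ y → ∑ xs (g y)))
        ≡⟨ cong (λ w → g x x + ∑ xs (g x) + (w + ∑ xs (λ y → ∑ xs (g y)))) (∑-cong xs λ y → gs y x) ⟩
      g x x + ∑ xs (g x) + (∑ xs (g x) + ∑ xs (λ y → ∑ xs (g y)))
        ≡⟨ cong₂ (λ v w → v + w + (w + ∑ xs (λ y → ∑ xs (g y)))) (gd x) (row rs) ⟩
      d + + length xs * c + (+ length xs * c + ∑ xs (λ y → ∑ xs (g y)))
        ≡⟨ cong (λ w → d + + length xs * c + (+ length xs * c + w)) (∑∑-AllPairs g d c gd gc gs ps) ⟩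
      d + + length xs * c + (+ length xs * c + + length xs * (d + (+ length xs ℤ.- 1ℤ) * c))
        ≡⟨ lem (+ length xs) d c ⟩
      (1ℤ + + length xs) * (d + (1ℤ + + length xs ℤ.- 1ℤ) * c) ∎
      where
      open ≡-Reasoning
      row : ∀ {ys} → All (R x) ys → ∑ ys (g x) ≡ + length ys * c
      row []       = refl
      row {_ ∷ ys} (r ∷ rs) = trans (cong₂ _+_ (gc r) (row rs)) (sym (ℤ.suc-* (+ length ys) c))
      lem : ∀ n d c → d + n * c + (n * c + n * (d + (n + ℤ.- 1ℤ) * c)) ≡
            (1ℤ + n) * (d + (1ℤ + n + ℤ.- 1ℤ) * c)
      lem = solve-∀

  open Sums

  -- Binomial coefficients divisible by a prime

  [1+k]*[1+n]C[1+k]≡[1+n]*nCk : ∀ n k → suc k ℕ.* (suc n C suc k) ≡ suc n ℕ.* (n C k)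
  [1+k]*[1+n]C[1+k]≡[1+n]*nCk n zero = trans (ℕ.*-identityˡ (suc n C 1)) (trans (nC1≡n (suc n)) (sym (ℕ.*-identityʳ (suc n))))
  [1+k]*[1+n]C[1+k]≡[1+n]*nCk zero (suc k) = ℕ.*-zeroʳ (suc (suc k))
  [1+k]*[1+n]C[1+k]≡[1+n]*nCk (suc n) (suc k) = begin
    suc (suc k) ℕ.* (suc (suc n) C suc (suc k))
      ≡⟨ cong (suc (suc k) ℕ.*_) (nCk+nC[k+1]≡[n+1]C[k+1] (suc n) (suc k)) ⟨
    suc (suc k) ℕ.* (c ℕ.+ (suc n C suc (suc k)))
      ≡⟨ ℕ.*-distribˡ-+ (suc (suc k)) c _ ⟩
    c ℕ.+ suc k ℕ.* c ℕ.+ suc (suc k) ℕ.* (suc n C suc (suc k))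
      ≡⟨ cong₂ (λ v w → c ℕ.+ v ℕ.+ w) ([1+k]*[1+n]C[1+k]≡[1+n]*nCk n k) ([1+k]*[1+n]C[1+k]≡[1+n]*nCk n (suc k)) ⟩
    c ℕ.+ suc n ℕ.* (n C k) ℕ.+ suc n ℕ.* (n C suc k)
      ≡⟨ ℕ.+-assoc c _ _ ⟩
    c ℕ.+ (suc n ℕ.* (n C k) ℕ.+ suc n ℕ.* (n C suc k))
      ≡⟨ cong (c ℕ.+_) (ℕ.*-distribˡ-+ (suc n) (n C k) (n C suc k)) ⟨
    c ℕ.+ suc n ℕ.* ((n C k) ℕ.+ (n C suc k))
      ≡⟨ cong (λ w → c ℕ.+ suc n ℕ.* w) (nCk+nC[k+1]≡[n+1]C[k+1] n k) ⟩
    c ℕ.+ suc n ℕ.* c ∎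
    where
    open ≡-Reasoning
    c = suc n C suc k

  -- By absorption `p` divides (k + 1) · C(p, k + 1), and it cannot divide the first factor, which
  -- lies strictly between 0 and `p`.
  p∣pCk : ∀ {p} k → Prime p → suc k ℕ.< p → p ∣ p C suc k
  p∣pCk {suc p} k pr k<p with euclidsLemma (suc k) (suc p C suc k) pr
    (divides (p C k) (trans ([1+k]*[1+n]C[1+k]≡[1+n]*nCk p k) (ℕ.*-comm (suc p) (p C k))))
  ... | inj₁ p∣k = contradiction (∣⇒≤ p∣k) (ℕ.<⇒≱ k<p)
  ... | inj₂ p∣C = p∣C

  ∑-tabulate : ∀ {a} {A : Set a} {n} (f : Fin n → A) (g : A → ℤ) → ∑ (tabulate f) g ≡ ∑ (allFin n) (λ i → g (f i))
  ∑-tabulate f g = trans (cong (λ l → ∑ l g) (sym (map-tabulate (λ i → i) f))) (∑-map f (allFin _) g)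

  allFin-enumerates : ∀ n → Enumerates Fin._≟_ (allFin n)
  allFin-enumerates n = record { count≡1 = go n }
    where
    go : ∀ n (i : Fin n) → ∑ (allFin n) (λ j → 𝟙 (i Fin.≟ j)) ≡ 1ℤ
    go (suc n) zero = cong (_+_ 1ℤ) (trans (∑-tabulate {n = n} suc (λ j → 𝟙 (zero Fin.≟ j))) (∑-0 (allFin n)))
    go (suc n) (suc i) = trans (ℤ.+-identityˡ _) (trans (∑-tabulate {n = n} suc (λ j → 𝟙 (suc i Fin.≟ j)))
      (trans (∑-cong (allFin n) λ j → 𝟙-cong (suc i Fin.≟ suc j) (i Fin.≟ j) Fin.suc-injective (cong suc)) (go n i)))

  module _ {c ℓ} (M : CommutativeMonoid c ℓ) where
    open CommutativeMonoid M using (Carrier; ε; _∙_; _≈_; ∙-congˡ; identityʳ; setoid) renaming (trans to ≈-trans)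
    open import Algebra.Properties.CommutativeMonoid.Sum M using (sum; sum-remove; sum-cong-≋; sum-replicate-zero)

    -- Kept at the level of monoids because it serves both the product in Fermat's theorem and sums
    -- against unit vectors.
    fold-single : ∀ {n} (j : Fin n) (t : Fin n → Carrier) → (∀ i → i ≢ j → t i ≈ ε) → sum t ≈ t j
    fold-single {suc n} j t e = ≈-trans (sum-remove {i = j} t) (≈-trans (∙-congˡ
      (≈-trans (sum-cong-≋ λ i → e (punchIn j i) (Fin.punchInᵢ≢i j i)) (sum-replicate-zero n))) (identityʳ (t j)))

  -- The given field is replaced by a copy on Fin N, where equality is propositional and sums can be permuted.
  record DiscreteField (N : ℕ) : Set where
    infix  8 ⊖_
    infixl 7 _⊙_
    infixl 6 _⊕_
    field
      _⊕_ _⊙_ : Fin N → Fin N → Fin N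
      ⊖_      : Fin N → Fin N
      0ₖ 1ₖ   : Fin N
      isCommutativeRing : IsCommutativeRing _≡_ _⊕_ _⊙_ ⊖_ 0ₖ 1ₖ
      1≢0     : 1ₖ ≢ 0ₖ
      inverse : ∀ x → x ≢ 0ₖ → ∃ λ y → x ⊙ y ≡ 1ₖ

  -- Finite fields: characteristic, Fermat's theorem, roots of polynomials

  module FieldProperties {N : ℕ} (𝕂 : DiscreteField N) where
    open DiscreteField 𝕂 public

    K : Set
    K = Fin N

    commutativeRing : CommutativeRing _ _
    commutativeRing = record { isCommutativeRing = isCommutativeRing }

    module R = CommutativeRing commutativeRing
    open R public using (semiring; commutativeSemiring)
    open import Algebra.Properties.Semiring.Sum semiring public
      using (sum; sum-cong-≗; ∑-distrib-+; ∑-comm; *-distribˡ-sum; *-distribʳ-sum; sum-replicate; ∑-permute; sum-replicate-zero; sum-init-last)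
    open import Algebra.Properties.Semiring.Mult semiring public
      using (×1-homo-*; ×-assoc-*) renaming (_×_ to _×ₖ_)
    open import Algebra.Properties.CommutativeSemiring.Exp commutativeSemiring public
      using (^-assocʳ; ^-distrib-*) renaming (_^_ to _^ₖ_)
    open import Algebra.Properties.Ring R.ring public
      using (-‿distribˡ-*; -‿distribʳ-*; -1*x≈-x; -0#≈0#; -‿involutive; -‿+-comm)
    module KSolver = Algebra.Solver.Ring.NaturalCoefficients.Default commutativeSemiring

    infix 4 _≟_
    _≟_ : (x y : K) → Dec (x ≡ y)
    _≟_ = Fin._≟_

    elems : List K
    elems = allFin N

    enum : Enumerates _≟_ elems
    enum = allFin-enumerates N

    ⊕-cancelˡ : ∀ a x → ⊖ a ⊕ (a ⊕ x) ≡ x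
    ⊕-cancelˡ a x = trans (sym (R.+-assoc (⊖ a) a x)) (trans (cong (_⊕ x) (R.-‿inverseˡ a)) (R.+-identityˡ x))

    ⊕-cancelˡ′ : ∀ a x → a ⊕ (⊖ a ⊕ x) ≡ x
    ⊕-cancelˡ′ a x = trans (sym (R.+-assoc a (⊖ a) x)) (trans (cong (_⊕ x) (R.-‿inverseʳ a)) (R.+-identityˡ x))

    x⊕⊖y≡0⇒x≡y : ∀ x y → x ⊕ ⊖ y ≡ 0ₖ → x ≡ y
    x⊕⊖y≡0⇒x≡y x y e = begin
      x               ≡⟨ R.+-identityʳ x ⟨
      x ⊕ 0ₖ          ≡⟨ cong (x ⊕_) (R.-‿inverseˡ y) ⟨
      x ⊕ (⊖ y ⊕ y)   ≡⟨ R.+-assoc x (⊖ y) y ⟨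
      x ⊕ ⊖ y ⊕ y     ≡⟨ cong (_⊕ y) e ⟩
      0ₖ ⊕ y          ≡⟨ R.+-identityˡ y ⟩
      y               ∎
      where open ≡-Reasoning

    ⊙-cancel-inverse : ∀ {a a⁻¹} x → a ⊙ a⁻¹ ≡ 1ₖ → a⁻¹ ⊙ (a ⊙ x) ≡ x
    ⊙-cancel-inverse {a} {a⁻¹} x e = trans (sym (R.*-assoc a⁻¹ a x))
      (trans (cong (_⊙ x) (trans (R.*-comm a⁻¹ a) e)) (R.*-identityˡ x))

    ⊙-cancelˡ : ∀ {a x y} → a ≢ 0ₖ → a ⊙ x ≡ a ⊙ y → x ≡ y
    ⊙-cancelˡ {a} {x} {y} a≢0 e with inverse a a≢0
    ... | a⁻¹ , aa⁻¹ = trans (sym (⊙-cancel-inverse x aa⁻¹)) (trans (cong (a⁻¹ ⊙_) e) (⊙-cancel-inverse y aa⁻¹))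

    x⊙y≡0⇒ : ∀ {x y} → x ⊙ y ≡ 0ₖ → x ≡ 0ₖ ⊎ y ≡ 0ₖ
    x⊙y≡0⇒ {x} {y} e with x ≟ 0ₖ
    ... | yes x≡0 = inj₁ x≡0
    ... | no x≢0  = inj₂ (⊙-cancelˡ x≢0 (trans e (sym (R.zeroʳ x))))

    x^n≡0⇒x≡0 : ∀ {x} n → x ^ₖ n ≡ 0ₖ → x ≡ 0ₖ
    x^n≡0⇒x≡0 zero    e = contradiction e 1≢0
    x^n≡0⇒x≡0 (suc n) e with x⊙y≡0⇒ e
    ... | inj₁ x≡0 = x≡0
    ... | inj₂ e′  = x^n≡0⇒x≡0 n e′

    ∑K-translate : ∀ a (f : K → ℤ) → ∑ elems (λ x → f (a ⊕ x)) ≡ ∑ elems f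
    ∑K-translate a = ∑-reindex enum (a ⊕_) (⊖ a ⊕_) (⊕-cancelˡ′ a) (⊕-cancelˡ a)

    -- Translation by 1 permutes the field, so the sum of all elements absorbs `N` copies of 1.
    N×1≡0 : N ×ₖ 1ₖ ≡ 0ₖ
    N×1≡0 = begin
      N ×ₖ 1ₖ                                  ≡⟨ ⊕-cancelˡ S (N ×ₖ 1ₖ) ⟨
      ⊖ S ⊕ (S ⊕ N ×ₖ 1ₖ)                     ≡⟨ cong (⊖ S ⊕_) (R.+-comm S (N ×ₖ 1ₖ)) ⟩
      ⊖ S ⊕ (N ×ₖ 1ₖ ⊕ S)                     ≡⟨ cong (λ w → ⊖ S ⊕ (w ⊕ S)) (sum-replicate N) ⟨
      ⊖ S ⊕ (sum {N} (λ _ → 1ₖ) ⊕ S)          ≡⟨ cong (⊖ S ⊕_) (∑-distrib-+ {N} (λ _ → 1ₖ) (λ i → i)) ⟨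
      ⊖ S ⊕ sum (λ i → 1ₖ ⊕ i)                ≡⟨ cong (⊖ S ⊕_) (∑-permute (λ i → i)
                                                    (permutation (1ₖ ⊕_) (⊖ 1ₖ ⊕_) (⊕-cancelˡ′ 1ₖ) (⊕-cancelˡ 1ₖ))) ⟨
      ⊖ S ⊕ S                                 ≡⟨ R.-‿inverseˡ S ⟩
      0ₖ                                      ∎
      where
      open ≡-Reasoning
      S : K
      S = sum {N} (λ i → i)

    module _ where
      open import Algebra.Properties.CommutativeMonoid.Sum R.*-commutativeMonoid
        using () renaming (sum to ∏; ∑-distrib-+ to ∏-distrib-*; ∑-permute to ∏-permute; sum-replicate to ∏-replicate; sum-cong-≗ to ∏-cong)

      ∏≢0 : ∀ {n} (t : Fin n → K) → (∀ i → t i ≢ 0ₖ) → ∏ t ≢ 0ₖ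
      ∏≢0 {zero}  t ne = 1≢0
      ∏≢0 {suc n} t ne e with x⊙y≡0⇒ e
      ... | inj₁ e₀ = ne zero e₀
      ... | inj₂ e₁ = ∏≢0 (λ i → t (suc i)) (λ i → ne (suc i)) e₁

      -- Multiplication by `a` permutes the field and so preserves a product over all elements. The
      -- place 0 needs a repair: `u` puts 1 there, and `v` supplies the factor `a` that
      -- multiplication by `a` fails to produce at 0. This gives the exponent N in place of N - 1.
      fermat : ∀ a → a ≢ 0ₖ → a ^ₖ N ≡ a
      fermat a a≢0 with inverse a a≢0
      ... | a⁻¹ , aa⁻¹ = sym (⊙-cancelˡ (∏≢0 u u≢0) (begin
        ∏ u ⊙ a                       ≡⟨ cong (∏ u ⊙_) a≡∏v ⟩
        ∏ u ⊙ ∏ v                     ≡⟨ cong (_⊙ ∏ v) (∏-permute u (permutation (a ⊙_) (a⁻¹ ⊙_) aa⁻¹x a⁻¹ax)) ⟩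
        ∏ (λ i → u (a ⊙ i)) ⊙ ∏ v     ≡⟨ ∏-distrib-* (λ i → u (a ⊙ i)) v ⟨
        ∏ (λ i → u (a ⊙ i) ⊙ v i)     ≡⟨ ∏-cong uv ⟩
        ∏ (λ i → a ⊙ u i)             ≡⟨ ∏-distrib-* (λ _ → a) u ⟩
        ∏ {N} (λ _ → a) ⊙ ∏ u         ≡⟨ cong (_⊙ ∏ u) (∏-replicate N) ⟩
        a ^ₖ N ⊙ ∏ u                  ≡⟨ R.*-comm (a ^ₖ N) (∏ u) ⟩
        ∏ u ⊙ a ^ₖ N                  ∎))
        where
        open ≡-Reasoning
        u v : K → K
        u i with i ≟ 0ₖ
        ... | yes _ = 1ₖ
        ... | no _  = i
        v i with i ≟ 0ₖ
        ... | yes _ = a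
        ... | no _  = 1ₖ
        u≢0 : ∀ i → u i ≢ 0ₖ
        u≢0 i with i ≟ 0ₖ
        ... | yes _  = 1≢0
        ... | no i≢0 = i≢0
        a⁻¹ax : ∀ x → a⁻¹ ⊙ (a ⊙ x) ≡ x
        a⁻¹ax x = ⊙-cancel-inverse x aa⁻¹
        aa⁻¹x : ∀ x → a ⊙ (a⁻¹ ⊙ x) ≡ x
        aa⁻¹x x = ⊙-cancel-inverse x (trans (R.*-comm a⁻¹ a) aa⁻¹)
        v≢ : ∀ i → i ≢ 0ₖ → v i ≡ 1ₖ
        v≢ i i≢0 with i ≟ 0ₖ
        ... | yes i≡0 = contradiction i≡0 i≢0
        ... | no _    = refl
        a≡∏v : a ≡ ∏ v
        a≡∏v = sym (trans (fold-single R.*-commutativeMonoid 0ₖ v v≢) v0)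
          where
          v0 : v 0ₖ ≡ a
          v0 with 0ₖ ≟ 0ₖ
          ... | yes _ = refl
          ... | no ne = contradiction refl ne
        uv : ∀ i → u (a ⊙ i) ⊙ v i ≡ a ⊙ u i
        uv i with i ≟ 0ₖ | a ⊙ i ≟ 0ₖ
        ... | yes refl | yes _   = trans (R.*-identityˡ a) (sym (R.*-identityʳ a))
        ... | yes refl | no ne   = contradiction (R.zeroʳ a) ne
        ... | no i≢0   | no _    = R.*-identityʳ (a ⊙ i)
        ... | no i≢0   | yes e with x⊙y≡0⇒ e
        ...   | inj₁ a≡0 = contradiction a≡0 a≢0
        ...   | inj₂ i≡0 = contradiction i≡0 i≢0

    -- Horner form with an implicit leading coefficient 1, so that the length of the vector is the
    -- degree.
    monic : ∀ {d} → Vec K d → K → K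
    monic []       x = 1ₖ
    monic (c ∷ cs) x = c ⊕ x ⊙ monic cs x

    -- cs(x) − cs(a) = (x − a) cs′(x), with the subtractions moved to the other side.
    monic-factor : ∀ {d} (cs : Vec K (suc d)) a → ∃ λ (cs′ : Vec K d) → ∀ x →
                   monic cs x ⊕ a ⊙ monic cs′ x ≡ x ⊙ monic cs′ x ⊕ monic cs a
    monic-factor (c ∷ []) a = [] , λ x → solve 3 (λ c x a → (c :+ x :* con 1) :+ a :* con 1 := x :* con 1 :+ (c :+ a :* con 1)) refl c x a
      where open KSolver
    monic-factor (c ∷ cs@(_ ∷ _)) a with monic-factor cs a
    ... | cs′ , e = monic cs a ∷ cs′ , λ x → begin
      c ⊕ x ⊙ monic cs x ⊕ a ⊙ (monic cs a ⊕ x ⊙ monic cs′ x)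
        ≡⟨ solve 6 (λ c x a m r m′ → (c :+ x :* m) :+ a :* (r :+ x :* m′) := (c :+ a :* r) :+ x :* (m :+ a :* m′))
             refl c x a (monic cs x) (monic cs a) (monic cs′ x) ⟩
      (c ⊕ a ⊙ monic cs a) ⊕ x ⊙ (monic cs x ⊕ a ⊙ monic cs′ x)
        ≡⟨ cong (λ w → (c ⊕ a ⊙ monic cs a) ⊕ x ⊙ w) (e x) ⟩
      (c ⊕ a ⊙ monic cs a) ⊕ x ⊙ (x ⊙ monic cs′ x ⊕ monic cs a)
        ≡⟨ solve 5 (λ c x a r m′ → (c :+ a :* r) :+ x :* (x :* m′ :+ r) := x :* (r :+ x :* m′) :+ (c :+ a :* r))
             refl c x a (monic cs a) (monic cs′ x) ⟩
      x ⊙ (monic cs a ⊕ x ⊙ monic cs′ x) ⊕ (c ⊕ a ⊙ monic cs a) ∎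
      where
      open ≡-Reasoning
      open KSolver

    -- Once a root `a` is found, any other root is a root of the quotient, since a field has no zero
    -- divisors.
    monic-roots : ∀ {d} (cs : Vec K d) → ∑ elems (λ x → 𝟙 (monic cs x ≟ 0ₖ)) ≤ + d
    monic-roots [] = ℤ.≤-reflexive (trans (∑-cong elems λ x → 𝟙-no (1ₖ ≟ 0ₖ) 1≢0) (∑-0 elems))
    monic-roots {suc d} cs@(_ ∷ _) with ∃? enum (λ x → monic cs x ≟ 0ₖ)
    ... | no ¬r = ℤ.≤-trans (ℤ.≤-reflexive (trans (∑-cong elems λ x → 𝟙-no (monic cs x ≟ 0ₖ) λ r → ¬r (x , r)) (∑-0 elems))) (+≤+ ℕ.z≤n)
    ... | yes (a , ra) with monic-factor cs a
    ...   | cs′ , e = ℤ.≤-trans (∑-mono elems bnd)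
      (ℤ.≤-trans (ℤ.≤-reflexive (∑-+ elems _ _)) (ℤ.+-mono-≤ (ℤ.≤-reflexive (count≡1 enum a)) (monic-roots cs′)))
      where
      open ≡-Reasoning
      same-root : ∀ {x} → monic cs x ≡ 0ₖ → monic cs′ x ⊙ a ≡ monic cs′ x ⊙ x
      same-root {x} r = begin
          monic cs′ x ⊙ a                  ≡⟨ R.*-comm _ a ⟩
          a ⊙ monic cs′ x                  ≡⟨ R.+-identityˡ _ ⟨
          0ₖ ⊕ a ⊙ monic cs′ x             ≡⟨ cong (_⊕ a ⊙ monic cs′ x) r ⟨
          monic cs x ⊕ a ⊙ monic cs′ x     ≡⟨ e x ⟩
          x ⊙ monic cs′ x ⊕ monic cs a     ≡⟨ cong (x ⊙ monic cs′ x ⊕_) ra ⟩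
          x ⊙ monic cs′ x ⊕ 0ₖ             ≡⟨ R.+-identityʳ _ ⟩
          x ⊙ monic cs′ x                  ≡⟨ R.*-comm x _ ⟩
          monic cs′ x ⊙ x                  ∎
      bnd : ∀ x → 𝟙 (monic cs x ≟ 0ₖ) ≤ 𝟙 (a ≟ x) + 𝟙 (monic cs′ x ≟ 0ₖ)
      bnd x with monic cs x ≟ 0ₖ | a ≟ x | monic cs′ x ≟ 0ₖ
      ... | no _  | d₁ | d₂ = ℤ.+-mono-≤ (0≤𝟙 d₁) (0≤𝟙 d₂)
      ... | yes _ | yes _ | d₂ = subst (_≤ 1ℤ + 𝟙 d₂) (ℤ.+-identityʳ 1ℤ) (ℤ.+-monoʳ-≤ 1ℤ (0≤𝟙 d₂))
      ... | yes _ | no _ | yes _ = ℤ.≤-refl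
      ... | yes r | no a≢x | no ne = contradiction (⊙-cancelˡ ne (same-root r)) a≢x

    -- One shape for three counts: `u` = 1 gives a trace fibre, `u` = 0 a norm fibre, and `u` = -1
    -- with `s` = 0 the fixed points of conjugation.
    trinomial-roots : ∀ m u s → ∑ elems (λ x → 𝟙 (s ⊕ x ⊙ (u ⊕ x ^ₖ suc m) ≟ 0ₖ)) ≤ + (suc (suc m))
    trinomial-roots m u s = subst (_≤ + suc (suc m)) (∑-cong elems λ x → cong (λ w → 𝟙 (s ⊕ x ⊙ (u ⊕ x ⊙ w) ≟ 0ₖ)) (monic-replicate m x))
      (monic-roots (s ∷ u ∷ replicate m 0ₖ))
      where
      monic-replicate : ∀ m x → monic (replicate m 0ₖ) x ≡ x ^ₖ m
      monic-replicate zero    x = refl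
      monic-replicate (suc m) x = trans (R.+-identityˡ _) (cong (x ⊙_) (monic-replicate m x))

  -- The order q is written `suc (suc r)`, so that q - 1, the value of `ψ` at 0, is visibly positive
  -- and can be cancelled.
  module HermitianGeometry {N : ℕ} (𝕂 : DiscreteField N) (p m r : ℕ) (p-prime : Prime p)
                           (q≡ : suc (suc r) ≡ p ℕ.^ suc m) (N≡ : N ≡ suc (suc r) ℕ.* suc (suc r)) where
    -- Conjugation, norm and trace

    open FieldProperties 𝕂 public

    q : ℕ
    q = suc (suc r)

    -- `N` is a power of `p`, so some power of p · 1 equals N · 1 = 0, and a field has no nilpotent
    -- elements.
    p×1≡0 : p ×ₖ 1ₖ ≡ 0ₖ
    p×1≡0 = x^n≡0⇒x≡0 (suc m ℕ.+ suc m) (begin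
      (p ×ₖ 1ₖ) ^ₖ (suc m ℕ.+ suc m)  ≡⟨ ×1-homo-^ (suc m ℕ.+ suc m) ⟨
      (p ℕ.^ (suc m ℕ.+ suc m)) ×ₖ 1ₖ ≡⟨ cong (_×ₖ 1ₖ) (trans (ℕ.^-distribˡ-+-* p (suc m) (suc m))
                                            (trans (sym (cong₂ ℕ._*_ q≡ q≡)) (sym N≡))) ⟩
      N ×ₖ 1ₖ                         ≡⟨ N×1≡0 ⟩
      0ₖ                              ∎)
      where
      open ≡-Reasoning
      ×1-homo-^ : ∀ k → (p ℕ.^ k) ×ₖ 1ₖ ≡ (p ×ₖ 1ₖ) ^ₖ k
      ×1-homo-^ zero    = R.+-identityʳ 1ₖ
      ×1-homo-^ (suc k) = trans (×1-homo-* p (p ℕ.^ k)) (cong (p ×ₖ 1ₖ ⊙_) (×1-homo-^ k))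

    p∣n⇒n×x≡0 : ∀ {n} x → p ∣ n → n ×ₖ x ≡ 0ₖ
    p∣n⇒n×x≡0 {n} x (divides c e) = begin
      n ×ₖ x                        ≡⟨ cong (n ×ₖ_) (R.*-identityˡ x) ⟨
      n ×ₖ (1ₖ ⊙ x)                 ≡⟨ ×-assoc-* n 1ₖ x ⟨
      n ×ₖ 1ₖ ⊙ x                   ≡⟨ cong (λ w → w ×ₖ 1ₖ ⊙ x) e ⟩
      (c ℕ.* p) ×ₖ 1ₖ ⊙ x           ≡⟨ cong (_⊙ x) (×1-homo-* c p) ⟩
      c ×ₖ 1ₖ ⊙ (p ×ₖ 1ₖ) ⊙ x       ≡⟨ cong (λ w → c ×ₖ 1ₖ ⊙ w ⊙ x) p×1≡0 ⟩
      c ×ₖ 1ₖ ⊙ 0ₖ ⊙ x              ≡⟨ cong (_⊙ x) (R.zeroʳ (c ×ₖ 1ₖ)) ⟩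
      0ₖ ⊙ x                        ≡⟨ R.zeroˡ x ⟩
      0ₖ                            ∎
      where open ≡-Reasoning

    freshman : ∀ x y → (x ⊕ y) ^ₖ p ≡ x ^ₖ p ⊕ y ^ₖ p
    freshman x y = go p p-prime refl
      where
      open ≡-Reasoning
      open import Algebra.Properties.CommutativeSemiring.Binomial commutativeSemiring using (theorem; binomialTerm)
      go : ∀ p′ → Prime p′ → p′ ≡ p → (x ⊕ y) ^ₖ p′ ≡ x ^ₖ p′ ⊕ y ^ₖ p′
      go (suc p′) pr refl = begin
        (x ⊕ y) ^ₖ suc p′                                        ≡⟨ theorem (suc p′) x y ⟩
        t zero ⊕ sum (λ i → t (suc i))                           ≡⟨ cong (t zero ⊕_) (sum-init-last (λ i → t (suc i))) ⟩
        t zero ⊕ (sum (λ i → t (suc (inject₁ i))) ⊕ t (suc (fromℕ p′)))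
          ≡⟨ cong₂ (λ v w → v ⊕ (w ⊕ t (suc (fromℕ p′)))) first middle ⟩
        y ^ₖ suc p′ ⊕ (0ₖ ⊕ t (suc (fromℕ p′)))                  ≡⟨ cong (y ^ₖ suc p′ ⊕_) (trans (R.+-identityˡ _) last) ⟩
        y ^ₖ suc p′ ⊕ x ^ₖ suc p′                                ≡⟨ R.+-comm _ _ ⟩
        x ^ₖ suc p′ ⊕ y ^ₖ suc p′                                ∎
        where
        t : Fin (suc (suc p′)) → K
        t = binomialTerm x y (suc p′)
        first : t zero ≡ y ^ₖ suc p′
        first = trans (R.+-identityʳ _) (R.*-identityˡ _)
        middle : sum (λ i → t (suc (inject₁ i))) ≡ 0ₖ
        middle = trans (sum-cong-≗ {p′} λ i → p∣n⇒n×x≡0 _ (p∣pCk (toℕ (inject₁ i)) pr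
          (ℕ.s≤s (subst (ℕ._< p′) (sym (Fin.toℕ-inject₁ i)) (Fin.toℕ<n i))))) (sum-replicate-zero p′)
        last : t (suc (fromℕ p′)) ≡ x ^ₖ suc p′
        last rewrite Fin.toℕ-fromℕ p′ | nCn≡1 (suc p′) | ℕ.n∸n≡0 p′ = trans (R.+-identityʳ _) (R.*-identityʳ _)

    conj : K → K
    conj x = x ^ₖ q

    conj-⊕ : ∀ x y → conj (x ⊕ y) ≡ conj x ⊕ conj y
    conj-⊕ x y = subst (λ e → (x ⊕ y) ^ₖ e ≡ x ^ₖ e ⊕ y ^ₖ e) (sym q≡) (iter (suc m))
      where
      open ≡-Reasoning
      iter : ∀ k → (x ⊕ y) ^ₖ (p ℕ.^ k) ≡ x ^ₖ (p ℕ.^ k) ⊕ y ^ₖ (p ℕ.^ k)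
      iter zero    = trans (R.*-identityʳ (x ⊕ y)) (sym (cong₂ _⊕_ (R.*-identityʳ x) (R.*-identityʳ y)))
      iter (suc k) = begin
        (x ⊕ y) ^ₖ (p ℕ.* p ℕ.^ k)                 ≡⟨ unroll (x ⊕ y) ⟩
        ((x ⊕ y) ^ₖ (p ℕ.^ k)) ^ₖ p                ≡⟨ cong (_^ₖ p) (iter k) ⟩
        (x ^ₖ (p ℕ.^ k) ⊕ y ^ₖ (p ℕ.^ k)) ^ₖ p     ≡⟨ freshman _ _ ⟩
        (x ^ₖ (p ℕ.^ k)) ^ₖ p ⊕ (y ^ₖ (p ℕ.^ k)) ^ₖ p ≡⟨ cong₂ _⊕_ (unroll x) (unroll y) ⟨
        x ^ₖ (p ℕ.* p ℕ.^ k) ⊕ y ^ₖ (p ℕ.* p ℕ.^ k) ∎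
        where
        unroll : ∀ z → z ^ₖ (p ℕ.* p ℕ.^ k) ≡ (z ^ₖ (p ℕ.^ k)) ^ₖ p
        unroll z = trans (cong (z ^ₖ_) (ℕ.*-comm p (p ℕ.^ k))) (sym (^-assocʳ z (p ℕ.^ k) p))

    conj-⊙ : ∀ x y → conj (x ⊙ y) ≡ conj x ⊙ conj y
    conj-⊙ x y = ^-distrib-* x y q

    conj-0 : conj 0ₖ ≡ 0ₖ
    conj-0 = R.zeroˡ _

    conj-involutive : ∀ x → conj (conj x) ≡ x
    conj-involutive x = trans (^-assocʳ x q q) (trans (cong (x ^ₖ_) (sym N≡)) (x^N≡x x))
      where
      x^N≡x : ∀ x → x ^ₖ N ≡ x
      x^N≡x x with x ≟ 0ₖ
      ... | no x≢0   = fermat x x≢0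
      ... | yes refl = subst (λ n → 0ₖ ^ₖ n ≡ 0ₖ) (sym N≡) (R.zeroˡ _)

    ⊖-unique : ∀ {x y} → x ⊕ y ≡ 0ₖ → y ≡ ⊖ x
    ⊖-unique {x} {y} e = trans (sym (⊕-cancelˡ x y)) (trans (cong (⊖ x ⊕_) e) (R.+-identityʳ (⊖ x)))

    conj-⊖ : ∀ x → conj (⊖ x) ≡ ⊖ conj x
    conj-⊖ x = ⊖-unique (trans (sym (conj-⊕ x (⊖ x))) (trans (cong conj (R.-‿inverseʳ x)) conj-0))

    conj≡0⇒≡0 : ∀ {x} → conj x ≡ 0ₖ → x ≡ 0ₖ
    conj≡0⇒≡0 = x^n≡0⇒x≡0 q

    -- Membership in the subfield F_q, which is never built as a type of its own.
    Real : K → Set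
    Real x = conj x ≡ x

    real? : ∀ x → Dec (Real x)
    real? x = conj x ≟ x

    real-⊕ : ∀ {x y} → Real x → Real y → Real (x ⊕ y)
    real-⊕ {x} {y} rx ry = trans (conj-⊕ x y) (cong₂ _⊕_ rx ry)

    real-⊙ : ∀ {x y} → Real x → Real y → Real (x ⊙ y)
    real-⊙ {x} {y} rx ry = trans (conj-⊙ x y) (cong₂ _⊙_ rx ry)

    real-⊖ : ∀ {x} → Real x → Real (⊖ x)
    real-⊖ {x} rx = trans (conj-⊖ x) (cong ⊖_ rx)

    tr nm : K → K
    tr x = x ⊕ conj x
    nm x = conj x ⊙ x

    tr-real : ∀ x → Real (tr x)
    tr-real x = trans (conj-⊕ x (conj x)) (trans (cong (conj x ⊕_) (conj-involutive x)) (R.+-comm _ _))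

    nm-real : ∀ x → Real (nm x)
    nm-real x = trans (conj-⊙ (conj x) x) (trans (cong (_⊙ conj x) (conj-involutive x)) (R.*-comm _ _))

    tr-⊕ : ∀ x y → tr (x ⊕ y) ≡ tr x ⊕ tr y
    tr-⊕ x y = trans (cong (x ⊕ y ⊕_) (conj-⊕ x y))
      (solve 4 (λ x y x̄ ȳ → (x :+ y) :+ (x̄ :+ ȳ) := (x :+ x̄) :+ (y :+ ȳ)) refl x y (conj x) (conj y))
      where open KSolver

    -- Opaque, so that the unifier does not unfold products with b.
    abstract
      b : ℤ
      b = - (+ q)

      b≡-q : b ≡ - (+ q)
      b≡-q = refl

    instance
      b-nonZero : ℤ.NonZero b
      b-nonZero = subst ℤ.NonZero (sym b≡-q) _

    -- Sizes of F_q and of the trace and norm fibres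

    ε : K → ℤ
    ε s = 𝟙 (real? s)

    ∑1≡q² : ∑ elems (λ _ → 1ℤ) ≡ + q * + q
    ∑1≡q² = trans (∑-const elems 1ℤ) (trans (ℤ.*-identityʳ _)
      (trans (cong +_ (trans (length-tabulate {n = N} (λ i → i)) N≡)) (ℤ.pos-* q q)))

    private
      fib : (K → K) → K → ℤ
      fib π s = ∑ elems (λ c → 𝟙 (π c ≟ s))

      -- Every field element lies in one fibre, and the weight `ε` loses none of them because `π`
      -- takes real values only.
      ∑fib : ∀ π → (∀ c → Real (π c)) → ∑ elems (λ s → fib π s * ε s) ≡ + q * + q
      ∑fib π rπ = trans (sym (∑-insert enum elems π ε)) (trans (∑-cong elems λ c → 𝟙-yes (real? (π c)) (rπ c)) ∑1≡q²)

      fib-tr≤q : ∀ s → fib tr s ≤ + q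
      fib-tr≤q s = subst (_≤ + q) (∑-cong elems λ c → 𝟙-cong (⊖ s ⊕ c ⊙ (1ₖ ⊕ c ^ₖ suc r) ≟ 0ₖ) (tr c ≟ s) (to c) (from c))
        (trinomial-roots r 1ₖ (⊖ s))
        where
        expand : ∀ c → c ⊙ (1ₖ ⊕ c ^ₖ suc r) ≡ tr c
        expand c = trans (R.distribˡ c 1ₖ _) (cong (_⊕ conj c) (R.*-identityʳ c))
        to : ∀ c → ⊖ s ⊕ c ⊙ (1ₖ ⊕ c ^ₖ suc r) ≡ 0ₖ → tr c ≡ s
        to c e = trans (sym (expand c)) (x⊕⊖y≡0⇒x≡y _ s (trans (R.+-comm _ (⊖ s)) e))
        from : ∀ c → tr c ≡ s → ⊖ s ⊕ c ⊙ (1ₖ ⊕ c ^ₖ suc r) ≡ 0ₖ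
        from c e = trans (cong (⊖ s ⊕_) (trans (expand c) e)) (R.-‿inverseˡ s)

      fib-nm≤q+1 : ∀ s → fib nm s ≤ + suc q
      fib-nm≤q+1 s = subst (_≤ + suc q) (∑-cong elems λ c → 𝟙-cong (⊖ s ⊕ c ⊙ (0ₖ ⊕ c ^ₖ q) ≟ 0ₖ) (nm c ≟ s) (to c) (from c))
        (trinomial-roots (suc r) 0ₖ (⊖ s))
        where
        expand : ∀ c → c ⊙ (0ₖ ⊕ c ^ₖ q) ≡ nm c
        expand c = trans (cong (c ⊙_) (R.+-identityˡ _)) (R.*-comm c _)
        to : ∀ c → ⊖ s ⊕ c ⊙ (0ₖ ⊕ c ^ₖ q) ≡ 0ₖ → nm c ≡ s
        to c e = trans (sym (expand c)) (x⊕⊖y≡0⇒x≡y _ s (trans (R.+-comm _ (⊖ s)) e))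
        from : ∀ c → nm c ≡ s → ⊖ s ⊕ c ⊙ (0ₖ ⊕ c ^ₖ q) ≡ 0ₖ
        from c e = trans (cong (⊖ s ⊕_) (trans (expand c) e)) (R.-‿inverseˡ s)

      ∑ε≤q : ∑ elems ε ≤ + q
      ∑ε≤q = subst (_≤ + q) (∑-cong elems λ c → 𝟙-cong (0ₖ ⊕ c ⊙ (⊖ 1ₖ ⊕ c ^ₖ suc r) ≟ 0ₖ) (real? c) (to c) (from c))
        (trinomial-roots r (⊖ 1ₖ) 0ₖ)
        where
        expand : ∀ c → 0ₖ ⊕ c ⊙ (⊖ 1ₖ ⊕ c ^ₖ suc r) ≡ conj c ⊕ ⊖ c
        expand c = trans (R.+-identityˡ _) (trans (R.distribˡ c (⊖ 1ₖ) _) (trans (R.+-comm _ _)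
          (cong (conj c ⊕_) (trans (R.*-comm c (⊖ 1ₖ)) (-1*x≈-x c)))))
        to : ∀ c → 0ₖ ⊕ c ⊙ (⊖ 1ₖ ⊕ c ^ₖ suc r) ≡ 0ₖ → Real c
        to c e = x⊕⊖y≡0⇒x≡y (conj c) c (trans (sym (expand c)) e)
        from : ∀ c → Real c → 0ₖ ⊕ c ⊙ (⊖ 1ₖ ⊕ c ^ₖ suc r) ≡ 0ₖ
        from c e = trans (expand c) (trans (cong (_⊕ ⊖ c) e) (R.-‿inverseʳ c))

      0≤ε : ∀ s → 0ℤ ≤ ε s
      0≤ε s = 0≤𝟙 (real? s)

      -- Nonnegative gaps with total at most 0 all vanish. This turns the upper bounds from root
      -- counting into exact fibre sizes; off F_q the weight makes both sides 0.
      weighted-gap : (f g : K → ℤ) → (∀ s → f s ≤ g s) → ∑ elems (λ s → g s * ε s) ≤ ∑ elems (λ s → f s * ε s) →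
                     ∀ s → f s * ε s ≡ g s * ε s
      weighted-gap f g f≤g tot s = sym (ℤ.i-j≡0⇒i≡j (g s * ε s) (f s * ε s) (trans (lem (g s) (f s) (ε s))
        (0≤∑≤0⇒0 elems {λ s → (g s + - f s) * ε s} nonneg total (enum-∈ enum s))))
        where
        lem : ∀ x y e → x * e + - (y * e) ≡ (x + - y) * e
        lem = solve-∀
        lem′ : ∀ x y e → (x + - y) * e ≡ x * e + (- 1ℤ) * (y * e)
        lem′ = solve-∀
        nonneg : ∀ s → 0ℤ ≤ (g s + - f s) * ε s
        nonneg s with real? s
        ... | yes _ = subst (0ℤ ≤_) (sym (ℤ.*-identityʳ _)) (ℤ.i≤j⇒0≤j-i (f≤g s))
        ... | no _  = ℤ.≤-reflexive (sym (ℤ.*-zeroʳ (g s + - f s)))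
        total : ∑ elems (λ s → (g s + - f s) * ε s) ≤ 0ℤ
        total = ℤ.≤-trans (ℤ.≤-reflexive (trans (∑-cong elems λ s → lem′ (g s) (f s) (ε s))
          (trans (∑-+ elems _ _) (cong (_+_ (∑ elems (λ s → g s * ε s)))
            (trans (∑-*ˡ elems (- 1ℤ) _) (ℤ.-1*i≡-i _))))))
          (ℤ.i≤j⇒i-j≤0 tot)

      -- All q² elements are spread over the trace fibres above F_q, each of size at most q, so F_q
      -- cannot have fewer than q elements.
      q²≤q∑ε : + q * + q ≤ + q * ∑ elems ε
      q²≤q∑ε = subst₂ _≤_ (∑fib tr tr-real) (∑-*ˡ elems (+ q) ε) (∑-mono elems λ s → ℤ.*-monoʳ-≤-nonNeg (ε s) {{ℤ.nonNegative (0≤ε s)}} (fib-tr≤q s))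

    ∑ε≡q : ∑ elems ε ≡ + q
    ∑ε≡q = ℤ.≤-antisym ∑ε≤q (ℤ.*-cancelˡ-≤-pos (+ q) (∑ elems ε) (+ q) q²≤q∑ε)

    private
      fib-tr : ∀ s → fib tr s * ε s ≡ + q * ε s
      fib-tr = weighted-gap (fib tr) (λ _ → + q) fib-tr≤q
        (ℤ.≤-reflexive (trans (∑-*ˡ elems (+ q) ε) (trans (cong (+ q *_) ∑ε≡q) (sym (∑fib tr tr-real)))))

      -- The upper bounds, 1 above zero and q + 1 above each of the q - 1 other real values, add up
      -- to q², so there is no slack.
      fib-nm : ∀ s → fib nm s * ε s ≡ (+ suc q + - (+ q * 𝟙 (0ₖ ≟ s))) * ε s
      fib-nm = weighted-gap (fib nm) _ bnd (ℤ.≤-reflexive (trans tot (sym (∑fib nm nm-real))))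
        where
        fib-nm-0 : fib nm 0ₖ ≡ 1ℤ
        fib-nm-0 = trans (∑-cong elems λ c → 𝟙-cong (nm c ≟ 0ₖ) (0ₖ ≟ c) (to c) λ { refl → R.zeroʳ _ }) (count≡1 enum 0ₖ)
          where
          to : ∀ c → nm c ≡ 0ₖ → 0ₖ ≡ c
          to c e with x⊙y≡0⇒ e
          ... | inj₁ e′ = sym (conj≡0⇒≡0 e′)
          ... | inj₂ e′ = sym e′
        bnd : ∀ s → fib nm s ≤ + suc q + - (+ q * 𝟙 (0ₖ ≟ s))
        bnd s with 0ₖ ≟ s
        ... | yes refl = ℤ.≤-reflexive (trans fib-nm-0 (lem (+ q)))
          where
          lem : ∀ x → 1ℤ ≡ 1ℤ + x + - (x * 1ℤ)
          lem = solve-∀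
        ... | no _ = subst (fib nm s ≤_) (lem (+ suc q) (+ q)) (fib-nm≤q+1 s)
          where
          lem : ∀ y x → y ≡ y + - (x * 0ℤ)
          lem = solve-∀
        tot : ∑ elems (λ s → (+ suc q + - (+ q * 𝟙 (0ₖ ≟ s))) * ε s) ≡ + q * + q
        tot = begin
          ∑ elems (λ s → (+ suc q + - (+ q * 𝟙 (0ₖ ≟ s))) * ε s)
            ≡⟨ ∑-cong elems (λ s → lem (+ suc q) (+ q) (𝟙 (0ₖ ≟ s)) (ε s)) ⟩
          ∑ elems (λ s → + suc q * ε s + - (+ q) * (𝟙 (0ₖ ≟ s) * ε s))
            ≡⟨ ∑-+ elems _ _ ⟩
          ∑ elems (λ s → + suc q * ε s) + ∑ elems (λ s → - (+ q) * (𝟙 (0ₖ ≟ s) * ε s))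
            ≡⟨ cong₂ _+_ (∑-*ˡ elems (+ suc q) ε) (∑-*ˡ elems (- (+ q)) _) ⟩
          + suc q * ∑ elems ε + - (+ q) * ∑ elems (λ s → 𝟙 (0ₖ ≟ s) * ε s)
            ≡⟨ cong₂ (λ v w → + suc q * v + - (+ q) * w) ∑ε≡q (trans (∑-δ enum 0ₖ ε) (𝟙-yes (real? 0ₖ) conj-0)) ⟩
          (1ℤ + + q) * + q + - (+ q) * 1ℤ
            ≡⟨ lem′ (+ q) ⟩
          + q * + q ∎
          where
          open ≡-Reasoning
          lem : ∀ y x d e → (y + - (x * d)) * e ≡ y * e + - x * (d * e)
          lem = solve-∀
          lem′ : ∀ x → (1ℤ + x) * x + - x * 1ℤ ≡ x * x
          lem′ = solve-∀

    Balanced : (K → ℤ) → Set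
    Balanced φ = ∑ elems (λ s → ε s * φ s) ≡ 0ℤ

    -- With `t` and `α` ≠ 0 real, s ↦ t + s α permutes F_q and also maps its complement to itself.
    balanced-affine : ∀ {φ t α} → Balanced φ → Real t → Real α → α ≢ 0ₖ → ∑ elems (λ s → ε s * φ (t ⊕ s ⊙ α)) ≡ 0ℤ
    balanced-affine {φ} {t} {α} bal rt rα α≢0 with inverse α α≢0
    ... | α⁻¹ , αα⁻¹ = trans (∑-cong elems λ s → cong (_* φ (π s)) (𝟙-cong (real? s) (real? (π s)) (to s) (from s)))
        (trans (∑-reindex enum π ρ πρ ρπ (λ s → ε s * φ s)) bal)
      where
      π ρ : K → K
      π s = t ⊕ s ⊙ α
      ρ s = α⁻¹ ⊙ (⊖ t ⊕ s)
      πρ : ∀ s → π (ρ s) ≡ s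
      πρ s = trans (cong (t ⊕_) (trans (R.*-comm _ α) (⊙-cancel-inverse _ (trans (R.*-comm α⁻¹ α) αα⁻¹)))) (⊕-cancelˡ′ t s)
      ρπ : ∀ s → ρ (π s) ≡ s
      ρπ s = trans (cong (α⁻¹ ⊙_) (⊕-cancelˡ t _)) (trans (cong (α⁻¹ ⊙_) (R.*-comm s α)) (⊙-cancel-inverse s αα⁻¹))
      to : ∀ s → Real s → Real (π s)
      to s rs = real-⊕ rt (real-⊙ rs rα)
      from : ∀ s → Real (π s) → Real s
      from s rπ = ⊙-cancelˡ α≢0 (begin
        α ⊙ conj s       ≡⟨ cong (_⊙ conj s) rα ⟨
        conj α ⊙ conj s  ≡⟨ conj-⊙ α s ⟨
        conj (α ⊙ s)     ≡⟨ cong conj (R.*-comm α s) ⟩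
        conj (s ⊙ α)     ≡⟨ cong conj (⊕-cancelˡ t (s ⊙ α)) ⟨
        conj (⊖ t ⊕ π s) ≡⟨ real-⊕ (real-⊖ rt) rπ ⟩
        ⊖ t ⊕ π s        ≡⟨ ⊕-cancelˡ t (s ⊙ α) ⟩
        s ⊙ α            ≡⟨ R.*-comm s α ⟩
        α ⊙ s            ∎)
        where open ≡-Reasoning

    -- With q + 1 preimages for every real value the sum would vanish by balance. Zero has q too
    -- few, and that deficit is -q φ(t).
    ∑-nm : ∀ {φ t α} → Balanced φ → Real t → Real α → α ≢ 0ₖ → ∑ elems (λ c → φ (t ⊕ nm c ⊙ α)) ≡ b * φ t
    ∑-nm {φ} {t} {α} bal rt rα α≢0 rewrite b≡-q = begin
      ∑ elems (λ c → f (nm c))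
        ≡⟨ ∑-cong elems (λ c → trans (cong (_* f (nm c)) (𝟙-yes (real? (nm c)) (nm-real c))) (ℤ.*-identityˡ (f (nm c)))) ⟨
      ∑ elems (λ c → ε (nm c) * f (nm c))
        ≡⟨ ∑-insert enum elems nm (λ s → ε s * f s) ⟩
      ∑ elems (λ s → fib nm s * (ε s * f s))
        ≡⟨ ∑-cong elems (λ s → trans (sym (ℤ.*-assoc (fib nm s) (ε s) (f s))) (trans (cong (_* f s) (fib-nm s))
             (lem (+ suc q) (+ q) (𝟙 (0ₖ ≟ s)) (ε s) (f s)))) ⟩
      ∑ elems (λ s → + suc q * (ε s * f s) + - (+ q) * (𝟙 (0ₖ ≟ s) * (ε s * f s)))
        ≡⟨ ∑-+ elems _ _ ⟩
      ∑ elems (λ s → + suc q * (ε s * f s)) + ∑ elems (λ s → - (+ q) * (𝟙 (0ₖ ≟ s) * (ε s * f s)))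
        ≡⟨ cong₂ _+_ (∑-*ˡ elems (+ suc q) _) (∑-*ˡ elems (- (+ q)) _) ⟩
      + suc q * ∑ elems (λ s → ε s * f s) + - (+ q) * ∑ elems (λ s → 𝟙 (0ₖ ≟ s) * (ε s * f s))
        ≡⟨ cong₂ (λ v w → + suc q * v + - (+ q) * w) (balanced-affine bal rt rα α≢0) (∑-δ enum 0ₖ (λ s → ε s * f s)) ⟩
      + suc q * 0ℤ + - (+ q) * (ε 0ₖ * f 0ₖ)
        ≡⟨ cong₂ (λ v w → + suc q * 0ℤ + - (+ q) * (v * w)) (𝟙-yes (real? 0ₖ) conj-0)
             (cong φ (trans (cong (t ⊕_) (R.zeroˡ α)) (R.+-identityʳ t))) ⟩
      + suc q * 0ℤ + - (+ q) * (1ℤ * φ t)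
        ≡⟨ lem′ (+ suc q) (- (+ q)) (φ t) ⟩
      - (+ q) * φ t ∎
      where
      open ≡-Reasoning
      f : K → ℤ
      f s = φ (t ⊕ s ⊙ α)
      lem : ∀ y x d e f → (y + - (x * d)) * e * f ≡ y * (e * f) + - x * (d * (e * f))
      lem = solve-∀
      lem′ : ∀ y b f → y * 0ℤ + b * (1ℤ * f) ≡ b * f
      lem′ = solve-∀

    -- Since `w` ≠ 0, `conj c ⊙ w` runs through the field together with `c`, and the trace covers
    -- F_q evenly.
    ∑-tr : ∀ {φ t w} → Balanced φ → Real t → w ≢ 0ₖ → ∑ elems (λ c → φ (t ⊕ tr (conj c ⊙ w))) ≡ 0ℤ
    ∑-tr {φ} {t} {w} bal rt w≢0 with inverse w w≢0
    ... | w⁻¹ , ww⁻¹ = begin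
      ∑ elems (λ c → f (tr (conj c ⊙ w)))
        ≡⟨ ∑-reindex enum (λ c → conj c ⊙ w) (λ c → conj (w⁻¹ ⊙ c)) πρ ρπ (λ c → f (tr c)) ⟩
      ∑ elems (λ c → f (tr c))
        ≡⟨ ∑-cong elems (λ c → trans (cong (_* f (tr c)) (𝟙-yes (real? (tr c)) (tr-real c))) (ℤ.*-identityˡ (f (tr c)))) ⟨
      ∑ elems (λ c → ε (tr c) * f (tr c))
        ≡⟨ ∑-insert enum elems tr (λ s → ε s * f s) ⟩
      ∑ elems (λ s → fib tr s * (ε s * f s))
        ≡⟨ ∑-cong elems (λ s → trans (sym (ℤ.*-assoc (fib tr s) (ε s) (f s))) (trans (cong (_* f s) (fib-tr s))
             (ℤ.*-assoc (+ q) (ε s) (f s)))) ⟩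
      ∑ elems (λ s → + q * (ε s * f s))
        ≡⟨ ∑-*ˡ elems (+ q) _ ⟩
      + q * ∑ elems (λ s → ε s * f s)
        ≡⟨ cong (+ q *_) (trans (∑-cong elems λ s → cong (λ v → ε s * φ (t ⊕ v)) (sym (R.*-identityʳ s)))
             (balanced-affine bal rt (1^ q) 1≢0)) ⟩
      + q * 0ℤ ≡⟨ ℤ.*-zeroʳ (+ q) ⟩
      0ℤ ∎
      where
      open ≡-Reasoning
      f : K → ℤ
      f s = φ (t ⊕ s)
      πρ : ∀ c → conj (conj (w⁻¹ ⊙ c)) ⊙ w ≡ c
      πρ c = trans (cong (_⊙ w) (conj-involutive _)) (trans (R.*-comm _ w) (⊙-cancel-inverse c (trans (R.*-comm w⁻¹ w) ww⁻¹)))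
      ρπ : ∀ c → conj (w⁻¹ ⊙ (conj c ⊙ w)) ≡ c
      ρπ c = trans (cong conj (trans (cong (w⁻¹ ⊙_) (R.*-comm (conj c) w)) (⊙-cancel-inverse (conj c) ww⁻¹))) (conj-involutive c)
      1^ : ∀ n → 1ₖ ^ₖ n ≡ 1ₖ
      1^ zero    = refl
      1^ (suc n) = trans (R.*-identityˡ _) (1^ n)

    -- Vectors and complements of a line

    V : ℕ → Set
    V n = Vec K n

    infixl 6 _+ᵥ_
    infixr 7 _·_
    _+ᵥ_ : ∀ {n} → V n → V n → V n
    _+ᵥ_ = zipWith _⊕_

    _·_ : ∀ {n} → K → V n → V n
    c · v = Vec.map (c ⊙_) v

    0ᵥ : ∀ {n} → V n
    0ᵥ {n} = replicate n 0ₖ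

    infix 4 _≟ᵥ_
    _≟ᵥ_ : ∀ {n} (v w : V n) → Dec (v ≡ w)
    _≟ᵥ_ = Vec.≡-dec _≟_

    +ᵥ-assoc : ∀ {n} (u v w : V n) → u +ᵥ v +ᵥ w ≡ u +ᵥ (v +ᵥ w)
    +ᵥ-assoc = Vec.zipWith-assoc R.+-assoc

    +ᵥ-comm : ∀ {n} (u v : V n) → u +ᵥ v ≡ v +ᵥ u
    +ᵥ-comm = Vec.zipWith-comm R.+-comm

    +ᵥ-identityˡ : ∀ {n} (u : V n) → 0ᵥ +ᵥ u ≡ u
    +ᵥ-identityˡ = Vec.zipWith-identityˡ R.+-identityˡ

    +ᵥ-identityʳ : ∀ {n} (u : V n) → u +ᵥ 0ᵥ ≡ u
    +ᵥ-identityʳ = Vec.zipWith-identityʳ R.+-identityʳ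

    ·-distribˡ : ∀ {n} c (u v : V n) → c · (u +ᵥ v) ≡ c · u +ᵥ c · v
    ·-distribˡ c []      []      = refl
    ·-distribˡ c (a ∷ u) (d ∷ v) = cong₂ _∷_ (R.distribˡ c a d) (·-distribˡ c u v)

    ·-distribʳ : ∀ {n} c d (u : V n) → (c ⊕ d) · u ≡ c · u +ᵥ d · u
    ·-distribʳ c d []      = refl
    ·-distribʳ c d (a ∷ u) = cong₂ _∷_ (R.distribʳ a c d) (·-distribʳ c d u)

    ·-assoc : ∀ {n} c d (u : V n) → (c ⊙ d) · u ≡ c · d · u
    ·-assoc c d []      = refl
    ·-assoc c d (a ∷ u) = cong₂ _∷_ (R.*-assoc c d a) (·-assoc c d u)

    0· : ∀ {n} (u : V n) → 0ₖ · u ≡ 0ᵥ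
    0· []      = refl
    0· (a ∷ u) = cong₂ _∷_ (R.zeroˡ a) (0· u)

    +ᵥ-inverseˡ : ∀ {n} (u : V n) → Vec.map ⊖_ u +ᵥ u ≡ 0ᵥ
    +ᵥ-inverseˡ []      = refl
    +ᵥ-inverseˡ (a ∷ u) = cong₂ _∷_ (R.-‿inverseˡ a) (+ᵥ-inverseˡ u)

    +ᵥ-cancelˡ : ∀ {n} (u v : V n) → Vec.map ⊖_ u +ᵥ (u +ᵥ v) ≡ v
    +ᵥ-cancelˡ u v = trans (sym (+ᵥ-assoc _ u v)) (trans (cong (_+ᵥ v) (+ᵥ-inverseˡ u)) (+ᵥ-identityˡ v))

    +ᵥ-cancelˡ′ : ∀ {n} (u v : V n) → u +ᵥ (Vec.map ⊖_ u +ᵥ v) ≡ v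
    +ᵥ-cancelˡ′ u v = trans (sym (+ᵥ-assoc u _ v)) (trans (cong (_+ᵥ v) (trans (+ᵥ-comm u _) (+ᵥ-inverseˡ u))) (+ᵥ-identityˡ v))

    vecs : ∀ n → List (V n)
    vecs zero    = [] ∷ []
    vecs (suc n) = cartesianProductWith _∷_ elems (vecs n)

    ∑-vecs : ∀ n (f : V (suc n) → ℤ) → ∑ (vecs (suc n)) f ≡ ∑ elems (λ a → ∑ (vecs n) λ v → f (a ∷ v))
    ∑-vecs n f = ∑-product _∷_ elems (vecs n) f

    enumᵥ : ∀ n → Enumerates (_≟ᵥ_ {n}) (vecs n)
    enumᵥ n = record { count≡1 = go n }
      where
      open ≡-Reasoning
      go : ∀ n (v : V n) → ∑ (vecs n) (λ w → 𝟙 (v ≟ᵥ w)) ≡ 1ℤ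
      go zero    []      = refl
      go (suc n) (a ∷ v) = begin
        ∑ (vecs (suc n)) (λ w → 𝟙 (a ∷ v ≟ᵥ w))               ≡⟨ ∑-vecs n _ ⟩
        ∑ elems (λ d → ∑ (vecs n) λ w → 𝟙 (a ∷ v ≟ᵥ d ∷ w))   ≡⟨ ∑-cong elems (λ d → trans (∑-cong (vecs n) (split d)) (∑-*ˡ (vecs n) (𝟙 (a ≟ d)) _)) ⟩
        ∑ elems (λ d → 𝟙 (a ≟ d) * ∑ (vecs n) λ w → 𝟙 (v ≟ᵥ w)) ≡⟨ ∑-cong elems (λ d → trans (cong (𝟙 (a ≟ d) *_) (go n v)) (ℤ.*-identityʳ _)) ⟩
        ∑ elems (λ d → 𝟙 (a ≟ d))                             ≡⟨ count≡1 enum a ⟩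
        1ℤ                                                    ∎
        where
        split : ∀ d w → 𝟙 (a ∷ v ≟ᵥ d ∷ w) ≡ 𝟙 (a ≟ d) * 𝟙 (v ≟ᵥ w)
        split d w = trans (𝟙-cong (a ∷ v ≟ᵥ d ∷ w) (a ≟ d ×-dec v ≟ᵥ w) Vec.∷-injective λ { (refl , refl) → refl })
                          (𝟙-× (a ≟ d) (v ≟ᵥ w))

    ∑V-translate : ∀ {n} u (f : V n → ℤ) → ∑ (vecs n) (λ x → f (u +ᵥ x)) ≡ ∑ (vecs n) f
    ∑V-translate {n} u = ∑-reindex (enumᵥ n) (u +ᵥ_) (Vec.map ⊖_ u +ᵥ_) (+ᵥ-cancelˡ′ u) (+ᵥ-cancelˡ u)

    b²≡q² : b * b ≡ + q * + q
    b²≡q² = trans (cong₂ _*_ b≡-q b≡-q) (lem (+ q))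
      where
      lem : ∀ x → - x * - x ≡ x * x
      lem = solve-∀

    ∑V-1 : ∀ n → ∑ (vecs n) (λ _ → 1ℤ) ≡ b ^ (n ℕ.+ n)
    ∑V-1 zero    = refl
    ∑V-1 (suc n) = begin
      ∑ (vecs (suc n)) (λ _ → 1ℤ)              ≡⟨ ∑-vecs n _ ⟩
      ∑ elems (λ _ → ∑ (vecs n) (λ _ → 1ℤ))    ≡⟨ ∑-cong elems (λ _ → trans (∑V-1 n) (sym (ℤ.*-identityˡ (b ^ (n ℕ.+ n))))) ⟩
      ∑ elems (λ _ → 1ℤ * b ^ (n ℕ.+ n))       ≡⟨ ∑-*ʳ elems (b ^ (n ℕ.+ n)) _ ⟩
      ∑ elems (λ _ → 1ℤ) * b ^ (n ℕ.+ n)       ≡⟨ cong (_* b ^ (n ℕ.+ n)) (trans ∑1≡q² (sym b²≡q²)) ⟩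
      b * b * b ^ (n ℕ.+ n)                    ≡⟨ ℤ.*-assoc b b _ ⟩
      b ^ (suc (suc (n ℕ.+ n)))                ≡⟨ cong (λ e → b ^ suc e) (ℕ.+-suc n n) ⟨
      b ^ (suc n ℕ.+ suc n)                    ∎
      where open ≡-Reasoning

    record Linear {k n} (ι : V k → V n) : Set where
      field
        map-+ : ∀ u v → ι (u +ᵥ v) ≡ ι u +ᵥ ι v
        map-· : ∀ c v → ι (c · v) ≡ c · ι v
    open Linear public

    -- The coordinate hyperplane at the first nonzero entry of x, a complement of the line through x (junk for x = 0).
    complement : ∀ {n} → V (suc n) → V n → V (suc n)
    complement (a ∷ x) z with a ≟ 0ₖ
    complement (a ∷ x) z           | no _  = 0ₖ ∷ z
    complement (a ∷ []) []         | yes _ = 0ₖ ∷ []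
    complement (a ∷ x@(_ ∷ _)) (d ∷ z) | yes _ = d ∷ complement x z

    complement-linear : ∀ {n} (x : V (suc n)) → Linear (complement x)
    complement-linear x = record { map-+ = add x ; map-· = scale x }
      where
      add : ∀ {n} (x : V (suc n)) u v → complement x (u +ᵥ v) ≡ complement x u +ᵥ complement x v
      add (a ∷ x) u v with a ≟ 0ₖ
      add (a ∷ x) u v           | no _  = cong (_∷ u +ᵥ v) (sym (R.+-identityˡ 0ₖ))
      add (a ∷ []) [] []         | yes _ = cong (_∷ []) (sym (R.+-identityˡ 0ₖ))
      add (a ∷ x@(_ ∷ _)) (d ∷ u) (e ∷ v) | yes _ = cong (d ⊕ e ∷_) (add x u v)
      scale : ∀ {n} (x : V (suc n)) c v → complement x (c · v) ≡ c · complement x v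
      scale (a ∷ x) c v with a ≟ 0ₖ
      scale (a ∷ x) c v           | no _  = cong (_∷ c · v) (sym (R.zeroʳ c))
      scale (a ∷ []) c []         | yes _ = cong (_∷ []) (sym (R.zeroʳ c))
      scale (a ∷ x@(_ ∷ _)) c (d ∷ v) | yes _ = cong (c ⊙ d ∷_) (scale x c v)

    complement-≢0 : ∀ {n a} → a ≢ 0ₖ → (x z : V n) → complement (a ∷ x) z ≡ 0ₖ ∷ z
    complement-≢0 {a = a} a≢0 x z with a ≟ 0ₖ
    ... | yes a≡0 = contradiction a≡0 a≢0
    ... | no _    = refl

    complement-0 : ∀ {n} (x : V (suc n)) d z → complement (0ₖ ∷ x) (d ∷ z) ≡ d ∷ complement x z
    complement-0 (_ ∷ _) d z with 0ₖ ≟ 0ₖ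
    ... | yes _ = refl
    ... | no ne = contradiction refl ne

    -- The line through `x` and its complement form a direct sum. If the leading entry of `x` is
    -- nonzero, `c` moves it through the whole field and a translation absorbs `c · x` in the tail;
    -- if it is zero, the leading coordinate is free on both sides and the induction passes to the
    -- tail.
    ∑-complement : ∀ {n} (x : V (suc n)) → x ≢ 0ᵥ → (f : V (suc n) → ℤ) →
                   ∑ (vecs (suc n)) f ≡ ∑ (vecs n) (λ z → ∑ elems λ c → f (c · x +ᵥ complement x z))
    ∑-complement-∷ : ∀ {n a} → Dec (a ≡ 0ₖ) → (x : V n) → a ∷ x ≢ 0ᵥ → (f : V (suc n) → ℤ) →
      ∑ (vecs (suc n)) f ≡ ∑ (vecs n) (λ z → ∑ elems λ c → f (c · (a ∷ x) +ᵥ complement (a ∷ x) z))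

    ∑-complement {n} (a ∷ x) x≢0 f = ∑-complement-∷ (a ≟ 0ₖ) x x≢0 f

    ∑-complement-∷ {n} {a} (no a≢0) x x≢0 f with inverse a a≢0
    ... | a⁻¹ , aa⁻¹ = begin
      ∑ (vecs (suc n)) f
        ≡⟨ ∑-vecs n f ⟩
      ∑ elems (λ c → ∑ (vecs n) λ z → f (c ∷ z))
        ≡⟨ ∑-reindex enum (_⊙ a) (_⊙ a⁻¹)
             (λ c → trans (R.*-assoc c a⁻¹ a) (trans (cong (c ⊙_) (trans (R.*-comm a⁻¹ a) aa⁻¹)) (R.*-identityʳ c)))
             (λ c → trans (R.*-assoc c a a⁻¹) (trans (cong (c ⊙_) aa⁻¹) (R.*-identityʳ c))) (λ c → ∑ (vecs n) λ z → f (c ∷ z)) ⟨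
      ∑ elems (λ c → ∑ (vecs n) λ z → f (c ⊙ a ∷ z))
        ≡⟨ ∑-cong elems (λ c → ∑V-translate (c · x) (λ z → f (c ⊙ a ∷ z))) ⟨
      ∑ elems (λ c → ∑ (vecs n) λ z → f (c ⊙ a ∷ (c · x +ᵥ z)))
        ≡⟨ ∑-swap elems (vecs n) _ ⟩
      ∑ (vecs n) (λ z → ∑ elems λ c → f (c ⊙ a ∷ (c · x +ᵥ z)))
        ≡⟨ ∑-cong (vecs n) (λ z → ∑-cong elems λ c → cong (λ w → f (w ∷ (c · x +ᵥ z))) (R.+-identityʳ (c ⊙ a))) ⟨
      ∑ (vecs n) (λ z → ∑ elems λ c → f (c · (a ∷ x) +ᵥ (0ₖ ∷ z)))
        ≡⟨ ∑-cong (vecs n) (λ z → ∑-cong elems λ c → cong (λ w → f (c · (a ∷ x) +ᵥ w)) (complement-≢0 a≢0 x z)) ⟨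
      ∑ (vecs n) (λ z → ∑ elems λ c → f (c · (a ∷ x) +ᵥ complement (a ∷ x) z)) ∎
      where open ≡-Reasoning
    ∑-complement-∷ (yes refl) [] x≢0 f = contradiction refl x≢0
    ∑-complement-∷ {suc n} (yes refl) x@(_ ∷ _) x≢0 f = begin
      ∑ (vecs (suc (suc n))) f
        ≡⟨ ∑-vecs (suc n) f ⟩
      ∑ elems (λ d → ∑ (vecs (suc n)) λ y → f (d ∷ y))
        ≡⟨ ∑-cong elems (λ d → ∑-complement x (λ e → x≢0 (cong (0ₖ ∷_) e)) (λ y → f (d ∷ y))) ⟩
      ∑ elems (λ d → ∑ (vecs n) λ z → ∑ elems λ c → f (d ∷ (c · x +ᵥ complement x z)))
        ≡⟨ ∑-cong elems (λ d → ∑-cong (vecs n) λ z → ∑-cong elems λ c →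
             cong (λ w → f (w ∷ (c · x +ᵥ complement x z))) (trans (cong (_⊕ d) (R.zeroʳ c)) (R.+-identityˡ d))) ⟨
      ∑ elems (λ d → ∑ (vecs n) λ z → ∑ elems λ c → f (c ⊙ 0ₖ ⊕ d ∷ (c · x +ᵥ complement x z)))
        ≡⟨ ∑-cong elems (λ d → ∑-cong (vecs n) λ z → ∑-cong elems λ c →
             cong (λ w → f (c · (0ₖ ∷ x) +ᵥ w)) (complement-0 x d z)) ⟨
      ∑ elems (λ d → ∑ (vecs n) λ z → ∑ elems λ c → f (c · (0ₖ ∷ x) +ᵥ complement (0ₖ ∷ x) (d ∷ z)))
        ≡⟨ ∑-vecs n (λ z → ∑ elems λ c → f (c · (0ₖ ∷ x) +ᵥ complement (0ₖ ∷ x) z)) ⟨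
      ∑ (vecs (suc n)) (λ z → ∑ elems λ c → f (c · (0ₖ ∷ x) +ᵥ complement (0ₖ ∷ x) z)) ∎
      where open ≡-Reasoning

    -- Hermitian forms and their nullity

    record Form (n : ℕ) : Set where
      field
        B      : V n → V n → K
        B-+    : ∀ x y z → B x (y +ᵥ z) ≡ B x y ⊕ B x z
        B-·    : ∀ c x y → B x (c · y) ≡ c ⊙ B x y
        B-conj : ∀ x y → conj (B x y) ≡ B y x

      B-+ˡ : ∀ x y z → B (x +ᵥ y) z ≡ B x z ⊕ B y z
      B-+ˡ x y z = begin
        B (x +ᵥ y) z                    ≡⟨ B-conj z (x +ᵥ y) ⟨
        conj (B z (x +ᵥ y))             ≡⟨ cong conj (B-+ z x y) ⟩
        conj (B z x ⊕ B z y)            ≡⟨ conj-⊕ _ _ ⟩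
        conj (B z x) ⊕ conj (B z y)     ≡⟨ cong₂ _⊕_ (B-conj z x) (B-conj z y) ⟩
        B x z ⊕ B y z                   ∎
        where open ≡-Reasoning

      B-·ˡ : ∀ c x y → B (c · x) y ≡ conj c ⊙ B x y
      B-·ˡ c x y = begin
        B (c · x) y             ≡⟨ B-conj y (c · x) ⟨
        conj (B y (c · x))      ≡⟨ cong conj (B-· c y x) ⟩
        conj (c ⊙ B y x)        ≡⟨ conj-⊙ c _ ⟩
        conj c ⊙ conj (B y x)   ≡⟨ cong (conj c ⊙_) (B-conj y x) ⟩
        conj c ⊙ B x y          ∎
        where open ≡-Reasoning

      h : V n → K
      h x = B x x

      h-real : ∀ x → Real (h x)
      h-real x = B-conj x x

      h-+ : ∀ x y → h (x +ᵥ y) ≡ h x ⊕ (tr (B x y) ⊕ h y)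
      h-+ x y = begin
        B (x +ᵥ y) (x +ᵥ y)                         ≡⟨ B-+ˡ x y (x +ᵥ y) ⟩
        B x (x +ᵥ y) ⊕ B y (x +ᵥ y)                 ≡⟨ cong₂ _⊕_ (B-+ x x y) (B-+ y x y) ⟩
        (B x x ⊕ B x y) ⊕ (B y x ⊕ B y y)           ≡⟨ cong (λ w → (B x x ⊕ B x y) ⊕ (w ⊕ B y y)) (B-conj x y) ⟨
        (B x x ⊕ B x y) ⊕ (conj (B x y) ⊕ B y y)    ≡⟨ solve 4 (λ s t u v → (s :+ t) :+ (u :+ v) := s :+ ((t :+ u) :+ v)) refl _ _ _ _ ⟩
        h x ⊕ (tr (B x y) ⊕ h y)                    ∎
        where
        open ≡-Reasoning
        open KSolver

      h-· : ∀ c x → h (c · x) ≡ nm c ⊙ h x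
      h-· c x = trans (B-· c (c · x) x) (trans (cong (c ⊙_) (B-·ˡ c x x))
        (trans (sym (R.*-assoc c (conj c) _)) (cong (_⊙ h x) (R.*-comm c (conj c)))))

      h-line : ∀ c x w → h (c · x +ᵥ w) ≡ nm c ⊙ h x ⊕ (tr (conj c ⊙ B x w) ⊕ h w)
      h-line c x w = trans (h-+ (c · x) w) (cong₂ (λ u v → u ⊕ (tr v ⊕ h w)) (h-· c x) (B-·ˡ c x w))

      Kernel : V n → Set
      Kernel x = ∀ y → B x y ≡ 0ₖ

      kernel? : ∀ x → Dec (Kernel x)
      kernel? x = ∀? (enumᵥ n) (λ y → B x y ≟ 0ₖ)

      B-0 : Kernel 0ᵥ
      B-0 y = trans (cong (λ w → B w y) (sym (0· 0ᵥ))) (trans (B-·ˡ 0ₖ 0ᵥ y) (trans (cong (_⊙ B 0ᵥ y) conj-0) (R.zeroˡ _)))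

      h-0 : h 0ᵥ ≡ 0ₖ
      h-0 = B-0 0ᵥ

      -- The dimension of the kernel, recorded through the exponential sum that it determines. In
      -- this form it passes to orthogonal complements and quotients by cancelling powers of `b`,
      -- without choosing a basis of the kernel.
      Nullity : ℕ → Set
      Nullity j = ∀ {φ t} → Balanced φ → Real t → ∑ (vecs n) (λ x → φ (t ⊕ h x)) ≡ b ^ (n ℕ.+ j) * φ t

    open Form public

    tr-0 : tr 0ₖ ≡ 0ₖ
    tr-0 = trans (cong (0ₖ ⊕_) conj-0) (R.+-identityˡ 0ₖ)

    pull : ∀ {k n} {ι : V k → V n} → Linear ι → Form n → Form k
    pull {ι = ι} lin F = record
      { B      = λ x y → B F (ι x) (ι y)
      ; B-+    = λ x y z → trans (cong (B F (ι x)) (map-+ lin y z)) (B-+ F _ _ _)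
      ; B-·    = λ c x y → trans (cong (B F (ι x)) (map-· lin c y)) (B-· F c _ _)
      ; B-conj = λ x y → B-conj F (ι x) (ι y)
      }

    module _ {n} (F : Form n) {φ : K → ℤ} {t : K} (bal : Balanced φ) (rt : Real t) where
      open ≡-Reasoning

      -- As `w` is orthogonal to `x`, there is no cross term and only a norm varies. The offset `β`
      -- is allowed because the coordinate complement is not orthogonal to `x`; translating `c`
      -- removes it.
      ∑-line-nonisotropic : ∀ x w β → h F x ≢ 0ₖ → B F x w ≡ 0ₖ →
        ∑ elems (λ c → φ (t ⊕ h F (c · x +ᵥ (β · x +ᵥ w)))) ≡ b * φ (t ⊕ h F w)
      ∑-line-nonisotropic x w β hx≢0 Bxw≡0 = begin
        ∑ elems (λ c → φ (t ⊕ h F (c · x +ᵥ (β · x +ᵥ w))))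
          ≡⟨ ∑-cong elems (λ c → cong φ (expand c)) ⟩
        ∑ elems (λ c → φ (t ⊕ h F w ⊕ nm (β ⊕ c) ⊙ h F x))
          ≡⟨ ∑K-translate β (λ c → φ (t ⊕ h F w ⊕ nm c ⊙ h F x)) ⟩
        ∑ elems (λ c → φ (t ⊕ h F w ⊕ nm c ⊙ h F x))
          ≡⟨ ∑-nm bal (real-⊕ rt (h-real F w)) (h-real F x) hx≢0 ⟩
        b * φ (t ⊕ h F w) ∎
        where
        expand : ∀ c → t ⊕ h F (c · x +ᵥ (β · x +ᵥ w)) ≡ t ⊕ h F w ⊕ nm (β ⊕ c) ⊙ h F x
        expand c = begin
          t ⊕ h F (c · x +ᵥ (β · x +ᵥ w))
            ≡⟨ cong (λ u → t ⊕ h F u) (trans (sym (+ᵥ-assoc (c · x) (β · x) w)) (cong (_+ᵥ w) (sym (·-distribʳ c β x)))) ⟩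
          t ⊕ h F ((c ⊕ β) · x +ᵥ w)
            ≡⟨ cong (λ u → t ⊕ h F (u · x +ᵥ w)) (R.+-comm c β) ⟩
          t ⊕ h F ((β ⊕ c) · x +ᵥ w)
            ≡⟨ cong (t ⊕_) (h-line F (β ⊕ c) x w) ⟩
          t ⊕ (nm (β ⊕ c) ⊙ h F x ⊕ (tr (conj (β ⊕ c) ⊙ B F x w) ⊕ h F w))
            ≡⟨ cong (λ u → t ⊕ (nm (β ⊕ c) ⊙ h F x ⊕ (u ⊕ h F w))) (trans (cong (λ u → tr (conj (β ⊕ c) ⊙ u)) Bxw≡0) (trans (cong tr (R.zeroʳ _)) tr-0)) ⟩
          t ⊕ (nm (β ⊕ c) ⊙ h F x ⊕ (0ₖ ⊕ h F w))
            ≡⟨ solve 3 (λ t a w → t :+ (a :+ (con 0 :+ w)) := (t :+ w) :+ a) refl t (nm (β ⊕ c) ⊙ h F x) (h F w) ⟩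
          t ⊕ h F w ⊕ nm (β ⊕ c) ⊙ h F x ∎
          where open KSolver

      -- The norm term dies with `h F x`, so `c` enters only through the trace of the cross term.
      ∑-line-isotropic : ∀ x w → h F x ≡ 0ₖ → B F x w ≢ 0ₖ → ∑ elems (λ c → φ (t ⊕ h F (c · x +ᵥ w))) ≡ 0ℤ
      ∑-line-isotropic x w hx≡0 Bxw≢0 = trans (∑-cong elems λ c → cong φ (expand c)) (∑-tr bal (real-⊕ rt (h-real F w)) Bxw≢0)
        where
        expand : ∀ c → t ⊕ h F (c · x +ᵥ w) ≡ t ⊕ h F w ⊕ tr (conj c ⊙ B F x w)
        expand c = begin
          t ⊕ h F (c · x +ᵥ w)
            ≡⟨ cong (t ⊕_) (h-line F c x w) ⟩
          t ⊕ (nm c ⊙ h F x ⊕ (tr (conj c ⊙ B F x w) ⊕ h F w))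
            ≡⟨ cong (λ u → t ⊕ (nm c ⊙ u ⊕ (tr (conj c ⊙ B F x w) ⊕ h F w))) hx≡0 ⟩
          t ⊕ (nm c ⊙ 0ₖ ⊕ (tr (conj c ⊙ B F x w) ⊕ h F w))
            ≡⟨ solve 4 (λ t a u w → t :+ (a :* con 0 :+ (u :+ w)) := (t :+ w) :+ u) refl t (nm c) (tr (conj c ⊙ B F x w)) (h F w) ⟩
          t ⊕ h F w ⊕ tr (conj c ⊙ B F x w) ∎
          where open KSolver

      ∑-line-kernel : ∀ x w → Kernel F x → ∑ elems (λ c → φ (t ⊕ h F (c · x +ᵥ w))) ≡ b * b * φ (t ⊕ h F w)
      ∑-line-kernel x w ker = begin
        ∑ elems (λ c → φ (t ⊕ h F (c · x +ᵥ w)))  ≡⟨ ∑-cong elems (λ c → trans (cong (λ u → φ (t ⊕ u)) (expand c)) (sym (ℤ.*-identityˡ _))) ⟩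
        ∑ elems (λ c → 1ℤ * φ (t ⊕ h F w))        ≡⟨ ∑-*ʳ elems (φ (t ⊕ h F w)) _ ⟩
        ∑ elems (λ c → 1ℤ) * φ (t ⊕ h F w)        ≡⟨ cong (_* φ (t ⊕ h F w)) (trans ∑1≡q² (sym b²≡q²)) ⟩
        b * b * φ (t ⊕ h F w)                     ∎
        where
        expand : ∀ c → h F (c · x +ᵥ w) ≡ h F w
        expand c = begin
          h F (c · x +ᵥ w)                                     ≡⟨ h-line F c x w ⟩
          nm c ⊙ h F x ⊕ (tr (conj c ⊙ B F x w) ⊕ h F w)       ≡⟨ cong₂ (λ u v → nm c ⊙ u ⊕ (tr (conj c ⊙ v) ⊕ h F w)) (ker x) (ker w) ⟩
          nm c ⊙ 0ₖ ⊕ (tr (conj c ⊙ 0ₖ) ⊕ h F w)               ≡⟨ cong (λ u → nm c ⊙ 0ₖ ⊕ (u ⊕ h F w)) (trans (cong tr (R.zeroʳ _)) tr-0) ⟩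
          nm c ⊙ 0ₖ ⊕ (0ₖ ⊕ h F w)                             ≡⟨ solve 2 (λ a w → a :* con 0 :+ (con 0 :+ w) := w) refl (nm c) (h F w) ⟩
          h F w                                                ∎
          where open KSolver

    -- The orthogonal projection of the complement along x.
    module Perp {n} (F : Form (suc n)) (x : V (suc n)) (hx≢0 : h F x ≢ 0ₖ) where
      hx⁻¹ : K
      hx⁻¹ = proj₁ (inverse (h F x) hx≢0)

      β : V n → K
      β z = B F x (complement x z) ⊙ hx⁻¹

      perp : V n → V (suc n)
      perp z = (⊖ β z) · x +ᵥ complement x z

      complement≡ : ∀ z → complement x z ≡ β z · x +ᵥ perp z
      complement≡ z = sym (begin
        β z · x +ᵥ ((⊖ β z) · x +ᵥ complement x z)   ≡⟨ +ᵥ-assoc _ _ _ ⟨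
        β z · x +ᵥ (⊖ β z) · x +ᵥ complement x z     ≡⟨ cong (_+ᵥ complement x z) (·-distribʳ (β z) (⊖ β z) x) ⟨
        (β z ⊕ ⊖ β z) · x +ᵥ complement x z          ≡⟨ cong (λ u → u · x +ᵥ complement x z) (R.-‿inverseʳ (β z)) ⟩
        0ₖ · x +ᵥ complement x z                     ≡⟨ cong (_+ᵥ complement x z) (0· x) ⟩
        0ᵥ +ᵥ complement x z                         ≡⟨ +ᵥ-identityˡ _ ⟩
        complement x z                               ∎)
        where open ≡-Reasoning

      perp-⊥ : ∀ z → B F x (perp z) ≡ 0ₖ
      perp-⊥ z = begin
        B F x (perp z)                                        ≡⟨ B-+ F x _ _ ⟩
        B F x ((⊖ β z) · x) ⊕ γ                               ≡⟨ cong (_⊕ γ) (B-· F (⊖ β z) x x) ⟩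
        (⊖ β z) ⊙ h F x ⊕ γ                                   ≡⟨ cong (_⊕ γ) (-‿distribˡ-* (β z) (h F x)) ⟨
        ⊖ (γ ⊙ hx⁻¹ ⊙ h F x) ⊕ γ                              ≡⟨ cong (λ u → ⊖ u ⊕ γ) (trans (R.*-assoc γ hx⁻¹ (h F x))
                                                                   (trans (cong (γ ⊙_) (trans (R.*-comm hx⁻¹ _) (proj₂ (inverse (h F x) hx≢0)))) (R.*-identityʳ γ))) ⟩
        ⊖ γ ⊕ γ                                               ≡⟨ R.-‿inverseˡ γ ⟩
        0ₖ                                                    ∎
        where
        open ≡-Reasoning
        γ = B F x (complement x z)

      private
        lin = complement-linear x

      β-+ : ∀ u v → β (u +ᵥ v) ≡ β u ⊕ β v
      β-+ u v = trans (cong (_⊙ hx⁻¹) (trans (cong (B F x) (map-+ lin u v)) (B-+ F x _ _))) (R.distribʳ hx⁻¹ _ _)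

      β-· : ∀ c v → β (c · v) ≡ c ⊙ β v
      β-· c v = trans (cong (_⊙ hx⁻¹) (trans (cong (B F x) (map-· lin c v)) (B-· F c x _))) (R.*-assoc c _ hx⁻¹)

      perp-linear : Linear perp
      perp-linear = record { map-+ = add ; map-· = scale }
        where
        open ≡-Reasoning
        add : ∀ u v → perp (u +ᵥ v) ≡ perp u +ᵥ perp v
        add u v = begin
          (⊖ β (u +ᵥ v)) · x +ᵥ complement x (u +ᵥ v)
            ≡⟨ cong₂ (λ s w → s · x +ᵥ w) (trans (cong ⊖_ (β-+ u v)) (sym (-‿+-comm (β u) (β v)))) (map-+ lin u v) ⟩
          (⊖ β u ⊕ ⊖ β v) · x +ᵥ (complement x u +ᵥ complement x v)
            ≡⟨ cong (_+ᵥ (complement x u +ᵥ complement x v)) (·-distribʳ _ _ x) ⟩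
          (⊖ β u) · x +ᵥ (⊖ β v) · x +ᵥ (complement x u +ᵥ complement x v)
            ≡⟨ interchange ((⊖ β u) · x) ((⊖ β v) · x) (complement x u) (complement x v) ⟩
          perp u +ᵥ perp v ∎
          where
          interchange : ∀ {k} (s t u v : V k) → s +ᵥ t +ᵥ (u +ᵥ v) ≡ s +ᵥ u +ᵥ (t +ᵥ v)
          interchange []      []      []      []      = refl
          interchange (s ∷ ss) (t ∷ ts) (u ∷ us) (v ∷ vs) = cong₂ _∷_
            (solve 4 (λ s t u v → (s :+ t) :+ (u :+ v) := (s :+ u) :+ (t :+ v)) refl s t u v) (interchange ss ts us vs)
            where open KSolver
        scale : ∀ c v → perp (c · v) ≡ c · perp v
        scale c v = begin
          (⊖ β (c · v)) · x +ᵥ complement x (c · v)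
            ≡⟨ cong₂ (λ s w → s · x +ᵥ w) (trans (cong ⊖_ (β-· c v)) (-‿distribʳ-* c (β v))) (map-· lin c v) ⟩
          (c ⊙ ⊖ β v) · x +ᵥ c · complement x v
            ≡⟨ cong (_+ᵥ c · complement x v) (·-assoc c (⊖ β v) x) ⟩
          c · (⊖ β v) · x +ᵥ c · complement x v
            ≡⟨ ·-distribˡ c _ _ ⟨
          c · perp v ∎

      perp-form : Form n
      perp-form = pull perp-linear F

      ∑-line-perp : ∀ {φ t} → Balanced φ → Real t → ∀ z →
        ∑ elems (λ c → φ (t ⊕ h F (c · x +ᵥ complement x z))) ≡ b * φ (t ⊕ h perp-form z)
      ∑-line-perp {φ} {t} bal rt z = trans
        (∑-cong elems λ c → cong (λ u → φ (t ⊕ h F (c · x +ᵥ u))) (complement≡ z))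
        (∑-line-nonisotropic F bal rt x (perp z) (β z) hx≢0 (perp-⊥ z))

      ∑-perp : ∀ {φ t} → Balanced φ → Real t →
        ∑ (vecs (suc n)) (λ y → φ (t ⊕ h F y)) ≡ b * ∑ (vecs n) (λ z → φ (t ⊕ h perp-form z))
      ∑-perp {φ} {t} bal rt = trans (∑-complement x (λ { refl → hx≢0 (h-0 F) }) _)
        (trans (∑-cong (vecs n) (∑-line-perp bal rt)) (∑-*ˡ (vecs n) b _))

      -- Splitting off a nonisotropic vector lowers the dimension by one and costs one factor `b` in
      -- the sum, so the nullity is unchanged.
      perp-nullity : ∀ {j} → Nullity F j → Nullity perp-form j
      perp-nullity {j} nul {φ} {t} bal rt = ℤ.*-cancelˡ-≡ b _ _
        (trans (sym (∑-perp bal rt)) (trans (nul bal rt) (ℤ.*-assoc b _ _)))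

      nullity-perp : ∀ {j} → Nullity perp-form j → Nullity F j
      nullity-perp {j} nul {φ} {t} bal rt = trans (∑-perp bal rt) (trans (cong (b *_) (nul bal rt)) (sym (ℤ.*-assoc b _ _)))

    -- Restriction to a complement stands for the quotient form. Dimension and nullity both drop by
    -- one, which matches the factor b² = q² from the points on each translate of the line.
    kernel-nullity : ∀ {n j} (F : Form (suc n)) x → x ≢ 0ᵥ → Kernel F x → Nullity F (suc j) →
                     Nullity (pull (complement-linear x) F) j
    kernel-nullity {n} {j} F x x≢0 ker nul {φ} {t} bal rt = ℤ.*-cancelˡ-≡ (b * b) _ _ {{ℤ.i*j≢0 b b}} (begin
      b * b * ∑ (vecs n) (λ z → φ (t ⊕ h F (complement x z)))                       ≡⟨ ∑-*ˡ (vecs n) (b * b) _ ⟨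
      ∑ (vecs n) (λ z → b * b * φ (t ⊕ h F (complement x z)))                       ≡⟨ ∑-cong (vecs n) (λ z → ∑-line-kernel F bal rt x (complement x z) ker) ⟨
      ∑ (vecs n) (λ z → ∑ elems λ c → φ (t ⊕ h F (c · x +ᵥ complement x z)))        ≡⟨ ∑-complement x x≢0 _ ⟨
      ∑ (vecs (suc n)) (λ y → φ (t ⊕ h F y))                                        ≡⟨ nul bal rt ⟩
      b * b ^ (n ℕ.+ suc j) * φ t                                                   ≡⟨ cong (λ e → b * b ^ e * φ t) (ℕ.+-suc n j) ⟩
      b * (b * b ^ (n ℕ.+ j)) * φ t                                                 ≡⟨ lem b _ _ ⟩
      b * b * (b ^ (n ℕ.+ j) * φ t)                                                 ∎)
      where
      open ≡-Reasoning
      lem : ∀ b u v → b * (b * u) * v ≡ b * b * (u * v)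
      lem = solve-∀

    zero-nullity : ∀ {n} (F : Form n) → (∀ x → h F x ≡ 0ₖ) → Nullity F n
    zero-nullity {n} F h≡0 {φ} {t} bal rt = begin
      ∑ (vecs n) (λ x → φ (t ⊕ h F x))  ≡⟨ ∑-cong (vecs n) (λ x → trans (cong φ (trans (cong (t ⊕_) (h≡0 x)) (R.+-identityʳ t))) (sym (ℤ.*-identityˡ _))) ⟩
      ∑ (vecs n) (λ x → 1ℤ * φ t)       ≡⟨ ∑-*ʳ (vecs n) (φ t) _ ⟩
      ∑ (vecs n) (λ x → 1ℤ) * φ t       ≡⟨ cong (_* φ t) (∑V-1 n) ⟩
      b ^ (n ℕ.+ n) * φ t               ∎
      where open ≡-Reasoning

    -- Diagonalisation: nonisotropic vectors are split off until `h` vanishes identically, where the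
    -- sum is constant.
    nullity-exists : ∀ {n} (F : Form n) → ∃ (Nullity F)
    nullity-exists {zero} F = 0 , zero-nullity F λ { [] → h-0 F }
    nullity-exists {suc n} F with ∃? (enumᵥ (suc n)) (λ x → ¬? (h F x ≟ 0ₖ))
    ... | yes (x , hx≢0) with nullity-exists (Perp.perp-form F x hx≢0)
    ...   | j , nul = j , Perp.nullity-perp F x hx≢0 {j} nul
    nullity-exists {suc n} F | no ¬∃ = suc n , zero-nullity F λ x → decidable-stable (h F x ≟ 0ₖ) λ hx≢0 → ¬∃ (x , hx≢0)

    b^≢0 : ∀ e → ℤ.NonZero (b ^ e)
    b^≢0 e = ℤ.≢-nonZero λ e≡0 → contradiction (trans (sym b≡-q) (ℤ.i^n≡0⇒i≡0 b e e≡0)) λ ()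

    -- On F_q this is the sum of all nontrivial additive characters, and it has integer values.
    ψ : K → ℤ
    ψ s = + q * 𝟙 (0ₖ ≟ s) + - 1ℤ

    ψ-balanced : Balanced ψ
    ψ-balanced = begin
      ∑ elems (λ s → ε s * (+ q * 𝟙 (0ₖ ≟ s) + - 1ℤ))                  ≡⟨ ∑-cong elems (λ s → lem (ε s) (+ q) (𝟙 (0ₖ ≟ s))) ⟩
      ∑ elems (λ s → + q * (𝟙 (0ₖ ≟ s) * ε s) + - 1ℤ * ε s)            ≡⟨ ∑-+ elems _ _ ⟩
      ∑ elems (λ s → + q * (𝟙 (0ₖ ≟ s) * ε s)) + ∑ elems (λ s → - 1ℤ * ε s) ≡⟨ cong₂ _+_ (∑-*ˡ elems (+ q) _) (∑-*ˡ elems (- 1ℤ) ε) ⟩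
      + q * ∑ elems (λ s → 𝟙 (0ₖ ≟ s) * ε s) + - 1ℤ * ∑ elems ε        ≡⟨ cong₂ (λ u v → + q * u + - 1ℤ * v) (trans (∑-δ enum 0ₖ ε) (𝟙-yes (real? 0ₖ) conj-0)) ∑ε≡q ⟩
      + q * 1ℤ + - 1ℤ * + q                                            ≡⟨ lem′ (+ q) ⟩
      0ℤ                                                               ∎
      where
      open ≡-Reasoning
      lem : ∀ e x d → e * (x * d + - 1ℤ) ≡ x * (d * e) + - 1ℤ * e
      lem = solve-∀
      lem′ : ∀ x → x * 1ℤ + - 1ℤ * x ≡ 0ℤ
      lem′ = solve-∀

    ψ0 : ψ 0ₖ ≡ + suc r
    ψ0 = trans (cong (λ d → + q * d + - 1ℤ) (𝟙-yes (0ₖ ≟ 0ₖ) refl)) (cong (_+ - 1ℤ) (ℤ.*-identityʳ (+ q)))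

    balanced-⊖ : ∀ {φ} → Balanced φ → Balanced (λ s → φ (⊖ s))
    balanced-⊖ {φ} bal = trans (∑-cong elems λ s → cong (_* φ (⊖ s)) (𝟙-cong (real? s) (real? (⊖ s)) real-⊖
        λ r⊖s → subst Real (-‿involutive s) (real-⊖ r⊖s)))
      (trans (∑-reindex enum ⊖_ ⊖_ -‿involutive -‿involutive (λ s → ε s * φ s)) bal)

    -- |∑ₓ φ(h x)|² counts the kernel: expanding h(x + y) − h(y), only the x in the kernel survive the sum over y.
    kernel-size : ∀ {n j} (F : Form n) → Nullity F j → ∑ (vecs n) (λ x → 𝟙 (kernel? F x)) ≡ b ^ (j ℕ.+ j)
    kernel-size {n} {j} F nul = ℤ.*-cancelˡ-≡ (b ^ (n ℕ.+ n)) _ _ {{b^≢0 (n ℕ.+ n)}} (ℤ.*-cancelʳ-≡ _ _ (+ suc r) (begin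
      b ^ (n ℕ.+ n) * κ * + suc r                                  ≡⟨ cong (b ^ (n ℕ.+ n) * κ *_) ψ0 ⟨
      b ^ (n ℕ.+ n) * κ * ψ 0ₖ                                     ≡⟨ lem (b ^ (n ℕ.+ n)) κ (ψ 0ₖ) ⟩
      κ * (b ^ (n ℕ.+ n) * ψ 0ₖ)                                   ≡⟨ ∑-*ʳ (vecs n) _ _ ⟨
      ∑ (vecs n) (λ x → 𝟙 (kernel? F x) * (b ^ (n ℕ.+ n) * ψ 0ₖ))  ≡⟨ ∑-cong (vecs n) inner ⟨
      ∑ (vecs n) (λ x → ∑ (vecs n) λ y → ψ (h F x ⊕ tr (B F x y))) ≡⟨ ∑-swap (vecs n) (vecs n) _ ⟩
      ∑ (vecs n) (λ y → ∑ (vecs n) λ x → ψ (h F x ⊕ tr (B F x y))) ≡⟨ ∑-cong (vecs n) (λ y → ∑-cong (vecs n) λ x → cong ψ (shift x y)) ⟩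
      ∑ (vecs n) (λ y → ∑ (vecs n) λ x → ψ (⊖ h F y ⊕ h F (y +ᵥ x))) ≡⟨ ∑-cong (vecs n) (λ y → ∑V-translate y (λ x → ψ (⊖ h F y ⊕ h F x))) ⟩
      ∑ (vecs n) (λ y → ∑ (vecs n) λ x → ψ (⊖ h F y ⊕ h F x))      ≡⟨ ∑-cong (vecs n) (λ y → nul ψ-balanced (real-⊖ (h-real F y))) ⟩
      ∑ (vecs n) (λ y → b ^ (n ℕ.+ j) * ψ (⊖ h F y))               ≡⟨ ∑-*ˡ (vecs n) (b ^ (n ℕ.+ j)) _ ⟩
      b ^ (n ℕ.+ j) * ∑ (vecs n) (λ y → ψ (⊖ h F y))               ≡⟨ cong (b ^ (n ℕ.+ j) *_) (∑-cong (vecs n) λ y → cong (λ u → ψ (⊖ u)) (R.+-identityˡ (h F y))) ⟨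
      b ^ (n ℕ.+ j) * ∑ (vecs n) (λ y → ψ (⊖ (0ₖ ⊕ h F y)))        ≡⟨ cong (b ^ (n ℕ.+ j) *_) (nul (balanced-⊖ ψ-balanced) conj-0) ⟩
      b ^ (n ℕ.+ j) * (b ^ (n ℕ.+ j) * ψ (⊖ 0ₖ))                   ≡⟨ cong (λ u → b ^ (n ℕ.+ j) * (b ^ (n ℕ.+ j) * u)) (trans (cong ψ -0#≈0#) ψ0) ⟩
      b ^ (n ℕ.+ j) * (b ^ (n ℕ.+ j) * + suc r)                    ≡⟨ cong (λ u → u * (u * + suc r)) (ℤ.^-distribˡ-+-* b n j) ⟩
      b ^ n * b ^ j * (b ^ n * b ^ j * + suc r)                    ≡⟨ lem′ (b ^ n) (b ^ j) (+ suc r) ⟩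
      b ^ n * b ^ n * (b ^ j * b ^ j) * + suc r                    ≡⟨ cong₂ (λ u v → u * v * + suc r) (ℤ.^-distribˡ-+-* b n n) (ℤ.^-distribˡ-+-* b j j) ⟨
      b ^ (n ℕ.+ n) * b ^ (j ℕ.+ j) * + suc r                      ∎))
      where
      open ≡-Reasoning
      κ = ∑ (vecs n) (λ x → 𝟙 (kernel? F x))
      lem : ∀ a k s → a * k * s ≡ k * (a * s)
      lem = solve-∀
      lem′ : ∀ a c s → a * c * (a * c * s) ≡ a * a * (c * c) * s
      lem′ = solve-∀
      shift : ∀ x y → h F x ⊕ tr (B F x y) ≡ ⊖ h F y ⊕ h F (y +ᵥ x)
      shift x y = begin
        h F x ⊕ tr (B F x y)                       ≡⟨ ⊕-cancelˡ (h F y) _ ⟨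
        ⊖ h F y ⊕ (h F y ⊕ (h F x ⊕ tr (B F x y))) ≡⟨ cong (⊖ h F y ⊕_) (solve 3 (λ y x t → y :+ (x :+ t) := x :+ (t :+ y)) refl (h F y) (h F x) (tr (B F x y))) ⟩
        ⊖ h F y ⊕ (h F x ⊕ (tr (B F x y) ⊕ h F y)) ≡⟨ cong (⊖ h F y ⊕_) (h-+ F x y) ⟨
        ⊖ h F y ⊕ h F (x +ᵥ y)                     ≡⟨ cong (λ u → ⊖ h F y ⊕ h F u) (+ᵥ-comm x y) ⟩
        ⊖ h F y ⊕ h F (y +ᵥ x)                     ∎
        where open KSolver
      inner : ∀ x → ∑ (vecs n) (λ y → ψ (h F x ⊕ tr (B F x y))) ≡ 𝟙 (kernel? F x) * (b ^ (n ℕ.+ n) * ψ 0ₖ)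
      inner x with kernel? F x
      ... | yes ker = trans (∑-cong (vecs n) λ y → trans (cong ψ (trans (cong₂ (λ u v → u ⊕ tr v) (ker x) (ker y)) (trans (R.+-identityˡ _) tr-0)))
                        (sym (ℤ.*-identityˡ (ψ 0ₖ)))) (trans (∑-*ʳ (vecs n) (ψ 0ₖ) _) (trans (cong (_* ψ 0ₖ) (∑V-1 n)) (sym (ℤ.*-identityˡ _))))
      ... | no ¬ker with ∃? (enumᵥ n) (λ y → ¬? (B F x y ≟ 0ₖ))
      ...   | no ¬∃ = contradiction (λ y → decidable-stable (B F x y ≟ 0ₖ) λ ne → ¬∃ (y , ne)) ¬ker
      -- Outside the kernel, q² copies of the sum are taken, translated by the multiples of some
      -- `y₀` not orthogonal to `x`. Summing over the multiple first gives a trace sum, which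
      -- vanishes. The scalar is `conj c` to fit the shape of `∑-tr`.
      ...   | yes (y₀ , ne) = ℤ.*-cancelˡ-≡ (+ q * + q) _ 0ℤ (begin
        + q * + q * ∑ (vecs n) f                                ≡⟨ cong (_* ∑ (vecs n) f) ∑1≡q² ⟨
        ∑ elems (λ _ → 1ℤ) * ∑ (vecs n) f                       ≡⟨ ∑-*ʳ elems (∑ (vecs n) f) _ ⟨
        ∑ elems (λ c → 1ℤ * ∑ (vecs n) f)                       ≡⟨ ∑-cong elems (λ c → trans (ℤ.*-identityˡ _) (sym (∑V-translate (conj c · y₀) f))) ⟩
        ∑ elems (λ c → ∑ (vecs n) λ y → f (conj c · y₀ +ᵥ y))   ≡⟨ ∑-swap elems (vecs n) _ ⟩
        ∑ (vecs n) (λ y → ∑ elems λ c → f (conj c · y₀ +ᵥ y))   ≡⟨ ∑-cong (vecs n) (λ y → trans (∑-cong elems λ c → cong ψ (expand c y))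
                                                                     (∑-tr ψ-balanced (real-⊕ (h-real F x) (tr-real (B F x y))) ne)) ⟩
        ∑ (vecs n) (λ y → 0ℤ)                                   ≡⟨ ∑-0 (vecs n) ⟩
        0ℤ                                                      ≡⟨ ℤ.*-zeroʳ (+ q * + q) ⟨
        + q * + q * 0ℤ                                          ∎)
        where
        f : V n → ℤ
        f y = ψ (h F x ⊕ tr (B F x y))
        expand : ∀ c y → h F x ⊕ tr (B F x (conj c · y₀ +ᵥ y)) ≡ h F x ⊕ tr (B F x y) ⊕ tr (conj c ⊙ B F x y₀)
        expand c y = begin
          h F x ⊕ tr (B F x (conj c · y₀ +ᵥ y))                ≡⟨ cong (λ u → h F x ⊕ tr u) (trans (B-+ F x _ y) (cong (_⊕ B F x y) (B-· F (conj c) x y₀))) ⟩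
          h F x ⊕ tr (conj c ⊙ B F x y₀ ⊕ B F x y)             ≡⟨ cong (h F x ⊕_) (tr-⊕ _ _) ⟩
          h F x ⊕ (tr (conj c ⊙ B F x y₀) ⊕ tr (B F x y))      ≡⟨ solve 3 (λ a s t → a :+ (s :+ t) := (a :+ t) :+ s) refl (h F x) (tr (conj c ⊙ B F x y₀)) (tr (B F x y)) ⟩
          h F x ⊕ tr (B F x y) ⊕ tr (conj c ⊙ B F x y₀)        ∎
          where open KSolver

    -- Sums over frames

    Q : ∀ {n m} → Form n → Vec (V n) m → K
    Q F []      = 0ₖ
    Q F (z ∷ Z) = h F z ⊕ Q F Z

    Q-real : ∀ {n m} (F : Form n) (Z : Vec (V n) m) → Real (Q F Z)
    Q-real F []      = conj-0
    Q-real F (z ∷ Z) = real-⊕ (h-real F z) (Q-real F Z)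

    rows : ∀ {k n m} → V n → (V k → V n) → V m → Vec (V k) m → Vec (V n) m
    rows x ι = zipWith (λ c z → c · x +ᵥ ι z)

    -- Each ordered basis occurs exactly once: a nonzero first vector, then a basis of the quotient
    -- by its line, lifted with arbitrary multiples of the first vector added.
    frames : ∀ n → List (Vec (V n) n)
    frames zero    = [] ∷ []
    frames (suc n) = concatMap
      (λ x → cartesianProductWith (λ Z cs → x ∷ rows x (complement x) cs Z) (frames n) (vecs n))
      (filter (λ x → ¬? (x ≟ᵥ 0ᵥ)) (vecs (suc n)))

    ∑-frames : ∀ n (g : Vec (V (suc n)) (suc n) → ℤ) → ∑ (frames (suc n)) g ≡
      ∑ (vecs (suc n)) (λ x → 𝟙 (¬? (x ≟ᵥ 0ᵥ)) * ∑ (frames n) λ Z → ∑ (vecs n) λ cs → g (x ∷ rows x (complement x) cs Z))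
    ∑-frames n g = trans (∑-concatMap _ (filter (λ x → ¬? (x ≟ᵥ 0ᵥ)) (vecs (suc n))) g)
      (trans (∑-filter (λ x → ¬? (x ≟ᵥ 0ᵥ)) (vecs (suc n)) _)
        (∑-cong (vecs (suc n)) λ x → cong (𝟙 (¬? (x ≟ᵥ 0ᵥ)) *_) (∑-product _ (frames n) (vecs n) g)))

    -- Read off from the summation formula: applied to the indicator of `y` it must yield 1, so some
    -- term is nonzero.
    complement-spans : ∀ {n} (x : V (suc n)) → x ≢ 0ᵥ → ∀ y → ∃ λ c → ∃ λ z → y ≡ c · x +ᵥ complement x z
    complement-spans {n} x x≢0 y with ∑≢0⇒∃ (vecs n) _ (λ e → contradiction
      (trans (sym (count≡1 (enumᵥ (suc n)) y)) (trans (∑-complement x x≢0 (λ w → 𝟙 (y ≟ᵥ w))) e)) λ ())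
    ... | z , _ , ne with ∑≢0⇒∃ elems _ ne
    ...   | c , _ , ne′ with y ≟ᵥ (c · x +ᵥ complement x z)
    ...     | yes e = c , z , e
    ...     | no _  = contradiction refl ne′

    -- Spanning in dual form. The functional that matters is B(x, -): a vector outside the kernel
    -- cannot be orthogonal to everything in a frame.
    frames-span : ∀ {n} {Z : Vec (V n) n} → Z ∈ frames n → (f : V n → K) →
      (∀ u v → f (u +ᵥ v) ≡ f u ⊕ f v) → (∀ c v → f (c · v) ≡ c ⊙ f v) →
      (∀ i → f (lookup Z i) ≡ 0ₖ) → ∀ y → f y ≡ 0ₖ
    frames-span {zero}  _  f f-+ f-· f≡0 [] = trans (f-· 0ₖ []) (R.zeroˡ _)
    frames-span {suc n} Z∈ f f-+ f-· f≡0 y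
      with find (∈-concatMap⁻ _ {xs = filter (λ x → ¬? (x ≟ᵥ 0ᵥ)) (vecs (suc n))} Z∈)
    ... | x , x∈ , Z∈x with ∈-cartesianProductWith⁻ _ (frames n) (vecs n) Z∈x
    ...   | Z , cs , Z∈′ , _ , refl with complement-spans x (proj₂ (∈-filter⁻ _ {xs = vecs (suc n)} x∈)) y
    ...     | c , z , refl = begin
      f (c · x +ᵥ complement x z)     ≡⟨ f-+ _ _ ⟩
      f (c · x) ⊕ f (complement x z)  ≡⟨ cong₂ _⊕_ (fcx≡0 c) (frames-span Z∈′ (λ z → f (complement x z))
                                          (λ u v → trans (cong f (map-+ lin u v)) (f-+ _ _))
                                          (λ c v → trans (cong f (map-· lin c v)) (f-· _ _)) tail≡0 z) ⟩
      0ₖ ⊕ 0ₖ                         ≡⟨ R.+-identityˡ 0ₖ ⟩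
      0ₖ                              ∎
      where
      open ≡-Reasoning
      lin = complement-linear x
      fcx≡0 : ∀ c → f (c · x) ≡ 0ₖ
      fcx≡0 c = trans (f-· c x) (trans (cong (c ⊙_) (f≡0 zero)) (R.zeroʳ c))
      tail≡0 : ∀ i → f (complement x (lookup Z i)) ≡ 0ₖ
      tail≡0 i = begin
        f (complement x (lookup Z i))                                   ≡⟨ R.+-identityˡ _ ⟨
        0ₖ ⊕ f (complement x (lookup Z i))                              ≡⟨ cong (_⊕ f (complement x (lookup Z i))) (fcx≡0 (lookup cs i)) ⟨
        f (lookup cs i · x) ⊕ f (complement x (lookup Z i))             ≡⟨ f-+ _ _ ⟨
        f (lookup cs i · x +ᵥ complement x (lookup Z i))                ≡⟨ cong f (Vec.lookup-zipWith _ i cs Z) ⟨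
        f (lookup (rows x (complement x) cs Z) i)                       ≡⟨ f≡0 (suc i) ⟩
        0ₖ                                                              ∎

    module _ {n} (F : Form n) (x : V n) {k} (ι : V k → V n) {φ : K → ℤ} where
      open ≡-Reasoning

      -- The coefficients of the rows vary independently, so each row contributes one line sum and
      -- thereby one factor `a`. The values of the other rows sit in the shift meanwhile, which is
      -- why `step` is required for every real `t`.
      ∑-rows : (F′ : Form k) (a : ℤ) →
        (∀ {t} → Real t → ∀ z → ∑ elems (λ c → φ (t ⊕ h F (c · x +ᵥ ι z))) ≡ a * φ (t ⊕ h F′ z)) →
        ∀ {t} → Real t → ∀ {m} (Z : Vec (V k) m) →
        ∑ (vecs m) (λ cs → φ (t ⊕ Q F (rows x ι cs Z))) ≡ a ^ m * φ (t ⊕ Q F′ Z)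
      ∑-rows F′ a step {t} rt [] = trans (ℤ.+-identityʳ _) (sym (ℤ.*-identityˡ _))
      ∑-rows F′ a step {t} rt {suc m} (z ∷ Z) = begin
        ∑ (vecs (suc m)) (λ cs → φ (t ⊕ Q F (rows x ι cs (z ∷ Z))))
          ≡⟨ ∑-vecs m _ ⟩
        ∑ elems (λ c → ∑ (vecs m) λ cs → φ (t ⊕ (h F (c · x +ᵥ ι z) ⊕ Q F (rows x ι cs Z))))
          ≡⟨ ∑-cong elems (λ c → ∑-cong (vecs m) λ cs → cong φ (R.+-assoc t _ _)) ⟨
        ∑ elems (λ c → ∑ (vecs m) λ cs → φ (t ⊕ h F (c · x +ᵥ ι z) ⊕ Q F (rows x ι cs Z)))
          ≡⟨ ∑-cong elems (λ c → ∑-rows F′ a step (real-⊕ rt (h-real F _)) Z) ⟩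
        ∑ elems (λ c → a ^ m * φ (t ⊕ h F (c · x +ᵥ ι z) ⊕ Q F′ Z))
          ≡⟨ ∑-*ˡ elems (a ^ m) _ ⟩
        a ^ m * ∑ elems (λ c → φ (t ⊕ h F (c · x +ᵥ ι z) ⊕ Q F′ Z))
          ≡⟨ cong (a ^ m *_) (∑-cong elems λ c → cong φ (⊕-right-comm t _ _)) ⟩
        a ^ m * ∑ elems (λ c → φ (t ⊕ Q F′ Z ⊕ h F (c · x +ᵥ ι z)))
          ≡⟨ cong (a ^ m *_) (step (real-⊕ rt (Q-real F′ Z)) z) ⟩
        a ^ m * (a * φ (t ⊕ Q F′ Z ⊕ h F′ z))
          ≡⟨ lem (a ^ m) a _ ⟩
        a * a ^ m * φ (t ⊕ Q F′ Z ⊕ h F′ z)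
          ≡⟨ cong (λ u → a * a ^ m * φ u) (trans (R.+-assoc t _ _) (cong (t ⊕_) (R.+-comm _ _))) ⟩
        a * a ^ m * φ (t ⊕ (h F′ z ⊕ Q F′ Z)) ∎
        where
        lem : ∀ u a f → u * (a * f) ≡ a * u * f
        lem = solve-∀
        ⊕-right-comm : ∀ t u v → t ⊕ u ⊕ v ≡ t ⊕ v ⊕ u
        ⊕-right-comm t u v = trans (R.+-assoc t u v) (trans (cong (t ⊕_) (R.+-comm u v)) (sym (R.+-assoc t v u)))

      -- A single vanishing line sum is enough: its coefficient is summed innermost, with all other
      -- rows in the shift.
      ∑-rows-0 : ∀ {t} → Real t → ∀ {m} (Z : Vec (V k) m) i →
        (∀ {t} → Real t → ∑ elems (λ c → φ (t ⊕ h F (c · x +ᵥ ι (lookup Z i)))) ≡ 0ℤ) →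
        ∑ (vecs m) (λ cs → φ (t ⊕ Q F (rows x ι cs Z))) ≡ 0ℤ
      ∑-rows-0 {t} rt {suc m} (z ∷ Z) zero step = begin
        ∑ (vecs (suc m)) (λ cs → φ (t ⊕ Q F (rows x ι cs (z ∷ Z))))
          ≡⟨ ∑-vecs m _ ⟩
        ∑ elems (λ c → ∑ (vecs m) λ cs → φ (t ⊕ (h F (c · x +ᵥ ι z) ⊕ Q F (rows x ι cs Z))))
          ≡⟨ ∑-swap elems (vecs m) _ ⟩
        ∑ (vecs m) (λ cs → ∑ elems λ c → φ (t ⊕ (h F (c · x +ᵥ ι z) ⊕ Q F (rows x ι cs Z))))
          ≡⟨ ∑-cong (vecs m) (λ cs → trans (∑-cong elems λ c → cong φ (trans (cong (t ⊕_) (R.+-comm _ _)) (sym (R.+-assoc t _ _))))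
               (step (real-⊕ rt (Q-real F (rows x ι cs Z))))) ⟩
        ∑ (vecs m) (λ cs → 0ℤ)
          ≡⟨ ∑-0 (vecs m) ⟩
        0ℤ ∎
      ∑-rows-0 {t} rt {suc m} (z ∷ Z) (suc i) step = begin
        ∑ (vecs (suc m)) (λ cs → φ (t ⊕ Q F (rows x ι cs (z ∷ Z))))
          ≡⟨ ∑-vecs m _ ⟩
        ∑ elems (λ c → ∑ (vecs m) λ cs → φ (t ⊕ (h F (c · x +ᵥ ι z) ⊕ Q F (rows x ι cs Z))))
          ≡⟨ ∑-cong elems (λ c → trans (∑-cong (vecs m) λ cs → cong φ (sym (R.+-assoc t _ _)))
               (∑-rows-0 (real-⊕ rt (h-real F _)) Z i step)) ⟩
        ∑ elems (λ c → 0ℤ)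
          ≡⟨ ∑-0 elems ⟩
        0ℤ ∎

    -- The isotropic vectors are subtracted from the full sum, and their number comes from the
    -- nullity equation for `ψ`. The factor `b` in front clears the division by q in that number.
    ∑-nonisotropic : ∀ {n j} (F : Form n) → Nullity F j → ∀ {φ t} → Balanced φ → Real t →
      b * ∑ (vecs n) (λ x → 𝟙 (¬? (h F x ≟ 0ₖ)) * φ (t ⊕ h F x)) ≡ (b ^ (n ℕ.+ n) + - b ^ (n ℕ.+ j)) * φ t
    ∑-nonisotropic {n} {j} F nul {φ} {t} bal rt = begin
      b * ∑ (vecs n) (λ x → 𝟙 (¬? (h F x ≟ 0ₖ)) * φ (t ⊕ h F x))
        ≡⟨ cong (b *_) (∑-cong (vecs n) split) ⟩
      b * ∑ (vecs n) (λ x → φ (t ⊕ h F x) + 𝟙 (0ₖ ≟ h F x) * - φ t)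
        ≡⟨ cong (b *_) (trans (∑-+ (vecs n) _ _) (cong₂ _+_ (nul bal rt) (∑-*ʳ (vecs n) (- φ t) _))) ⟩
      b * (y * φ t + isotropic * - φ t)
        ≡⟨ lem b y isotropic (φ t) ⟩
      (b * y + - b * isotropic) * φ t
        ≡⟨ cong (λ u → (b * y + u) * φ t) isotropic-count ⟩
      (b * y + (b ^ (n ℕ.+ n) + y * (- b + - 1ℤ))) * φ t
        ≡⟨ lem′ b y (b ^ (n ℕ.+ n)) (φ t) ⟩
      (b ^ (n ℕ.+ n) + - y) * φ t ∎
      where
      open ≡-Reasoning
      y isotropic : ℤ
      y = b ^ (n ℕ.+ j)
      isotropic = ∑ (vecs n) (λ x → 𝟙 (0ₖ ≟ h F x))
      lem : ∀ b y i f → b * (y * f + i * - f) ≡ (b * y + - b * i) * f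
      lem = solve-∀
      lem′ : ∀ b y z f → (b * y + (z + y * (- b + - 1ℤ))) * f ≡ (z + - y) * f
      lem′ = solve-∀
      split : ∀ x → 𝟙 (¬? (h F x ≟ 0ₖ)) * φ (t ⊕ h F x) ≡ φ (t ⊕ h F x) + 𝟙 (0ₖ ≟ h F x) * - φ t
      split x with h F x ≟ 0ₖ
      ... | no ne  = trans (ℤ.*-identityˡ _) (sym (trans (cong (λ u → φ (t ⊕ h F x) + u * - φ t) (𝟙-no (0ₖ ≟ h F x) λ e → ne (sym e))) (ℤ.+-identityʳ _)))
      ... | yes e  = sym (trans (cong₂ (λ u v → φ u + v * - φ t) (trans (cong (t ⊕_) e) (R.+-identityʳ t)) (𝟙-yes (0ₖ ≟ h F x) (sym e))) (lem″ (φ t)))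
        where
        lem″ : ∀ f → f + 1ℤ * - f ≡ 0ℤ
        lem″ = solve-∀
      q≡-b : + q ≡ - b
      q≡-b = trans (sym (ℤ.neg-involutive (+ q))) (cong -_ (sym b≡-q))
      isotropic-count : - b * isotropic ≡ b ^ (n ℕ.+ n) + y * (- b + - 1ℤ)
      isotropic-count = begin
        - b * isotropic
          ≡⟨ lem₁ (- b) isotropic (b ^ (n ℕ.+ n)) ⟩
        b ^ (n ℕ.+ n) + (- b * isotropic + - 1ℤ * b ^ (n ℕ.+ n))
          ≡⟨ cong (λ u → b ^ (n ℕ.+ n) + u) ψ-sum ⟨
        b ^ (n ℕ.+ n) + ∑ (vecs n) (λ x → ψ (0ₖ ⊕ h F x))
          ≡⟨ cong (_+_ (b ^ (n ℕ.+ n))) (nul ψ-balanced conj-0) ⟩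
        b ^ (n ℕ.+ n) + y * ψ 0ₖ
          ≡⟨ cong (λ u → b ^ (n ℕ.+ n) + y * u) (trans (cong (λ d → + q * d + - 1ℤ) (𝟙-yes (0ₖ ≟ 0ₖ) refl))
               (cong (_+ - 1ℤ) (trans (ℤ.*-identityʳ (+ q)) q≡-b))) ⟩
        b ^ (n ℕ.+ n) + y * (- b + - 1ℤ) ∎
        where
        lem₁ : ∀ c i z → c * i ≡ z + (c * i + - 1ℤ * z)
        lem₁ = solve-∀
        ψ-sum : ∑ (vecs n) (λ x → ψ (0ₖ ⊕ h F x)) ≡ - b * isotropic + - 1ℤ * b ^ (n ℕ.+ n)
        ψ-sum = begin
          ∑ (vecs n) (λ x → ψ (0ₖ ⊕ h F x))                          ≡⟨ ∑-cong (vecs n) (λ x → cong ψ (R.+-identityˡ (h F x))) ⟩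
          ∑ (vecs n) (λ x → + q * 𝟙 (0ₖ ≟ h F x) + - 1ℤ * 1ℤ)        ≡⟨ ∑-+ (vecs n) _ _ ⟩
          ∑ (vecs n) (λ x → + q * 𝟙 (0ₖ ≟ h F x)) + ∑ (vecs n) (λ x → - 1ℤ * 1ℤ)
            ≡⟨ cong₂ _+_ (trans (∑-*ˡ (vecs n) (+ q) _) (cong (_* isotropic) q≡-b)) (trans (∑-*ˡ (vecs n) (- 1ℤ) _) (cong (- 1ℤ *_) (∑V-1 n))) ⟩
          - b * isotropic + - 1ℤ * b ^ (n ℕ.+ n)                     ∎

    -- M(n) P(n) is the order of GL_n over the field with b² elements. Each of its factors b^(2i) -
    -- 1 is split: b^i - 1 goes to `M`, b^i + 1 to `P`, and the remaining powers of `b` go to `M`.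
    M P : ℕ → ℤ
    M zero    = 1ℤ
    M (suc n) = b ^ (n ℕ.+ n) * (b ^ suc n + - 1ℤ) * M n
    P zero    = 1ℤ
    P (suc j) = (b ^ suc j + 1ℤ) * P j

    b^e≡1⇒e≡0 : ∀ e → b ^ e ≡ 1ℤ → e ≡ 0
    b^e≡1⇒e≡0 zero    _  = refl
    b^e≡1⇒e≡0 (suc e) eq = contradiction (ℕ.m*n≡1⇒m≡1 q ℤ.∣ b ^ e ∣ (trans (sym (trans (ℤ.abs-* b (b ^ e))
      (cong (ℕ._* ℤ.∣ b ^ e ∣) (cong ℤ.∣_∣ b≡-q)))) (cong ℤ.∣_∣ eq))) λ ()

    -- With nullity 0 the kernel has b^0 = 1 element, and the zero vector is one already. The
    -- difference of the two indicators is nonnegative with sum 0, yet it would be 1 at `x`.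
    kernel≢0⇒nullity≢0 : ∀ {n} (F : Form n) x → x ≢ 0ᵥ → Kernel F x → ¬ Nullity F 0
    kernel≢0⇒nullity≢0 {n} F x x≢0 ker nul = contradiction
      (0≤∑≤0⇒0 (vecs n) nonneg (ℤ.≤-reflexive sum≡0) (enum-∈ (enumᵥ n) x))
      (subst (_≢ 0ℤ) (sym (cong₂ (λ u v → u + - 1ℤ * v) (𝟙-yes (kernel? F x) ker) (𝟙-no (0ᵥ ≟ᵥ x) λ e → x≢0 (sym e)))) λ ())
      where
      nonneg : ∀ y → 0ℤ ≤ 𝟙 (kernel? F y) + - 1ℤ * 𝟙 (0ᵥ ≟ᵥ y)
      nonneg y with kernel? F y | 0ᵥ ≟ᵥ y
      ... | yes _   | yes _    = ℤ.≤-refl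
      ... | yes _   | no _     = +≤+ ℕ.z≤n
      ... | no ¬ker | yes refl = contradiction (B-0 F) ¬ker
      ... | no _    | no _     = ℤ.≤-refl
      sum≡0 : ∑ (vecs n) (λ y → 𝟙 (kernel? F y) + - 1ℤ * 𝟙 (0ᵥ ≟ᵥ y)) ≡ 0ℤ
      sum≡0 = trans (∑-+ (vecs n) _ _) (cong₂ _+_ (kernel-size {j = 0} F nul)
        (trans (∑-*ˡ (vecs n) (- 1ℤ) _) (cong (- 1ℤ *_) (count≡1 (enumᵥ n) 0ᵥ))))

    -- This weighs the nonzero kernel vectors, which have quotient forms of nullity j - 1. At j = 0
    -- there are none and both sides vanish, so the value of `pred` at 0 does no harm.
    P-pred : ∀ j → (b ^ j * b ^ j + - 1ℤ) * P (ℕ.pred j) ≡ (b ^ j + - 1ℤ) * P j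
    P-pred zero    = refl
    P-pred (suc j) = lem (b ^ suc j) (P j)
      where
      lem : ∀ v p → (v * v + - 1ℤ) * p ≡ (v + - 1ℤ) * ((v + 1ℤ) * p)
      lem = solve-∀

    -- With u = b^n and v = b^j, nonisotropic and kernel vectors contribute in proportion to b u - v
    -- and v - 1. In the total b u - 1 the nullity has cancelled, and what remains is the new factor
    -- of `M`.
    frames-recurrence : ∀ n j f S c₁ c₂ → b * S ≡ (b ^ (suc n ℕ.+ suc n) + - b ^ (suc n ℕ.+ j)) * f →
      c₁ ≡ b ^ n * (M n * P j) → c₂ ≡ b ^ (n ℕ.+ n) * (M n * P (ℕ.pred j)) * f →
      b * (S * c₁ + (b ^ (j ℕ.+ j) + - 1ℤ) * c₂) ≡ b * (M (suc n) * P j * f)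
    frames-recurrence n j f S _ _ bS refl refl = go (b ^ n) (b ^ j) (M n) (P j) (P (ℕ.pred j)) (b ^ (n ℕ.+ n)) (b ^ (j ℕ.+ j))
      (b ^ (suc n ℕ.+ suc n)) (b ^ (suc n ℕ.+ j)) (ℤ.^-distribˡ-+-* b n n) (ℤ.^-distribˡ-+-* b j j)
      (ℤ.^-distribˡ-+-* b (suc n) (suc n)) (ℤ.^-distribˡ-+-* b (suc n) j) bS (P-pred j)
      where
      open ≡-Reasoning
      go : ∀ u v m p p′ u² v² w x → u² ≡ u * u → v² ≡ v * v → w ≡ b * u * (b * u) → x ≡ b * u * v →
        b * S ≡ (w + - x) * f → (v * v + - 1ℤ) * p′ ≡ (v + - 1ℤ) * p →
        b * (S * (u * (m * p)) + (v² + - 1ℤ) * (u² * (m * p′) * f)) ≡ b * (u² * (b * u + - 1ℤ) * m * p * f)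
      go u v m p p′ _ _ _ _ refl refl refl refl bS pp′ = begin
        b * (S * (u * (m * p)) + (v * v + - 1ℤ) * (u * u * (m * p′) * f))
          ≡⟨ lem₁ b S u v m p p′ f ⟩
        b * S * (u * m * p) + b * u * u * m * f * ((v * v + - 1ℤ) * p′)
          ≡⟨ cong₂ (λ y z → y * (u * m * p) + b * u * u * m * f * z) bS pp′ ⟩
        (b * u * (b * u) + - (b * u * v)) * f * (u * m * p) + b * u * u * m * f * ((v + - 1ℤ) * p)
          ≡⟨ lem₂ b u v m p f ⟩
        b * (u * u * (b * u + - 1ℤ) * m * p * f) ∎
        where
        lem₁ : ∀ b S u v m p p′ f → b * (S * (u * (m * p)) + (v * v + - 1ℤ) * (u * u * (m * p′) * f)) ≡
          b * S * (u * m * p) + b * u * u * m * f * ((v * v + - 1ℤ) * p′)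
        lem₁ = solve-∀
        lem₂ : ∀ b u v m p f → (b * u * (b * u) + - (b * u * v)) * f * (u * m * p) + b * u * u * m * f * ((v + - 1ℤ) * p) ≡
          b * (u * u * (b * u + - 1ℤ) * m * p * f)
        lem₂ = solve-∀

    -- Induction on the dimension, with `t` left general because the value of the first vector joins
    -- the shift for the remaining ones.
    ∑-frames-Q : ∀ {n j} (F : Form n) → Nullity F j → ∀ {φ t} → Balanced φ → Real t →
      ∑ (frames n) (λ Z → φ (t ⊕ Q F Z)) ≡ M n * P j * φ t
    ∑-frames-Q {zero} {zero} F nul {φ} {t} bal rt = trans (ℤ.+-identityʳ _) (trans (cong φ (R.+-identityʳ t)) (sym (ℤ.*-identityˡ (φ t))))
    -- In dimension 0 the kernel has one element, which rules out a positive nullity.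
    ∑-frames-Q {zero} {suc j} F nul bal rt = contradiction (b^e≡1⇒e≡0 (suc j ℕ.+ suc j)
      (trans (sym (kernel-size {j = suc j} F nul)) (cong (_+ 0ℤ) (𝟙-yes (kernel? F []) (B-0 F))))) λ ()
    ∑-frames-Q {suc n} {j} F nul {φ} {t} bal rt = ℤ.*-cancelˡ-≡ b (∑ (frames (suc n)) (λ Z → φ (t ⊕ Q F Z))) (M (suc n) * P j * φ t)
      (trans (cong (b *_) sum-by-first) (frames-recurrence n j (φ t) S c₁ c₂ (∑-nonisotropic {j = j} F nul bal rt) refl refl))
      where
      open ≡-Reasoning
      S c₁ c₂ : ℤ
      S  = ∑ (vecs (suc n)) (λ x → 𝟙 (¬? (h F x ≟ 0ₖ)) * φ (t ⊕ h F x))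
      c₁ = b ^ n * (M n * P j)
      c₂ = b ^ (n ℕ.+ n) * (M n * P (ℕ.pred j)) * φ t

      inner : V (suc n) → ℤ
      inner x = ∑ (frames n) λ Z → ∑ (vecs n) λ cs → φ (t ⊕ (h F x ⊕ Q F (rows x (complement x) cs Z)))

      inner-assoc : ∀ x → inner x ≡ ∑ (frames n) λ Z → ∑ (vecs n) λ cs → φ (t ⊕ h F x ⊕ Q F (rows x (complement x) cs Z))
      inner-assoc x = ∑-cong (frames n) λ Z → ∑-cong (vecs n) λ cs → cong φ (sym (R.+-assoc t _ _))

      inner-nonisotropic : ∀ x → h F x ≢ 0ₖ → inner x ≡ φ (t ⊕ h F x) * c₁
      inner-nonisotropic x hx≢0 = begin
        inner x
          ≡⟨ inner-assoc x ⟩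
        ∑ (frames n) (λ Z → ∑ (vecs n) λ cs → φ (t ⊕ h F x ⊕ Q F (rows x (complement x) cs Z)))
          ≡⟨ ∑-cong (frames n) (∑-rows F x (complement x) {φ} perp-form b (∑-line-perp bal) (real-⊕ rt (h-real F x))) ⟩
        ∑ (frames n) (λ Z → b ^ n * φ (t ⊕ h F x ⊕ Q perp-form Z))
          ≡⟨ ∑-*ˡ (frames n) (b ^ n) _ ⟩
        b ^ n * ∑ (frames n) (λ Z → φ (t ⊕ h F x ⊕ Q perp-form Z))
          ≡⟨ cong (b ^ n *_) (∑-frames-Q perp-form (perp-nullity {j} nul) bal (real-⊕ rt (h-real F x))) ⟩
        b ^ n * (M n * P j * φ (t ⊕ h F x))
          ≡⟨ lem₁ (b ^ n) (M n * P j) _ ⟩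
        φ (t ⊕ h F x) * c₁ ∎
        where
        open Perp F x hx≢0
        lem₁ : ∀ u g f → u * (g * f) ≡ f * (u * g)
        lem₁ = solve-∀

      inner-kernel : ∀ x → x ≢ 0ᵥ → Kernel F x → inner x ≡ c₂
      inner-kernel x x≢0 ker = go j nul
        where
        F′ = pull (complement-linear x) F
        b²^ : ∀ k → (b * b) ^ k ≡ b ^ (k ℕ.+ k)
        b²^ zero    = refl
        b²^ (suc k) = trans (cong (b * b *_) (b²^ k)) (trans (ℤ.*-assoc b b _) (cong (λ e → b ^ suc e) (sym (ℕ.+-suc k k))))
        go : ∀ j → Nullity F j → inner x ≡ b ^ (n ℕ.+ n) * (M n * P (ℕ.pred j)) * φ t
        go zero    nul = ⊥-elim (kernel≢0⇒nullity≢0 F x x≢0 ker nul)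
        go (suc j) nul = begin
          inner x
            ≡⟨ ∑-cong (frames n) (λ Z → ∑-cong (vecs n) λ cs → cong (λ u → φ (t ⊕ u)) (trans (cong (_⊕ Q F (rows x (complement x) cs Z)) (ker x)) (R.+-identityˡ _))) ⟩
          ∑ (frames n) (λ Z → ∑ (vecs n) λ cs → φ (t ⊕ Q F (rows x (complement x) cs Z)))
            ≡⟨ ∑-cong (frames n) (∑-rows F x (complement x) {φ} F′ (b * b) (λ rt z → ∑-line-kernel F bal rt x (complement x z) ker) rt) ⟩
          ∑ (frames n) (λ Z → (b * b) ^ n * φ (t ⊕ Q F′ Z))
            ≡⟨ ∑-*ˡ (frames n) ((b * b) ^ n) _ ⟩
          (b * b) ^ n * ∑ (frames n) (λ Z → φ (t ⊕ Q F′ Z))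
            ≡⟨ cong₂ _*_ (b²^ n) (∑-frames-Q F′ (kernel-nullity {j = j} F x x≢0 ker nul) bal rt) ⟩
          b ^ (n ℕ.+ n) * (M n * P j * φ t)
            ≡⟨ ℤ.*-assoc (b ^ (n ℕ.+ n)) (M n * P j) (φ t) ⟨
          b ^ (n ℕ.+ n) * (M n * P j) * φ t ∎

      inner-isotropic : ∀ x → x ≢ 0ᵥ → h F x ≡ 0ₖ → ¬ Kernel F x → inner x ≡ 0ℤ
      inner-isotropic x x≢0 hx≡0 ¬ker = trans (inner-assoc x) (trans (∑-cong-∈ (frames n) vanish) (∑-0 (frames n)))
        where
        f : V n → K
        f z = B F x (complement x z)
        vanish : ∀ Z → Z ∈ frames n → ∑ (vecs n) (λ cs → φ (t ⊕ h F x ⊕ Q F (rows x (complement x) cs Z))) ≡ 0ℤ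
        -- If every vector of the frame were orthogonal to `x`, so would be the whole complement; as
        -- `x` is orthogonal to itself, it would then lie in the kernel.
        vanish Z Z∈ with Fin.any? (λ i → ¬? (f (lookup Z i) ≟ 0ₖ))
        ... | yes (i , ne) = ∑-rows-0 F x (complement x) {φ} (real-⊕ rt (h-real F x)) Z i
                (λ rt → ∑-line-isotropic F bal rt x (complement x (lookup Z i)) hx≡0 ne)
        ... | no ¬∃ = contradiction (λ y → kernel-everywhere y) ¬ker
          where
          f≡0 : ∀ z → f z ≡ 0ₖ
          f≡0 = frames-span Z∈ f
            (λ u v → trans (cong (B F x) (map-+ (complement-linear x) u v)) (B-+ F x _ _))
            (λ c v → trans (cong (B F x) (map-· (complement-linear x) c v)) (B-· F c x _))
            (λ i → decidable-stable (f (lookup Z i) ≟ 0ₖ) λ ne → ¬∃ (i , ne))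
          kernel-everywhere : ∀ y → B F x y ≡ 0ₖ
          kernel-everywhere y with complement-spans x x≢0 y
          ... | c , z , refl = trans (B-+ F x _ _) (trans (cong₂ _⊕_ (trans (B-· F c x x) (trans (cong (c ⊙_) hx≡0) (R.zeroʳ c))) (f≡0 z)) (R.+-identityˡ 0ₖ))

      -- The zero vector lies in the kernel, so its own indicator is subtracted from the kernel
      -- term; the remaining isotropic vectors contribute nothing.
      by-first : ∀ x → 𝟙 (¬? (x ≟ᵥ 0ᵥ)) * inner x ≡
        𝟙 (¬? (h F x ≟ 0ₖ)) * φ (t ⊕ h F x) * c₁ + (𝟙 (kernel? F x) + - 1ℤ * 𝟙 (0ᵥ ≟ᵥ x)) * c₂
      by-first x = by-cases (x ≟ᵥ 0ᵥ) (h F x ≟ 0ₖ) (kernel? F x) (0ᵥ ≟ᵥ x)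
        where
        -- Not a with-abstraction, which would normalise the products in ℤ.
        by-cases : (d : Dec (x ≡ 0ᵥ)) (e : Dec (h F x ≡ 0ₖ)) (k : Dec (Kernel F x)) (z : Dec (0ᵥ ≡ x)) →
          𝟙 (¬? d) * inner x ≡ 𝟙 (¬? e) * φ (t ⊕ h F x) * c₁ + (𝟙 k + - 1ℤ * 𝟙 z) * c₂
        by-cases (yes _)    (yes _)    (yes _)   (yes _)   = refl
        by-cases (yes refl) _          _         (no ne)   = contradiction refl ne
        by-cases (yes refl) _          (no ¬ker) _         = contradiction (B-0 F) ¬ker
        by-cases (yes refl) (no hx≢0)  _         _         = contradiction (h-0 F) hx≢0
        by-cases (no x≢0)   _          _         (yes 0≡x) = contradiction (sym 0≡x) x≢0
        by-cases (no _)     (no hx≢0)  (yes ker) (no _)    = contradiction (ker x) hx≢0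
        by-cases (no x≢0)   (no hx≢0)  (no _)    (no _)    = trans (ℤ.*-identityˡ (inner x)) (trans (inner-nonisotropic x hx≢0)
          (sym (trans (ℤ.+-identityʳ (1ℤ * φ (t ⊕ h F x) * c₁)) (cong (_* c₁) (ℤ.*-identityˡ (φ (t ⊕ h F x)))))))
        by-cases (no x≢0)   (yes _)    (yes ker) (no _)    = trans (ℤ.*-identityˡ (inner x)) (trans (inner-kernel x x≢0 ker)
          (sym (trans (ℤ.+-identityˡ (1ℤ * c₂)) (ℤ.*-identityˡ c₂))))
        by-cases (no x≢0)   (yes hx≡0) (no ¬ker) (no _)    = trans (ℤ.*-identityˡ (inner x)) (inner-isotropic x x≢0 hx≡0 ¬ker)

      nonzero-kernel : ∑ (vecs (suc n)) (λ x → 𝟙 (kernel? F x) + - 1ℤ * 𝟙 (0ᵥ ≟ᵥ x)) ≡ b ^ (j ℕ.+ j) + - 1ℤ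
      nonzero-kernel = trans (∑-+ (vecs (suc n)) (λ x → 𝟙 (kernel? F x)) (λ x → - 1ℤ * 𝟙 (0ᵥ ≟ᵥ x)))
        (cong₂ _+_ (kernel-size {j = j} F nul)
          (trans (∑-*ˡ (vecs (suc n)) (- 1ℤ) (λ x → 𝟙 (0ᵥ ≟ᵥ x))) (cong (- 1ℤ *_) (count≡1 (enumᵥ (suc n)) 0ᵥ))))

      sum-by-first : ∑ (frames (suc n)) (λ Z → φ (t ⊕ Q F Z)) ≡ S * c₁ + (b ^ (j ℕ.+ j) + - 1ℤ) * c₂
      sum-by-first = begin
        ∑ (frames (suc n)) (λ Z → φ (t ⊕ Q F Z))
          ≡⟨ ∑-frames n (λ Z → φ (t ⊕ Q F Z)) ⟩
        ∑ (vecs (suc n)) (λ x → 𝟙 (¬? (x ≟ᵥ 0ᵥ)) * inner x)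
          ≡⟨ ∑-cong (vecs (suc n)) by-first ⟩
        ∑ (vecs (suc n)) (λ x → 𝟙 (¬? (h F x ≟ 0ₖ)) * φ (t ⊕ h F x) * c₁ + (𝟙 (kernel? F x) + - 1ℤ * 𝟙 (0ᵥ ≟ᵥ x)) * c₂)
          ≡⟨ ∑-+ (vecs (suc n)) (λ x → 𝟙 (¬? (h F x ≟ 0ₖ)) * φ (t ⊕ h F x) * c₁) (λ x → (𝟙 (kernel? F x) + - 1ℤ * 𝟙 (0ᵥ ≟ᵥ x)) * c₂) ⟩
        ∑ (vecs (suc n)) (λ x → 𝟙 (¬? (h F x ≟ 0ₖ)) * φ (t ⊕ h F x) * c₁) +
        ∑ (vecs (suc n)) (λ x → (𝟙 (kernel? F x) + - 1ℤ * 𝟙 (0ᵥ ≟ᵥ x)) * c₂)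
          ≡⟨ cong₂ _+_ (∑-*ʳ (vecs (suc n)) c₁ (λ x → 𝟙 (¬? (h F x ≟ 0ₖ)) * φ (t ⊕ h F x)))
               (trans (∑-*ʳ (vecs (suc n)) c₂ (λ x → 𝟙 (kernel? F x) + - 1ℤ * 𝟙 (0ᵥ ≟ᵥ x))) (cong (_* c₂) nonzero-kernel)) ⟩
        S * c₁ + (b ^ (j ℕ.+ j) + - 1ℤ) * c₂ ∎

    -- Matrices and rank

    sum-single : ∀ {n} (j : Fin n) (t : Fin n → K) → (∀ i → i ≢ j → t i ≡ 0ₖ) → sum t ≡ t j
    sum-single = fold-single R.+-commutativeMonoid

    indicator : ∀ {n} → Fin n → Fin n → K
    indicator i l with i Fin.≟ l
    ... | yes _ = 1ₖ
    ... | no _  = 0ₖ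

    sum-indicator : ∀ {n} (i : Fin n) (t : Fin n → K) → sum (λ l → t l ⊙ indicator i l) ≡ t i
    sum-indicator i t = trans (sum-single i (λ l → t l ⊙ indicator i l) off) on
      where
      off : ∀ l → l ≢ i → t l ⊙ indicator i l ≡ 0ₖ
      off l l≢i with i Fin.≟ l
      ... | yes i≡l = contradiction (sym i≡l) l≢i
      ... | no _    = R.zeroʳ (t l)
      on : t i ⊙ indicator i i ≡ t i
      on with i Fin.≟ i
      ... | yes _ = R.*-identityʳ (t i)
      ... | no ne = contradiction refl ne

    sum-⊙-sum : ∀ {m n} (a : Fin m → K) (c : Fin m → Fin n → K) (w : Fin n → K) →
      sum (λ i → a i ⊙ sum (λ j → c i j ⊙ w j)) ≡ sum (λ j → sum (λ i → a i ⊙ c i j) ⊙ w j)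
    sum-⊙-sum {m} {n} a c w = begin
      sum (λ i → a i ⊙ sum (λ j → c i j ⊙ w j))       ≡⟨ sum-cong-≗ {m} (λ i → *-distribˡ-sum (a i) (λ j → c i j ⊙ w j)) ⟩
      sum (λ i → sum (λ j → a i ⊙ (c i j ⊙ w j)))     ≡⟨ ∑-comm (λ i j → a i ⊙ (c i j ⊙ w j)) ⟩
      sum (λ j → sum (λ i → a i ⊙ (c i j ⊙ w j)))     ≡⟨ sum-cong-≗ {n} (λ j → sum-cong-≗ {m} λ i → R.*-assoc (a i) (c i j) (w j)) ⟨
      sum (λ j → sum (λ i → a i ⊙ c i j ⊙ w j))       ≡⟨ sum-cong-≗ {n} (λ j → *-distribʳ-sum (w j) (λ i → a i ⊙ c i j)) ⟨
      sum (λ j → sum (λ i → a i ⊙ c i j) ⊙ w j)       ∎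
      where open ≡-Reasoning

    conj-sum : ∀ {n} (t : Fin n → K) → conj (sum t) ≡ sum (λ i → conj (t i))
    conj-sum {zero}  t = conj-0
    conj-sum {suc n} t = trans (conj-⊕ _ _) (cong (conj (t zero) ⊕_) (conj-sum (λ i → t (suc i))))

    combination : ∀ {n k} → (Fin k → Fin n → K) → V k → Fin n → K
    combination a c i = sum (λ j → lookup c j ⊙ a j i)

    combination-+ : ∀ {n k} (a : Fin k → Fin n → K) c d i → combination a (c +ᵥ d) i ≡ combination a c i ⊕ combination a d i
    combination-+ {k = k} a c d i = trans (sum-cong-≗ {k} λ j → trans (cong (_⊙ a j i) (Vec.lookup-zipWith _⊕_ j c d)) (R.distribʳ _ _ _))
      (∑-distrib-+ (λ j → lookup c j ⊙ a j i) (λ j → lookup d j ⊙ a j i))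

    combination-· : ∀ {n k} (a : Fin k → Fin n → K) s c i → combination a (s · c) i ≡ s ⊙ combination a c i
    combination-· {k = k} a s c i = trans (sum-cong-≗ {k} λ j → trans (cong (_⊙ a j i) (Vec.lookup-map j (s ⊙_) c)) (R.*-assoc _ _ _))
      (sym (*-distribˡ-sum s (λ j → lookup c j ⊙ a j i)))

    combination-combination : ∀ {n k l} (a : Fin k → Fin n → K) (Γ : Fin l → V k) (x : V l) i →
      combination a (Vec.tabulate λ j → sum (λ t → lookup x t ⊙ lookup (Γ t) j)) i ≡ sum (λ t → lookup x t ⊙ combination a (Γ t) i)
    combination-combination {k = k} a Γ x i = trans
      (sum-cong-≗ {k} λ j → cong (_⊙ a j i) (Vec.lookup∘tabulate (λ j → sum (λ t → lookup x t ⊙ lookup (Γ t) j)) j))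
      (sym (sum-⊙-sum (lookup x) (λ t → lookup (Γ t)) (λ j → a j i)))

    Independent : ∀ {n k} → (Fin k → Fin n → K) → Set
    Independent {k = k} a = ∀ c → (∀ i → combination a c i ≡ 0ₖ) → c ≡ 0ᵥ

    infix 4 _≗?_
    _≗?_ : ∀ {n} (f g : Fin n → K) → Dec (∀ i → f i ≡ g i)
    f ≗? g = Fin.all? λ i → f i ≟ g i

    independent-injective : ∀ {n k} (a : Fin k → Fin n → K) → Independent a → ∀ c d →
      (∀ i → combination a c i ≡ combination a d i) → c ≡ d
    independent-injective a ind c d e = begin
      c                         ≡⟨ +ᵥ-cancelˡ′ d c ⟨
      d +ᵥ (Vec.map ⊖_ d +ᵥ c)  ≡⟨ cong (d +ᵥ_) (ind _ λ i → ⊖-cancel i) ⟩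
      d +ᵥ 0ᵥ                   ≡⟨ +ᵥ-identityʳ d ⟩
      d                         ∎
      where
      open ≡-Reasoning
      ⊖-cancel : ∀ i → combination a (Vec.map ⊖_ d +ᵥ c) i ≡ 0ₖ
      ⊖-cancel i = begin
        combination a (Vec.map ⊖_ d +ᵥ c) i                             ≡⟨ ⊕-cancelˡ (combination a d i) _ ⟨
        ⊖ combination a d i ⊕ (combination a d i ⊕ combination a (Vec.map ⊖_ d +ᵥ c) i) ≡⟨ cong (⊖ combination a d i ⊕_) (combination-+ a d _ i) ⟨
        ⊖ combination a d i ⊕ combination a (d +ᵥ (Vec.map ⊖_ d +ᵥ c)) i ≡⟨ cong (λ u → ⊖ combination a d i ⊕ combination a u i) (+ᵥ-cancelˡ′ d c) ⟩
        ⊖ combination a d i ⊕ combination a c i                         ≡⟨ cong (⊖ combination a d i ⊕_) (e i) ⟩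
        ⊖ combination a d i ⊕ combination a d i                         ≡⟨ R.-‿inverseˡ _ ⟩
        0ₖ                                                              ∎

    -- Rank–nullity: every x has exactly one c with A x = Σ cⱼ a (σ j), and each c is attained by a translate of the kernel.
    kernel-count : ∀ {n k l} (a : Fin l → Fin n → K) (σ : Fin k → Fin l) → Independent (λ j → a (σ j)) →
      (Γ : Fin l → V k) → (∀ t i → a t i ≡ combination (λ j → a (σ j)) (Γ t) i) →
      b ^ (k ℕ.+ k) * ∑ (vecs l) (λ x → 𝟙 (combination a x ≗? λ _ → 0ₖ)) ≡ b ^ (l ℕ.+ l)
    kernel-count {n} {k} {l} a σ ind Γ spans = begin
      b ^ (k ℕ.+ k) * κ
        ≡⟨ cong (_* κ) (∑V-1 k) ⟨
      ∑ (vecs k) (λ _ → 1ℤ) * κ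
        ≡⟨ ∑-*ʳ (vecs k) κ _ ⟨
      ∑ (vecs k) (λ c → 1ℤ * κ)
        ≡⟨ ∑-cong (vecs k) (λ c → trans (ℤ.*-identityˡ κ) (sym (fibre c))) ⟩
      ∑ (vecs k) (λ c → ∑ (vecs l) λ x → 𝟙 (combination a x ≗? combination aσ c))
        ≡⟨ ∑-swap (vecs k) (vecs l) _ ⟩
      ∑ (vecs l) (λ x → ∑ (vecs k) λ c → 𝟙 (combination a x ≗? combination aσ c))
        ≡⟨ ∑-cong (vecs l) unique ⟩
      ∑ (vecs l) (λ _ → 1ℤ)
        ≡⟨ ∑V-1 l ⟩
      b ^ (l ℕ.+ l) ∎
      where
      open ≡-Reasoning
      κ = ∑ (vecs l) (λ x → 𝟙 (combination a x ≗? λ _ → 0ₖ))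
      aσ : Fin k → Fin n → K
      aσ j = a (σ j)
      coords : V l → V k
      coords x = Vec.tabulate λ j → sum (λ t → lookup x t ⊙ lookup (Γ t) j)
      coords-spec : ∀ x i → combination a x i ≡ combination aσ (coords x) i
      coords-spec x i = trans (sum-cong-≗ {l} λ t → cong (lookup x t ⊙_) (spans t i)) (sym (combination-combination aσ Γ x i))
      unique : ∀ x → ∑ (vecs k) (λ c → 𝟙 (combination a x ≗? combination aσ c)) ≡ 1ℤ
      unique x = trans (∑-cong (vecs k) λ c → 𝟙-cong (combination a x ≗? combination aσ c) (coords x ≟ᵥ c)
          (λ e → independent-injective aσ ind _ _ λ i → trans (sym (coords-spec x i)) (e i))
          (λ { refl → coords-spec x }))
        (count≡1 (enumᵥ k) (coords x))
      -- A preimage of `c`: its entries are placed at the chosen columns, as a sum of unit vectors.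
      embed : V k → V l
      embed c = Vec.tabulate λ t → sum (λ j → lookup c j ⊙ lookup (Vec.tabulate (indicator (σ j))) t)
      embed-spec : ∀ c i → combination a (embed c) i ≡ combination aσ c i
      embed-spec c i = trans (combination-combination a (λ j → Vec.tabulate (indicator (σ j))) c i)
        (sum-cong-≗ {k} λ j → cong (lookup c j ⊙_) (trans (sum-cong-≗ {l} λ t → trans
          (cong (_⊙ a t i) (Vec.lookup∘tabulate (indicator (σ j)) t)) (R.*-comm _ _)) (sum-indicator (σ j) (λ t → a t i))))
      fibre : ∀ c → ∑ (vecs l) (λ x → 𝟙 (combination a x ≗? combination aσ c)) ≡ κ
      fibre c = trans (sym (∑V-translate (embed c) _)) (∑-cong (vecs l) λ x →
        𝟙-cong (combination a (embed c +ᵥ x) ≗? combination aσ c) (combination a x ≗? λ _ → 0ₖ) (to x) (from x))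
        where
        to : ∀ x → (∀ i → combination a (embed c +ᵥ x) i ≡ combination aσ c i) → ∀ i → combination a x i ≡ 0ₖ
        to x e i = begin
          combination a x i                                                    ≡⟨ ⊕-cancelˡ (combination aσ c i) _ ⟨
          ⊖ combination aσ c i ⊕ (combination aσ c i ⊕ combination a x i)      ≡⟨ cong (λ u → ⊖ combination aσ c i ⊕ (u ⊕ combination a x i)) (embed-spec c i) ⟨
          ⊖ combination aσ c i ⊕ (combination a (embed c) i ⊕ combination a x i) ≡⟨ cong (⊖ combination aσ c i ⊕_) (trans (sym (combination-+ a (embed c) x i)) (e i)) ⟩
          ⊖ combination aσ c i ⊕ combination aσ c i                            ≡⟨ R.-‿inverseˡ _ ⟩
          0ₖ                                                                   ∎
        from : ∀ x → (∀ i → combination a x i ≡ 0ₖ) → ∀ i → combination a (embed c +ᵥ x) i ≡ combination aσ c i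
        from x e i = trans (combination-+ a (embed c) x i) (trans (cong₂ _⊕_ (embed-spec c i) (e i)) (R.+-identityʳ _))

    -- A nonzero coefficient `s` could be divided out, which would put `v` into the span.
    outside-span : ∀ {n k} (a : Fin k → Fin n → K) → Independent a → (v : Fin n → K) →
      ¬ (∃ λ c → ∀ i → v i ≡ combination a c i) → ∀ s c → (∀ i → s ⊙ v i ⊕ combination a c i ≡ 0ₖ) → s ≡ 0ₖ × c ≡ 0ᵥ
    outside-span a ind v ∉span s c e with s ≟ 0ₖ
    ... | yes refl = refl , ind c λ i → trans (sym (trans (cong (_⊕ combination a c i) (R.zeroˡ (v i))) (R.+-identityˡ _))) (e i)
    ... | no s≢0 with inverse s s≢0
    ...   | s⁻¹ , ss⁻¹ = contradiction ((s⁻¹ ⊙ ⊖ 1ₖ) · c , λ i → begin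
      v i                                     ≡⟨ ⊙-cancel-inverse (v i) ss⁻¹ ⟨
      s⁻¹ ⊙ (s ⊙ v i)                         ≡⟨ cong (s⁻¹ ⊙_) (⊖-unique (trans (R.+-comm _ _) (e i))) ⟩
      s⁻¹ ⊙ ⊖ combination a c i               ≡⟨ cong (s⁻¹ ⊙_) (-1*x≈-x _) ⟨
      s⁻¹ ⊙ (⊖ 1ₖ ⊙ combination a c i)        ≡⟨ R.*-assoc s⁻¹ (⊖ 1ₖ) _ ⟨
      s⁻¹ ⊙ ⊖ 1ₖ ⊙ combination a c i          ≡⟨ combination-· a _ c i ⟨
      combination a ((s⁻¹ ⊙ ⊖ 1ₖ) · c) i      ∎) ∉span
      where open ≡-Reasoning

    column : ∀ {n} → (Fin n → Fin n → K) → Fin n → Fin n → K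
    column A j i = A i j

    -- The form x* A y. Its hermitian symmetry is an exchange of the two sums combined with that of
    -- `A`.
    matrix-form : ∀ {n} (A : Fin n → Fin n → K) → (∀ i j → conj (A i j) ≡ A j i) → Form n
    matrix-form {n} A herm = record
      { B      = λ x y → sum (λ i → conj (lookup x i) ⊙ combination (column A) y i)
      ; B-+    = λ x y z → trans (sum-cong-≗ {n} λ i → trans (cong (conj (lookup x i) ⊙_) (combination-+ (column A) y z i)) (R.distribˡ _ _ _))
                   (∑-distrib-+ (λ i → conj (lookup x i) ⊙ combination (column A) y i) (λ i → conj (lookup x i) ⊙ combination (column A) z i))
      ; B-·    = λ c x y → trans (sum-cong-≗ {n} λ i → trans (cong (conj (lookup x i) ⊙_) (combination-· (column A) c y i)) (x∙yz≈y∙xz (conj (lookup x i)) c _))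
                   (sym (*-distribˡ-sum c (λ i → conj (lookup x i) ⊙ combination (column A) y i)))
      ; B-conj = λ x y → begin
          conj (sum (λ i → conj (lookup x i) ⊙ sum (λ j → lookup y j ⊙ A i j)))
            ≡⟨ conj-sum (λ i → conj (lookup x i) ⊙ sum (λ j → lookup y j ⊙ A i j)) ⟩
          sum (λ i → conj (conj (lookup x i) ⊙ sum (λ j → lookup y j ⊙ A i j)))
            ≡⟨ sum-cong-≗ {n} (λ i → trans (conj-⊙ _ _) (cong₂ _⊙_ (conj-involutive _) (conj-sum (λ j → lookup y j ⊙ A i j)))) ⟩
          sum (λ i → lookup x i ⊙ sum (λ j → conj (lookup y j ⊙ A i j)))
            ≡⟨ sum-cong-≗ {n} (λ i → cong (lookup x i ⊙_) (sum-cong-≗ {n} λ j → trans (conj-⊙ _ _)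
                 (trans (cong (conj (lookup y j) ⊙_) (herm i j)) (R.*-comm _ _)))) ⟩
          sum (λ i → lookup x i ⊙ sum (λ j → A j i ⊙ conj (lookup y j)))
            ≡⟨ sum-⊙-sum (lookup x) (λ i j → A j i) (λ j → conj (lookup y j)) ⟩
          sum (λ j → sum (λ i → lookup x i ⊙ A j i) ⊙ conj (lookup y j))
            ≡⟨ sum-cong-≗ {n} (λ j → R.*-comm _ _) ⟩
          sum (λ j → conj (lookup y j) ⊙ sum (λ i → lookup x i ⊙ A j i)) ∎
      }
      where
      open ≡-Reasoning
      open import Algebra.Properties.CommutativeSemigroup (R.*-commutativeSemigroup) using (x∙yz≈y∙xz)

    -- Pairing with unit vectors reads off the entries of A x. The test vector is conjugated because
    -- the form conjugates its first argument.
    matrix-kernel : ∀ {n} (A : Fin n → Fin n → K) herm x →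
      𝟙 (kernel? (matrix-form A herm) x) ≡ 𝟙 (combination (column A) x ≗? λ _ → 0ₖ)
    matrix-kernel {n} A herm x = 𝟙-cong (kernel? F x) (combination (column A) x ≗? λ _ → 0ₖ) to from
      where
      open ≡-Reasoning
      F = matrix-form A herm
      from : (∀ i → combination (column A) x i ≡ 0ₖ) → Kernel F x
      from e y = trans (sym (B-conj F y x)) (trans (cong conj (trans
        (sum-cong-≗ {n} λ i → trans (cong (conj (lookup y i) ⊙_) (e i)) (R.zeroʳ _)) (sum-replicate-zero n))) conj-0)
      to : Kernel F x → ∀ i → combination (column A) x i ≡ 0ₖ
      to ker i = begin
        combination (column A) x i                                      ≡⟨ sum-indicator i (combination (column A) x) ⟨
        sum (λ l → combination (column A) x l ⊙ indicator i l)          ≡⟨ sum-cong-≗ {n} (λ l → trans (R.*-comm _ _)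
                                                                            (cong (_⊙ combination (column A) x l) (sym (entry l)))) ⟩
        B F e x                                                         ≡⟨ B-conj F x e ⟨
        conj (B F x e)                                                  ≡⟨ cong conj (ker e) ⟩
        conj 0ₖ                                                         ≡⟨ conj-0 ⟩
        0ₖ                                                              ∎
        where
        e : V n
        e = Vec.tabulate (λ l → conj (indicator i l))
        entry : ∀ l → conj (lookup e l) ≡ indicator i l
        entry l = trans (cong conj (Vec.lookup∘tabulate (λ l → conj (indicator i l)) l)) (conj-involutive _)

    b-^-injective : ∀ d e → b ^ d ≡ b ^ e → d ≡ e
    b-^-injective zero    e       eq = sym (b^e≡1⇒e≡0 e (sym eq))
    b-^-injective (suc d) zero    eq = b^e≡1⇒e≡0 (suc d) eq
    b-^-injective (suc d) (suc e) eq = cong suc (b-^-injective d e (ℤ.*-cancelˡ-≡ b (b ^ d) (b ^ e) eq))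

    m+m≡n+n⇒m≡n : ∀ m n → m ℕ.+ m ≡ n ℕ.+ n → m ≡ n
    m+m≡n+n⇒m≡n zero    zero    e = refl
    m+m≡n+n⇒m≡n (suc m) (suc n) e = cong suc (m+m≡n+n⇒m≡n m n
      (ℕ.suc-injective (trans (sym (ℕ.+-suc m m)) (trans (ℕ.suc-injective e) (ℕ.+-suc n n)))))

    -- Counting the null space in two ways gives b^(2k) · b^(2j) = b^(2n), and powers of `b`
    -- determine their exponents.
    rank⇒nullity : ∀ {n k} (A : Fin n → Fin n → K) herm (σ : Fin k → Fin n) → Independent (λ j → column A (σ j)) →
      (Γ : Fin n → V k) → (∀ t i → column A t i ≡ combination (λ j → column A (σ j)) (Γ t) i) →
      ∃ λ j → k ℕ.+ j ≡ n × Nullity (matrix-form A herm) j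
    rank⇒nullity {n} {k} A herm σ ind Γ spans with nullity-exists (matrix-form A herm)
    ... | j , nul = j , m+m≡n+n⇒m≡n (k ℕ.+ j) n (b-^-injective _ _ (begin
      b ^ (k ℕ.+ j ℕ.+ (k ℕ.+ j))      ≡⟨ cong (b ^_) (interchange k j k j) ⟩
      b ^ (k ℕ.+ k ℕ.+ (j ℕ.+ j))      ≡⟨ ℤ.^-distribˡ-+-* b (k ℕ.+ k) (j ℕ.+ j) ⟩
      b ^ (k ℕ.+ k) * b ^ (j ℕ.+ j)    ≡⟨ cong (b ^ (k ℕ.+ k) *_) (kernel-size {j = j} (matrix-form A herm) nul) ⟨
      b ^ (k ℕ.+ k) * ∑ (vecs n) (λ x → 𝟙 (kernel? (matrix-form A herm) x))
                                       ≡⟨ cong (b ^ (k ℕ.+ k) *_) (∑-cong (vecs n) (matrix-kernel A herm)) ⟩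
      b ^ (k ℕ.+ k) * ∑ (vecs n) (λ x → 𝟙 (combination (column A) x ≗? λ _ → 0ₖ))
                                       ≡⟨ kernel-count (column A) σ ind Γ spans ⟩
      b ^ (n ℕ.+ n)                    ∎)) , nul
      where
      open ≡-Reasoning
      open import Algebra.Properties.CommutativeSemigroup ℕ.+-commutativeSemigroup using (interchange)

    -- The clique bound

    sum-sub : ∀ {n} (a f g : Fin n → K) → sum (λ i → a i ⊙ (f i ⊕ ⊖ g i)) ≡ sum (λ i → a i ⊙ f i) ⊕ ⊖ sum (λ i → a i ⊙ g i)
    sum-sub {n} a f g = begin
      d                          ≡⟨ R.+-identityʳ d ⟨
      d ⊕ 0ₖ                     ≡⟨ cong (d ⊕_) (R.-‿inverseʳ _) ⟨
      d ⊕ (s g ⊕ ⊖ s g)          ≡⟨ R.+-assoc d _ _ ⟨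
      d ⊕ s g ⊕ ⊖ s g            ≡⟨ cong (_⊕ ⊖ s g) (∑-distrib-+ (λ i → a i ⊙ (f i ⊕ ⊖ g i)) (λ i → a i ⊙ g i)) ⟨
      sum (λ i → a i ⊙ (f i ⊕ ⊖ g i) ⊕ a i ⊙ g i) ⊕ ⊖ s g
                                 ≡⟨ cong (_⊕ ⊖ s g) (sum-cong-≗ {n} λ i → trans (sym (R.distribˡ (a i) _ _)) (cong (a i ⊙_)
                                      (trans (R.+-assoc (f i) _ _) (trans (cong (f i ⊕_) (R.-‿inverseˡ (g i))) (R.+-identityʳ _))))) ⟩
      s f ⊕ ⊖ s g                ∎
      where
      open ≡-Reasoning
      s : (Fin n → K) → K
      s f = sum (λ i → a i ⊙ f i)
      d = s (λ i → f i ⊕ ⊖ g i)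

    -- Only the values of `h` are compared, as `Q` depends on nothing else.
    IsDifference : ∀ {n} → Form n → Form n → Form n → Set
    IsDifference D F G = ∀ x → h D x ≡ h F x ⊕ ⊖ h G x

    matrix-difference : ∀ {n} (D A A′ : Fin n → Fin n → K) hD hA hA′ → (∀ i j → D i j ≡ A i j ⊕ ⊖ A′ i j) →
      IsDifference (matrix-form D hD) (matrix-form A hA) (matrix-form A′ hA′)
    matrix-difference {n} D A A′ hD hA hA′ D≡ x = trans
      (sum-cong-≗ {n} λ i → cong (conj (lookup x i) ⊙_) (trans
        (sum-cong-≗ {n} λ j → cong (lookup x j ⊙_) (D≡ i j)) (sum-sub (lookup x) (A i) (A′ i))))
      (sum-sub (λ i → conj (lookup x i)) (combination (column A) x) (combination (column A′) x))

    Q-difference : ∀ {n m} (D F G : Form n) → IsDifference D F G → (Z : Vec (V n) m) → Q D Z ≡ Q F Z ⊕ ⊖ Q G Z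
    Q-difference D F G d []      = sym (R.-‿inverseʳ 0ₖ)
    Q-difference D F G d (z ∷ Z) = begin
      h D z ⊕ Q D Z                                    ≡⟨ cong₂ _⊕_ (d z) (Q-difference D F G d Z) ⟩
      (h F z ⊕ ⊖ h G z) ⊕ (Q F Z ⊕ ⊖ Q G Z)            ≡⟨ solve 4 (λ s t u v → (s :+ t) :+ (u :+ v) := (s :+ u) :+ (t :+ v)) refl _ _ _ _ ⟩
      (h F z ⊕ Q F Z) ⊕ (⊖ h G z ⊕ ⊖ Q G Z)            ≡⟨ cong ((h F z ⊕ Q F Z) ⊕_) (-‿+-comm _ _) ⟩
      (h F z ⊕ Q F Z) ⊕ ⊖ (h G z ⊕ Q G Z)              ∎
      where
      open ≡-Reasoning
      open KSolver

    zero-form : ∀ n → Form n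
    zero-form n = record
      { B = λ _ _ → 0ₖ ; B-+ = λ _ _ _ → sym (R.+-identityˡ 0ₖ) ; B-· = λ c _ _ → sym (R.zeroʳ c) ; B-conj = λ _ _ → conj-0 }

    ψ-even : ∀ s → ψ (⊖ s) ≡ ψ s
    ψ-even s = cong (λ d → + q * d + - 1ℤ) (𝟙-cong (0ₖ ≟ ⊖ s) (0ₖ ≟ s)
      (λ e → trans (sym -0#≈0#) (trans (cong ⊖_ e) (-‿involutive s))) (λ e → trans (sym -0#≈0#) (cong ⊖_ e)))

    -- Cauchy–Schwarz for the fibre sizes of L: q Σₛ |L⁻¹(s)|² ≥ |xs|².
    ψ-positive : ∀ {a} {A : Set a} (xs : List A) (L : A → K) → (∀ x → Real (L x)) →
                 0ℤ ≤ ∑ xs (λ x → ∑ xs λ y → ψ (L x ⊕ ⊖ L y))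
    ψ-positive xs L real = ℤ.*-cancelˡ-≤-pos 0ℤ _ (+ q) (subst₂ _≤_ (sym (ℤ.*-zeroʳ (+ q))) total
      (0≤∑ elems λ s → nonneg s))
      where
      open ≡-Reasoning
      u : ℤ
      u = ∑ xs (λ _ → 1ℤ)
      fibre : K → ℤ
      fibre s = ∑ xs (λ x → 𝟙 (L x ≟ s))
      E = ∑ xs (λ x → ∑ xs λ y → 𝟙 (L y ≟ L x))
      0≤i*i : ∀ i → 0ℤ ≤ i * i
      0≤i*i (+ n)      = subst (0ℤ ≤_) (ℤ.pos-* n n) (+≤+ ℕ.z≤n)
      0≤i*i ℤ.-[1+ n ] = +≤+ ℕ.z≤n
      nonneg : ∀ s → 0ℤ ≤ ε s * ((+ q * fibre s + - u) * (+ q * fibre s + - u))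
      nonneg s with real? s
      ... | yes _ = subst (0ℤ ≤_) (sym (ℤ.*-identityˡ _)) (0≤i*i (+ q * fibre s + - u))
      ... | no _  = ℤ.≤-refl
      ∑ε-fibre : ∀ (g : K → ℤ) → ∑ elems (λ s → fibre s * (ε s * g s)) ≡ ∑ xs (λ x → g (L x))
      ∑ε-fibre g = trans (sym (∑-insert enum xs L (λ s → ε s * g s)))
        (∑-cong xs λ x → trans (cong (_* g (L x)) (𝟙-yes (real? (L x)) (real x))) (ℤ.*-identityˡ _))
      energy : ∑ xs (λ x → ∑ xs λ y → ψ (L x ⊕ ⊖ L y)) ≡ + q * E + - 1ℤ * (u * u)
      energy = begin
        ∑ xs (λ x → ∑ xs λ y → ψ (L x ⊕ ⊖ L y))
          ≡⟨ ∑-cong xs (λ x → ∑-cong xs λ y → cong (λ d → + q * d + - 1ℤ) (𝟙-cong (0ₖ ≟ L x ⊕ ⊖ L y) (L y ≟ L x)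
               (λ e → sym (x⊕⊖y≡0⇒x≡y (L x) (L y) (sym e))) (λ e → sym (trans (cong (λ w → L x ⊕ ⊖ w) e) (R.-‿inverseʳ (L x)))))) ⟩
        ∑ xs (λ x → ∑ xs λ y → + q * 𝟙 (L y ≟ L x) + - 1ℤ * 1ℤ)
          ≡⟨ ∑-cong xs (λ x → trans (∑-+ xs _ _) (cong₂ _+_ (∑-*ˡ xs (+ q) _) (∑-*ˡ xs (- 1ℤ) _))) ⟩
        ∑ xs (λ x → + q * ∑ xs (λ y → 𝟙 (L y ≟ L x)) + - 1ℤ * u)
          ≡⟨ trans (∑-+ xs _ _) (cong₂ _+_ (∑-*ˡ xs (+ q) _)
               (trans (∑-*ˡ xs (- 1ℤ) _) (cong (- 1ℤ *_) (trans (∑-cong xs λ _ → sym (ℤ.*-identityˡ u)) (∑-*ʳ xs u _))))) ⟩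
        + q * E + - 1ℤ * (u * u) ∎
      total : ∑ elems (λ s → ε s * ((+ q * fibre s + - u) * (+ q * fibre s + - u))) ≡
              + q * ∑ xs (λ x → ∑ xs λ y → ψ (L x ⊕ ⊖ L y))
      total = begin
        ∑ elems (λ s → ε s * ((+ q * fibre s + - u) * (+ q * fibre s + - u)))
          ≡⟨ ∑-cong elems (λ s → lem (ε s) (+ q) (fibre s) u) ⟩
        ∑ elems (λ s → + q * + q * (fibre s * (ε s * fibre s)) + (- (+ q * u + + q * u) * (fibre s * (ε s * 1ℤ)) + ε s * (u * u)))
          ≡⟨ trans (∑-+ elems _ _) (cong₂ _+_ (∑-*ˡ elems (+ q * + q) _)
               (trans (∑-+ elems _ _) (cong₂ _+_ (∑-*ˡ elems (- (+ q * u + + q * u)) _) (∑-*ʳ elems (u * u) ε)))) ⟩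
        + q * + q * ∑ elems (λ s → fibre s * (ε s * fibre s)) +
          (- (+ q * u + + q * u) * ∑ elems (λ s → fibre s * (ε s * 1ℤ)) + ∑ elems ε * (u * u))
          ≡⟨ cong₂ (λ v w → + q * + q * v + w) (∑ε-fibre fibre)
               (cong₂ (λ v w → - (+ q * u + + q * u) * v + w * (u * u)) (∑ε-fibre (λ _ → 1ℤ)) ∑ε≡q) ⟩
        + q * + q * E + (- (+ q * u + + q * u) * u + + q * (u * u))
          ≡⟨ lem′ (+ q) E u ⟩
        + q * (+ q * E + - 1ℤ * (u * u))
          ≡⟨ cong (+ q *_) energy ⟨
        + q * ∑ xs (λ x → ∑ xs λ y → ψ (L x ⊕ ⊖ L y)) ∎
        where
        lem : ∀ e x f u → e * ((x * f + - u) * (x * f + - u)) ≡ x * x * (f * (e * f)) + (- (x * u + x * u) * (f * (e * 1ℤ)) + e * (u * u))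
        lem = solve-∀
        lem′ : ∀ x E u → x * x * E + (- (x * u + x * u) * u + x * (u * u)) ≡ x * (x * E + - 1ℤ * (u * u))
        lem′ = solve-∀

    -- `ψ-positive` is summed over the frames and the sums are exchanged. Each pair then counts
    -- through the nullity of its difference: `n` on the diagonal, where the difference is the zero
    -- form, and `j` elsewhere. The common factor ψ(0) is cancelled.
    delsarte : ∀ {n j} (Fs : List (Form n)) →
      AllPairs (λ F G → ∃ λ D → IsDifference D F G × Nullity D j) Fs →
      0ℤ ≤ + List.length Fs * (M n * P n + (+ List.length Fs ℤ.- 1ℤ) * (M n * P j))
    delsarte {n} {j} Fs pairs = ℤ.*-cancelʳ-≤-pos 0ℤ _ (+ suc r) (subst (0ℤ ≤_) (begin
      ∑ (frames n) (λ Z → ∑ Fs λ F → ∑ Fs λ G → ψ (Q F Z ⊕ ⊖ Q G Z))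
        ≡⟨ ∑-swap (frames n) Fs _ ⟩
      ∑ Fs (λ F → ∑ (frames n) λ Z → ∑ Fs λ G → ψ (Q F Z ⊕ ⊖ Q G Z))
        ≡⟨ ∑-cong Fs (λ F → ∑-swap (frames n) Fs _) ⟩
      ∑ Fs (λ F → ∑ Fs (g F))
        ≡⟨ ∑∑-AllPairs g (M n * P n * + suc r) (M n * P j * + suc r) diagonal off-diagonal symmetric pairs ⟩
      + List.length Fs * (M n * P n * + suc r + (+ List.length Fs ℤ.- 1ℤ) * (M n * P j * + suc r))
        ≡⟨ lem (+ List.length Fs) (M n * P n) (M n * P j) (+ suc r) ⟩
      + List.length Fs * (M n * P n + (+ List.length Fs ℤ.- 1ℤ) * (M n * P j)) * + suc r ∎)
      (0≤∑ (frames n) λ Z → ψ-positive Fs (λ F → Q F Z) λ F → Q-real F Z))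
      where
      open ≡-Reasoning
      g : Form n → Form n → ℤ
      g F G = ∑ (frames n) λ Z → ψ (Q F Z ⊕ ⊖ Q G Z)
      lem : ∀ l x y s → l * (x * s + (l + - 1ℤ) * (y * s)) ≡ l * (x + (l + - 1ℤ) * y) * s
      lem = solve-∀
      from-difference : ∀ {i F G} (D : Form n) → IsDifference D F G → Nullity D i → g F G ≡ M n * P i * + suc r
      from-difference {i} {F} {G} D d nul = trans
        (∑-cong (frames n) λ Z → cong ψ (trans (sym (Q-difference D F G d Z)) (sym (R.+-identityˡ _))))
        (trans (∑-frames-Q {j = i} D nul ψ-balanced conj-0) (cong (M n * P i *_) ψ0))
      diagonal : ∀ F → g F F ≡ M n * P n * + suc r
      diagonal F = from-difference {n} (zero-form n) (λ x → sym (R.-‿inverseʳ (h F x))) (zero-nullity (zero-form n) λ _ → refl)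
      off-diagonal : ∀ {F G} → ∃ (λ D → IsDifference D F G × Nullity D j) → g F G ≡ M n * P j * + suc r
      off-diagonal (D , d , nul) = from-difference {j} D d nul
      symmetric : ∀ F G → g F G ≡ g G F
      symmetric F G = ∑-cong (frames n) λ Z → trans (sym (ψ-even _)) (cong ψ (trans (sym (-‿+-comm _ _))
        (trans (cong (⊖ Q F Z ⊕_) (-‿involutive _)) (R.+-comm _ _))))

    -- For the zero form each frame contributes ψ(0) > 0, which makes the product nonnegative. It is
    -- nonzero because no positive power of `b` is 1 or -1.
    M*P-positive : ∀ n → 0ℤ ℤ.< M n * P n
    M*P-positive n = ℤ.≤∧≢⇒< (ℤ.*-cancelʳ-≤-pos 0ℤ _ (+ suc r) (subst (0ℤ ≤_)
        (trans (∑-frames-Q {j = n} (zero-form n) (zero-nullity (zero-form n) λ _ → refl) ψ-balanced conj-0) (cong (M n * P n *_) ψ0))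
        (0≤∑ (frames n) λ Z → subst (λ u → 0ℤ ≤ ψ u) (sym (trans (R.+-identityˡ _) (Q-zero Z))) (subst (0ℤ ≤_) (sym ψ0) (+≤+ ℕ.z≤n)))))
      λ e → ℕ.≢-nonZero⁻¹ ℤ.∣ M n * P n ∣ {{ℤ.i*j≢0 (M n) (P n) {{M≢0 n}} {{P≢0 n}}}} (cong ℤ.∣_∣ (sym e))
      where
      Q-zero : ∀ {m} (Z : Vec (V n) m) → Q (zero-form n) Z ≡ 0ₖ
      Q-zero []      = refl
      Q-zero (z ∷ Z) = trans (R.+-identityˡ _) (Q-zero Z)
      b^e≢-1 : ∀ e → b ^ suc e ≢ - 1ℤ
      b^e≢-1 e eq = contradiction (ℕ.m*n≡1⇒m≡1 q ℤ.∣ b ^ e ∣ (trans (sym (trans (ℤ.abs-* b (b ^ e))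
        (cong (ℕ._* ℤ.∣ b ^ e ∣) (cong ℤ.∣_∣ b≡-q)))) (cong ℤ.∣_∣ eq))) λ ()
      M≢0 : ∀ n → ℤ.NonZero (M n)
      M≢0 zero    = _
      M≢0 (suc n) = ℤ.i*j≢0 (b ^ (n ℕ.+ n) * (b ^ suc n + - 1ℤ)) (M n)
        {{ℤ.i*j≢0 (b ^ (n ℕ.+ n)) (b ^ suc n + - 1ℤ) {{b^≢0 (n ℕ.+ n)}} {{ℤ.≢-nonZero λ e → contradiction
          (b^e≡1⇒e≡0 (suc n) (ℤ.i-j≡0⇒i≡j (b ^ suc n) 1ℤ e)) λ ()}}}} {{M≢0 n}}
      P≢0 : ∀ n → ℤ.NonZero (P n)
      P≢0 zero    = _
      P≢0 (suc n) = ℤ.i*j≢0 (b ^ suc n + 1ℤ) (P n) {{ℤ.≢-nonZero λ e → b^e≢-1 n (ℤ.i-j≡0⇒i≡j (b ^ suc n) (- 1ℤ) e)}} {{P≢0 n}}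

    -- Signs of the factors and the final inequality

    b^≡ : ∀ e → b ^ e ≡ negOnePow e * + (q ℕ.^ e)
    b^≡ zero    = refl
    b^≡ (suc e) = begin
      b * b ^ e                                 ≡⟨ cong₂ _*_ b≡-q (b^≡ e) ⟩
      - (+ q) * (negOnePow e * + (q ℕ.^ e))     ≡⟨ lem (+ q) (negOnePow e) (+ (q ℕ.^ e)) ⟩
      - negOnePow e * (+ q * + (q ℕ.^ e))       ≡⟨ cong (- negOnePow e *_) (ℤ.pos-* q (q ℕ.^ e)) ⟨
      - negOnePow e * + (q ℕ.* q ℕ.^ e)         ∎
      where
      open ≡-Reasoning
      lem : ∀ x s y → - x * (s * y) ≡ - s * (x * y)
      lem = solve-∀

    negOnePow² : ∀ e → negOnePow e * negOnePow e ≡ 1ℤ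
    negOnePow² zero    = refl
    negOnePow² (suc e) = trans (lem (negOnePow e)) (negOnePow² e)
      where
      lem : ∀ s → - s * - s ≡ s * s
      lem = solve-∀

    factor : ℕ → ℕ → ℤ
    factor n i = + (q ℕ.^ (n ℕ.∸ i ℕ.+ 1)) + negOnePow (n ℕ.∸ i ℕ.+ 1)

    signs : ℕ → ℕ → ℤ
    signs n k = prodFrom1 k (λ i → negOnePow (n ℕ.∸ i ℕ.+ 1))

    -- For every e, b^e + 1 = (-1)^e (q^e + (-1)^e). The exponents run from n down to j + 1, as in
    -- the bound, with the signs collected apart from the absolute values.
    P-factor : ∀ n k j → k ℕ.+ j ≡ n → P n ≡ signs n k * prodFrom1 k (factor n) * P j
    P-factor n zero    j refl = sym (trans (cong (_* P n) (ℤ.*-identityˡ 1ℤ)) (ℤ.*-identityˡ (P n)))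
    P-factor n (suc k) j refl = begin
      P n
        ≡⟨ P-factor n k (suc j) (ℕ.+-suc k j) ⟩
      signs n k * prodFrom1 k (factor n) * ((b ^ suc j + 1ℤ) * P j)
        ≡⟨ cong (λ u → signs n k * prodFrom1 k (factor n) * (u * P j)) step ⟩
      signs n k * prodFrom1 k (factor n) * (negOnePow (suc j) * (+ (q ℕ.^ suc j) + negOnePow (suc j)) * P j)
        ≡⟨ cong (λ e → signs n k * prodFrom1 k (factor n) * (negOnePow e * (+ (q ℕ.^ e) + negOnePow e) * P j)) exponent ⟨
      signs n k * prodFrom1 k (factor n) * (negOnePow (n ℕ.∸ suc k ℕ.+ 1) * factor n (suc k) * P j)
        ≡⟨ lem (signs n k) (prodFrom1 k (factor n)) (negOnePow (n ℕ.∸ suc k ℕ.+ 1)) (factor n (suc k)) (P j) ⟩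
      signs n (suc k) * prodFrom1 (suc k) (factor n) * P j ∎
      where
      open ≡-Reasoning
      exponent : n ℕ.∸ suc k ℕ.+ 1 ≡ suc j
      exponent = trans (ℕ.+-comm _ 1) (cong suc (ℕ.m+n∸m≡n (suc k) j))
      step : b ^ suc j + 1ℤ ≡ negOnePow (suc j) * (+ (q ℕ.^ suc j) + negOnePow (suc j))
      step = trans (cong₂ _+_ (b^≡ (suc j)) (sym (negOnePow² (suc j)))) (sym (ℤ.*-distribˡ-+ (negOnePow (suc j)) _ _))
      lem : ∀ s f t g P → s * f * (t * g * P) ≡ s * t * (f * g) * P
      lem = solve-∀

    -- Neighbouring exponents have opposite signs. The hypothesis keeps the truncated subtraction
    -- from repeating an exponent.
    signs-+2 : ∀ n k → suc (suc k) ℕ.≤ n → signs n (suc (suc k)) ≡ - signs n k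
    signs-+2 n k k+2≤n = begin
      signs n k * negOnePow (n ℕ.∸ suc k ℕ.+ 1) * negOnePow e
        ≡⟨ cong (λ d → signs n k * negOnePow (d ℕ.+ 1) * negOnePow e) (ℕ.+-∸-assoc 1 k+2≤n) ⟩
      signs n k * - negOnePow e * negOnePow e
        ≡⟨ lem (signs n k) (negOnePow e) ⟩
      - (signs n k * (negOnePow e * negOnePow e))
        ≡⟨ cong -_ (trans (cong (signs n k *_) (negOnePow² e)) (ℤ.*-identityʳ _)) ⟩
      - signs n k ∎
      where
      open ≡-Reasoning
      e = n ℕ.∸ suc (suc k) ℕ.+ 1
      lem : ∀ s t → s * - t * t ≡ - (s * (t * t))
      lem = solve-∀

    -- The factors form 2 l + 1 neighbouring pairs, an odd number.
    signs-2mod4 : ∀ n l → 2 ℕ.+ l ℕ.* 4 ℕ.≤ n → signs n (2 ℕ.+ l ℕ.* 4) ≡ - 1ℤ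
    signs-2mod4 n zero    le = signs-+2 n 0 le
    signs-2mod4 n (suc l) le = begin
      signs n (6 ℕ.+ l ℕ.* 4)      ≡⟨ signs-+2 n (4 ℕ.+ l ℕ.* 4) le ⟩
      - signs n (4 ℕ.+ l ℕ.* 4)    ≡⟨ cong -_ (signs-+2 n (2 ℕ.+ l ℕ.* 4) (ℕ.≤-trans (ℕ.m≤n+m _ 2) le)) ⟩
      - - signs n (2 ℕ.+ l ℕ.* 4)  ≡⟨ ℤ.neg-involutive _ ⟩
      signs n (2 ℕ.+ l ℕ.* 4)      ≡⟨ signs-2mod4 n l (ℕ.≤-trans (ℕ.m≤n+m _ 4) le) ⟩
      - 1ℤ                         ∎
      where open ≡-Reasoning

    0≤factor : ∀ n i → 0ℤ ≤ factor n i
    0≤factor n i = ℤ.+-mono-≤ (+≤+ (ℕ.m^n>0 q e)) (-1≤negOnePow e)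
      where
      e = n ℕ.∸ i ℕ.+ 1
      sign-cases : ∀ e → negOnePow e ≡ 1ℤ ⊎ negOnePow e ≡ - 1ℤ
      sign-cases zero = inj₁ refl
      sign-cases (suc e) with sign-cases e
      ... | inj₁ s = inj₂ (cong -_ s)
      ... | inj₂ s = inj₁ (cong -_ s)
      -1≤negOnePow : ∀ e → - 1ℤ ≤ negOnePow e
      -1≤negOnePow e with sign-cases e
      ... | inj₁ s = subst (- 1ℤ ≤_) (sym s) ℤ.-≤+
      ... | inj₂ s = ℤ.≤-reflexive (sym s)

    0≤product : ∀ n k → 0ℤ ≤ prodFrom1 k (factor n)
    0≤product n zero    = +≤+ ℕ.z≤n
    0≤product n (suc k) = subst (_≤ prodFrom1 k (factor n) * factor n (suc k)) (ℤ.*-zeroʳ (prodFrom1 k (factor n)))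
      (ℤ.*-monoˡ-≤-nonNeg (prodFrom1 k (factor n)) {{ℤ.nonNegative (0≤product n k)}} (0≤factor n (suc k)))

    -- From M(n) P(n) = -Y Π > 0 and Π ≥ 0 it follows that -Y > 0. The clique inequality becomes 0 ≤
    -- u (-Y) (Π - (u - 1)), and cancelling the positive factors leaves u - 1 ≤ Π. The empty list is
    -- separate because u itself is cancelled.
    form-bound : ∀ {n j} l → 2 ℕ.+ l ℕ.* 4 ℕ.+ j ≡ n → (Fs : List (Form n)) →
      AllPairs (λ F G → ∃ λ D → IsDifference D F G × Nullity D j) Fs →
      + List.length Fs ≤ 1ℤ + prodFrom1 (2 ℕ.+ l ℕ.* 4) (factor n)
    form-bound {n} {j} l k+j≡n []         _     = ℤ.+-mono-≤ (+≤+ {0} ℕ.z≤n) (0≤product n (2 ℕ.+ l ℕ.* 4))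
    form-bound {n} {j} l k+j≡n Fs@(_ ∷ _) pairs = ℤ.i-j≤0⇒i≤j (ℤ.≮⇒≥ λ 0<gap → ℤ.<⇒≱ (negative 0<gap) 0≤value)
      where
      open ≡-Reasoning
      k = 2 ℕ.+ l ℕ.* 4
      Π u Y : ℤ
      Π = prodFrom1 k (factor n)
      u = + List.length Fs
      Y = M n * P j
      MPn : M n * P n ≡ - Y * Π
      MPn = begin
        M n * P n                    ≡⟨ cong (M n *_) (P-factor n k j k+j≡n) ⟩
        M n * (signs n k * Π * P j)  ≡⟨ cong (λ s → M n * (s * Π * P j)) (signs-2mod4 n l (subst (k ℕ.≤_) k+j≡n (ℕ.m≤m+n k j))) ⟩
        M n * (- 1ℤ * Π * P j)       ≡⟨ lem (M n) Π (P j) ⟩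
        - Y * Π                      ∎
        where
        lem : ∀ M F P → M * (- 1ℤ * F * P) ≡ - (M * P) * F
        lem = solve-∀
      0<-Y : 0ℤ ℤ.< - Y
      0<-Y = ℤ.≰⇒> λ -Y≤0 → ℤ.<⇒≱ (M*P-positive n) (subst₂ _≤_ (sym MPn) (ℤ.*-zeroˡ Π)
        (ℤ.*-monoʳ-≤-nonNeg Π {{ℤ.nonNegative (0≤product n k)}} -Y≤0))
      0≤value : 0ℤ ≤ - Y * (Π + - (u ℤ.- 1ℤ))
      0≤value = ℤ.*-cancelˡ-≤-pos 0ℤ _ u (subst₂ _≤_ (sym (ℤ.*-zeroʳ u)) (cong (u *_)
        (trans (cong (_+ (u ℤ.- 1ℤ) * Y) MPn) (lem Y Π (u ℤ.- 1ℤ)))) (delsarte {j = j} Fs pairs))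
        where
        lem : ∀ Y F v → - Y * F + v * Y ≡ - Y * (F + - v)
        lem = solve-∀
      negative : 0ℤ ℤ.< u ℤ.- (1ℤ + Π) → - Y * (Π + - (u ℤ.- 1ℤ)) ℤ.< 0ℤ
      negative 0<gap = subst₂ ℤ._<_ (lem Y Π u) refl (ℤ.neg-mono-< (subst (ℤ._< - Y * (u ℤ.- (1ℤ + Π))) (ℤ.*-zeroʳ (- Y))
        (ℤ.*-monoˡ-<-pos (- Y) {{ℤ.positive 0<-Y}} 0<gap)))
        where
        lem : ∀ Y F u → - (- Y * (u + - (1ℤ + F))) ≡ - Y * (F + - (u + - 1ℤ))
        lem = solve-∀

    -- Transfer to the given field

    module Transfer {c ℓ} (F : FiniteField c ℓ) {val : K → FiniteField.Carrier F}
                      (val-mono : IsRingMonomorphism R.rawRing (CommutativeRing.rawRing (FiniteField.commRing F)) val)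
                      (idx : FiniteField.Carrier F → K) (val-idx : ∀ x → FiniteField._≈_ F (val (idx x)) x) where
      open FiniteField F using (Carrier; _≈_; commRing; pow; sumFin; LinIndep; HasIndepCols; RankEq; Hermitian; HermitianSet; ConstRankDist; Matrix) renaming (_⊖_ to _−_)
      module C = CommutativeRing commRing
      open IsRingMonomorphism val-mono using (+-homo; *-homo; -‿homo; 0#-homo; 1#-homo) renaming (injective to val-injective)
      open import Relation.Binary.Reasoning.Setoid C.setoid

      val-pow : ∀ x e → val (x ^ₖ e) ≈ pow (val x) e
      val-pow x zero    = 1#-homo
      val-pow x (suc e) = C.trans (*-homo _ _) (C.*-congˡ (val-pow x e))

      pow-cong : ∀ {x y} e → x ≈ y → pow x e ≈ pow y e
      pow-cong zero    x≈y = C.refl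
      pow-cong (suc e) x≈y = C.*-cong x≈y (pow-cong e x≈y)

      val-sum : ∀ {n} (f : Fin n → K) (g : Fin n → Carrier) → (∀ i → val (f i) ≈ g i) → val (sum f) ≈ sumFin g
      val-sum {zero}  f g e = 0#-homo
      val-sum {suc n} f g e = C.trans (+-homo _ _) (C.+-cong (e zero) (val-sum (λ i → f (suc i)) (λ i → g (suc i)) λ i → e (suc i)))

      val≈0⇒≡0 : ∀ {x} → val x ≈ C.0# → x ≡ 0ₖ
      val≈0⇒≡0 e = val-injective (C.trans e (C.sym 0#-homo))

      lookup≡0⇒≡0ᵥ : ∀ {n} (v : V n) → (∀ i → lookup v i ≡ 0ₖ) → v ≡ 0ᵥ
      lookup≡0⇒≡0ᵥ Vec.[]       e = refl
      lookup≡0⇒≡0ᵥ (x Vec.∷ v) e = cong₂ Vec._∷_ (e zero) (lookup≡0⇒≡0ᵥ v λ i → e (suc i))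

      ⟦_⟧ : ∀ {n} → Matrix n → Fin n → Fin n → K
      ⟦ A ⟧ i j = idx (A i j)

      hermitian : ∀ {n} (A : Matrix n) → Hermitian q A → ∀ i j → conj (⟦ A ⟧ i j) ≡ ⟦ A ⟧ j i
      hermitian A herm i j = val-injective (begin
        val (⟦ A ⟧ i j ^ₖ q)     ≈⟨ val-pow (⟦ A ⟧ i j) q ⟩
        pow (val (⟦ A ⟧ i j)) q  ≈⟨ pow-cong q (val-idx (A i j)) ⟩
        pow (A i j) q            ≈⟨ herm i j ⟨
        A j i                    ≈⟨ val-idx (A j i) ⟨
        val (⟦ A ⟧ j i)          ∎)

      ⟦−⟧ : ∀ {n} (A A′ : Matrix n) i j → ⟦ A − A′ ⟧ i j ≡ ⟦ A ⟧ i j ⊕ ⊖ ⟦ A′ ⟧ i j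
      ⟦−⟧ A A′ i j = val-injective (begin
        val (idx (A i j C.- A′ i j))                  ≈⟨ val-idx _ ⟩
        A i j C.- A′ i j                              ≈⟨ C.+-cong (val-idx _) (C.trans (-‿homo _) (C.-‿cong (val-idx _))) ⟨
        val (⟦ A ⟧ i j) C.+ val (⊖ ⟦ A′ ⟧ i j)        ≈⟨ +-homo _ _ ⟨
        val (⟦ A ⟧ i j ⊕ ⊖ ⟦ A′ ⟧ i j)                ∎)

      hermitian-− : ∀ {n} (A A′ : Matrix n) → Hermitian q A → Hermitian q A′ → ∀ i j → conj (⟦ A − A′ ⟧ i j) ≡ ⟦ A − A′ ⟧ j i
      hermitian-− A A′ hA hA′ i j = trans (cong conj (⟦−⟧ A A′ i j)) (trans (conj-⊕ _ _)
        (trans (cong₂ _⊕_ (hermitian A hA i j) (trans (conj-⊖ _) (cong ⊖_ (hermitian A′ hA′ i j)))) (sym (⟦−⟧ A A′ j i))))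

      module _ {n} (A : Matrix n) where

        val-combination : ∀ {k} (σ : Fin k → Fin n) (c : V k) (g : Fin k → Carrier) → (∀ j → val (lookup c j) ≈ g j) →
          ∀ i → val (combination (λ j → column ⟦ A ⟧ (σ j)) c i) ≈ sumFin (λ j → g j C.* A i (σ j))
        val-combination σ c g e i = val-sum _ _ λ j → C.trans (*-homo _ _) (C.*-cong (e j) (val-idx _))

        independent : ∀ {k} (σ : Fin k → Fin n) → LinIndep (λ j i → A i (σ j)) → Independent (λ j → column ⟦ A ⟧ (σ j))
        independent σ ind c e = lookup≡0⇒≡0ᵥ c λ j → val≈0⇒≡0 (ind (λ j → val (lookup c j))
          (λ i → C.trans (C.sym (val-combination σ c _ (λ _ → C.refl) i)) (C.trans (C.reflexive (cong val (e i))) 0#-homo)) j)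

        -- A column outside the span would extend the chosen ones to k + 1 independent columns.
        -- Membership in the span is decided by searching all coefficient vectors.
        maximal⇒spans : ∀ {k} (σ : Fin k → Fin n) → Injective _≡_ _≡_ σ → LinIndep (λ j i → A i (σ j)) → ¬ HasIndepCols A (suc k) →
          ∀ t → ∃ λ c → ∀ i → column ⟦ A ⟧ t i ≡ combination (λ j → column ⟦ A ⟧ (σ j)) c i
        maximal⇒spans {k} σ σ-inj ind ¬max t with ∃? (enumᵥ k) (λ c → column ⟦ A ⟧ t ≗? combination (λ j → column ⟦ A ⟧ (σ j)) c)
        ... | yes c = c
        ... | no ∉span = ⊥-elim (¬max (τ , (λ {i} {j} → τ-inj {i} {j}) , τ-ind))
          where
          a : Fin k → Fin n → K
          a j = column ⟦ A ⟧ (σ j)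
          τ : Fin (suc k) → Fin n
          τ zero    = t
          τ (suc j) = σ j
          t≢σ : ∀ j → t ≢ σ j
          -- A chosen column is a combination with a unit vector as coefficients, so a column
          -- outside the span is a new one and `τ` stays injective.
          t≢σ j t≡σj = ∉span (Vec.tabulate (indicator j) , λ i → trans (cong (λ s → ⟦ A ⟧ i s) t≡σj)
            (sym (trans (sum-cong-≗ {k} λ l → trans (cong (_⊙ a l i) (Vec.lookup∘tabulate (indicator j) l)) (R.*-comm _ _))
              (sum-indicator j (λ l → a l i)))))
          τ-inj : Injective _≡_ _≡_ τ
          τ-inj {zero}  {zero}  e = refl
          τ-inj {zero}  {suc j} e = contradiction e (t≢σ j)
          τ-inj {suc i} {zero}  e = contradiction (sym e) (t≢σ i)
          τ-inj {suc i} {suc j} e = cong suc (σ-inj e)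
          τ-ind : LinIndep (λ j i → A i (τ j))
          τ-ind g e = go
            where
            s = idx (g zero)
            c′ = Vec.tabulate (λ j → idx (g (suc j)))
            lookup-c′ : ∀ j → val (lookup c′ j) ≈ g (suc j)
            lookup-c′ j = C.trans (C.reflexive (cong val (Vec.lookup∘tabulate (λ j → idx (g (suc j))) j))) (val-idx _)
            vanish : ∀ i → s ⊙ column ⟦ A ⟧ t i ⊕ combination a c′ i ≡ 0ₖ
            vanish i = val≈0⇒≡0 (C.trans (+-homo _ _) (C.trans (C.+-cong
              (C.trans (*-homo _ _) (C.*-cong (val-idx (g zero)) (val-idx (A i t)))) (val-combination σ c′ _ lookup-c′ i)) (e i)))
            both : s ≡ 0ₖ × c′ ≡ 0ᵥ
            both = outside-span a (independent σ ind) (column ⟦ A ⟧ t) ∉span s c′ vanish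
            go : ∀ j → g j ≈ C.0#
            go zero    = C.trans (C.sym (val-idx _)) (C.trans (C.reflexive (cong val (proj₁ both))) 0#-homo)
            go (suc j) = C.trans (C.sym (lookup-c′ j)) (C.trans
              (C.reflexive (cong val (trans (cong (λ v → lookup v j) (proj₂ both)) (Vec.lookup-replicate j 0ₖ)))) 0#-homo)

        rank-nullity : ∀ {k} → RankEq A k → (herm : ∀ i j → conj (⟦ A ⟧ i j) ≡ ⟦ A ⟧ j i) →
          ∃ λ j → k ℕ.+ j ≡ n × Nullity (matrix-form ⟦ A ⟧ herm) j
        rank-nullity ((σ , σ-inj , ind) , ¬max) herm =
          rank⇒nullity ⟦ A ⟧ herm σ (independent σ ind) (λ t → proj₁ (spans t)) (λ t → proj₂ (spans t))
          where spans = maximal⇒spans σ σ-inj ind ¬max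

      forms : ∀ {n} {U : List (Matrix n)} → All (Hermitian q) U → List (Form n)
      forms []                = []
      forms {U = A ∷ _} (h ∷ hs) = matrix-form ⟦ A ⟧ (hermitian A h) ∷ forms hs

      length-forms : ∀ {n} {U : List (Matrix n)} (hs : All (Hermitian q) U) → length (forms hs) ≡ length U
      length-forms []       = refl
      length-forms (_ ∷ hs) = cong suc (length-forms hs)

      form-differences : ∀ {n k} {U : List (Matrix n)} (hs : All (Hermitian q) U) → AllPairs (λ A A′ → RankEq (A − A′) k) U →
        AllPairs (λ G G′ → ∃ λ D → IsDifference D G G′ × Nullity D (n ℕ.∸ k)) (forms hs)
      form-differences []       []       = []
      form-differences {n} {k} (hA ∷ hs) (ds ∷ pairs) = row hA hs ds ∷ form-differences hs pairs
        where
        row : ∀ {A} (hA : Hermitian q A) {U} (hs : All (Hermitian q) U) → All (λ A′ → RankEq (A − A′) k) U →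
          All (λ G′ → ∃ λ D → IsDifference D (matrix-form ⟦ A ⟧ (hermitian A hA)) G′ × Nullity D (n ℕ.∸ k)) (forms hs)
        row hA []       []       = []
        row {A} hA {A′ ∷ _} (hA′ ∷ hs) (d ∷ ds) =
          let hD = hermitian-− A A′ hA hA′
              j , k+j≡n , nul = rank-nullity (A − A′) d hD
          in (matrix-form ⟦ A − A′ ⟧ hD , matrix-difference ⟦ A − A′ ⟧ ⟦ A ⟧ ⟦ A′ ⟧ hD (hermitian A hA) (hermitian A′ hA′) (⟦−⟧ A A′) ,
              -- The nullity is found separately for each pair; k + j = n turns it into the common
              -- value `n ∸ k`.
              subst (Nullity (matrix-form ⟦ A − A′ ⟧ hD)) (trans (sym (ℕ.m+n∸m≡n k j)) (cong (ℕ._∸ k) k+j≡n)) nul) ∷ row hA hs ds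

      matrix-bound : ∀ {n} l → 2 ℕ.+ l ℕ.* 4 ℕ.≤ n → (U : List (Matrix n)) → HermitianSet q U → ConstRankDist (2 ℕ.+ l ℕ.* 4) U →
        + length U ≤ bound q n (2 ℕ.+ l ℕ.* 4)
      matrix-bound {n} l k≤n U (_ , hs) (pairs , _) = subst (λ u → + u ≤ bound q n (2 ℕ.+ l ℕ.* 4)) (length-forms hs)
        (form-bound {j = n ℕ.∸ (2 ℕ.+ l ℕ.* 4)} l (ℕ.m+[n∸m]≡n k≤n) (forms hs) (form-differences hs pairs))

  -- The copy of the given field on an initial segment of the naturals

  module Discretize {c ℓ} (F : FiniteField c ℓ) where
    open FiniteField F using (Carrier; _≈_; elements; complete; distinct; commRing; size; pow; sumFin; LinIndep; HasIndepCols; RankEq; Hermitian; Matrix; _⊖_)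
    private module F = FiniteField F
    module C = CommutativeRing commRing
    open import Relation.Binary.Reasoning.Setoid C.setoid

    val : Fin size → Carrier
    val = List.lookup elements

    idx : Carrier → Fin size
    idx x = Any.index (complete x)

    val-idx : ∀ x → val (idx x) ≈ x
    val-idx x = C.sym (lookup-index (complete x))

    val-injective : ∀ {i j} → val i ≈ val j → i ≡ j
    val-injective = go distinct _ _
      where
      go : ∀ {xs} → AllPairs (λ x y → ¬ (x ≈ y)) xs → ∀ i j → List.lookup xs i ≈ List.lookup xs j → i ≡ j
      go (_ ∷ _)  zero    zero    e = refl
      go (d ∷ _)  zero    (suc j) e = contradiction e (All.lookup d (∈-lookup j))
      go (d ∷ _)  (suc i) zero    e = contradiction (C.sym e) (All.lookup d (∈-lookup i))
      go (_ ∷ ds) (suc i) (suc j) e = cong suc (go ds i j e)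

    idx-cong : ∀ {x y} → x ≈ y → idx x ≡ idx y
    idx-cong {x} {y} e = val-injective (C.trans (val-idx x) (C.trans e (C.sym (val-idx y))))

    rawRing : RawRing _ _
    rawRing = record
      { Carrier = Fin size ; _≈_ = _≡_
      ; _+_ = λ i j → idx (val i C.+ val j) ; _*_ = λ i j → idx (val i C.* val j) ; -_ = λ i → idx (C.- val i)
      ; 0# = idx C.0# ; 1# = idx C.1# }

    val-mono : IsRingMonomorphism rawRing C.rawRing val
    val-mono = record
      { isRingHomomorphism = record
        { isSemiringHomomorphism = record
          { isNearSemiringHomomorphism = record
            { +-isMonoidHomomorphism = record
              { isMagmaHomomorphism = record
                { isRelHomomorphism = record { cong = λ { refl → C.refl } }
                ; homo = λ i j → val-idx (val i C.+ val j) }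
              ; ε-homo = val-idx C.0# }
            ; *-homo = λ i j → val-idx (val i C.* val j) }
          ; 1#-homo = val-idx C.1# }
        ; -‿homo = λ i → val-idx (C.- val i) }
      ; injective = val-injective }

    -- The ring laws are pulled back along `val`, which is a monomorphism because `idx` only picks a
    -- listed representative of each element.
    discrete : DiscreteField size
    discrete = record
      { _⊕_ = λ i j → idx (val i C.+ val j) ; _⊙_ = λ i j → idx (val i C.* val j) ; ⊖_ = λ i → idx (C.- val i)
      ; 0ₖ = idx C.0# ; 1ₖ = idx C.1#
      ; isCommutativeRing = RingMonomorphism.isCommutativeRing val-mono C.isCommutativeRing
      ; 1≢0 = λ e → F.1≉0 (C.trans (C.sym (val-idx C.1#)) (C.trans (C.reflexive (cong val e)) (val-idx C.0#)))
      ; inverse = inv }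
      where
      inv : ∀ i → i ≢ idx C.0# → ∃ λ j → idx (val i C.* val j) ≡ idx C.1#
      inv i i≢0 with F.inverse (val i) (λ e → i≢0 (val-injective (C.trans e (C.sym (val-idx C.0#)))))
      ... | y , e = idx y , idx-cong (C.trans (C.*-congˡ (val-idx y)) e)

  2≤p^[1+m] : ∀ {p} m → Prime p → 2 ℕ.≤ p ℕ.^ suc m
  2≤p^[1+m] {p} m p-prime = ℕ.≤-trans (ℕ.nonTrivial⇒n>1 p) (subst (ℕ._≤ p ℕ.^ suc m) (ℕ.*-identityʳ p)
    (ℕ.*-monoʳ-≤ p (ℕ.m^n>0 p {{ℕ.nonTrivial⇒nonZero p}} m)))
    where instance _ = prime⇒nonTrivial p-prime

open import Data.Nat using (ℕ; _≤_; _%_; _*_)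
open import Data.Integer using (+_) renaming (_≤_ to _≤ℤ_)
open import Data.List using (List; length)
open import Relation.Binary.PropositionalEquality using (_≡_; refl; sym; trans; cong; subst)
import Data.Nat as ℕ
import Data.Nat.Properties as ℕ
open import Data.Nat.DivMod using (m≡m%n+[m/n]*n; _/_)
open import Data.Product using (∃; _,_)

theorem4p5 : ∀ {c ℓ : Level} (q : ℕ) → IsPrimePower q →
    (F : FiniteField c ℓ) → FiniteField.size F ≡ q * q →
    (n k : ℕ) → 1 ≤ n → 1 ≤ k → k ≤ n → k % 4 ≡ 2 →
    (U : List (FiniteField.Matrix F n)) →
    FiniteField.HermitianSet F q U →
    FiniteField.ConstRankDist F k U →
    + (length U) ≤ℤ bound q n k
theorem4p5 q (p , m , p-prime , q≡) F N≡ n k _ _ k≤n k%4≡2 U =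
  prove (ℕ.m≤n⇒∃[o]m+o≡n (subst (2 ≤_) (sym q≡) (Development.2≤p^[1+m] m p-prime)))
  where
  open Development.Discretize F
  open FiniteField F using (HermitianSet; ConstRankDist)

  k≡2+4l : k ≡ 2 ℕ.+ k / 4 * 4
  k≡2+4l = trans (m≡m%n+[m/n]*n k 4) (cong (ℕ._+ k / 4 * 4) k%4≡2)

  -- Matching replaces `q` by `2 + r`, the shape in which the geometry takes it, and `subst` brings
  -- `k` into the shape 2 + 4 l.
  prove : (∃ λ r → 2 ℕ.+ r ≡ q) → HermitianSet q U → ConstRankDist k U → + length U ≤ℤ bound q n k
  prove (r , refl) = subst (λ k → HermitianSet q U → ConstRankDist k U → + length U ≤ℤ bound q n k) (sym k≡2+4l)
    (matrix-bound (k / 4) (subst (_≤ n) k≡2+4l k≤n) U)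
    where open Development.HermitianGeometry.Transfer discrete p m r p-prime q≡ N≡ F val-mono idx val-idx using (matrix-bound)
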